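{- Let $G$ be a finite connected simple graph. Then the matching polytope $P_M(G)$ is Gorenstein if and only if $G$ is one of the following: (a) a bipartite graph all of whose essential vertices have the same degree; (b) the $5$-cycle $C_5$; (c) a graph all of whose essential vertices have degree $3$ and each of whose blocks is bipartite, $K_3$, $K_4$, $K_{1,1,2}$, or $C'_5$.
   Context: For a graph $G$ with edge set $E$, a matching $m\subseteq E$ is identified with its indicator vector in $\mathbb{R}^E$; the matching polytope $P_M(G)\subset\mathbb{R}^E$ is the convex hull of the indicator vectors of all matchings of $G$. A lattice polytope $P\subset\mathbb{R}^d$ is reflexive if both $P$ and its polar dual $P^*=\{y\in\mathbb{R}^d:\langle x,y\rangle\ge -1 \text{ for all } x\in P\}$ are lattice polytopes; $P$ is Gorenstein if there exist $k\in\mathbb{Z}_{>0}$ and $\alpha\in\mathbb{Z}^d$ such that $kP-\alpha$ is reflexive (equivalently, its Ehrhart ring is Gorenstein). A vertex $u$ of $G$ is essential if (1) $\deg_G(u)=1$ and its neighbor also has degree $1$, or (2) $\deg_G(u)=2$ and its two neighbors are not adjacent, or (3) $\deg_G(u)\ge 3$. A block is a maximal connected subgraph without a cut vertex. $K_{1,1,2}$ is the complete multipartite graph with parts of sizes $1,1,2$ (i.e. $K_4$ minus an edge). $C'_5$ is the graph on vertex set $\mathbb{Z}_5$ with edges $\{i,i+1\}$ for $i\in\mathbb{Z}_5$ together with the two chords $\{1,3\},\{2,4\}$.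
   Formalization: The matching polytope, its dilates and its polar dual are taken in rational rather than real space (rational points, rational convex coefficients, rational polar vectors); since all these polyhedra are rational, this agrees with the real notion of Gorenstein. -}

module Defs where

open import Data.Nat as ℕ using (ℕ; zero; suc)
open import Data.Integer as ℤ using (ℤ)
open import Data.Rational as ℚ using (ℚ; 0ℚ; 1ℚ)
open import Data.Fin as Fin using (Fin; toℕ)
open import Data.Bool using (Bool; true; false; _∨_; _∧_)
open import Data.List using (List; []; _∷_)
open import Data.Product using (Σ; ∃; _×_; _,_; proj₁; proj₂)
open import Data.Sum using (_⊎_)
open import Relation.Nullary using (¬_)
open import Relation.Nullary.Decidable using (⌊_⌋)
open import Relation.Binary.PropositionalEquality using (_≡_; _≢_)

SameEnds : ∀ {n} → Fin n × Fin n → Fin n × Fin n → Set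
SameEnds (a , b) (c , d) = (a ≡ c × b ≡ d) ⊎ (a ≡ d × b ≡ c)

record Graph : Set where
  field
    n        : ℕ
    m        : ℕ
    ends     : Fin m → Fin n × Fin n
    loopless : ∀ e → proj₁ (ends e) ≢ proj₂ (ends e)
    noMulti  : ∀ e e′ → SameEnds (ends e) (ends e′) → e ≡ e′

module _ (G : Graph) where
  open Graph G

  Incident : Fin m → Fin n → Set
  Incident e u = (proj₁ (ends e) ≡ u) ⊎ (proj₂ (ends e) ≡ u)

  incident? : Fin m → Fin n → Bool
  incident? e u = ⌊ proj₁ (ends e) Fin.≟ u ⌋ ∨ ⌊ proj₂ (ends e) Fin.≟ u ⌋

  Adj : Fin n → Fin n → Set
  Adj u v = ∃ λ e → SameEnds (ends e) (u , v)

  degree : Fin n → ℕ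
  degree u = go m (λ e → incident? e u)
    where
    go : (k : ℕ) → (Fin k → Bool) → ℕ
    go zero    f = 0
    go (suc k) f = (if′ (f Fin.zero)) ℕ.+ go k (λ i → f (Fin.suc i))
      where
      if′ : Bool → ℕ
      if′ true  = 1
      if′ false = 0

  Essential : Fin n → Set
  Essential u =
      (degree u ≡ 1 × (∀ v → Adj u v → degree v ≡ 1))
    ⊎ (degree u ≡ 2 × (∀ v w → Adj u v → Adj u w → v ≢ w → ¬ Adj v w))
    ⊎ (3 ℕ.≤ degree u)

  record Subgraph : Set where
    field
      S      : Fin n → Bool
      F      : Fin m → Bool
      closed : ∀ e → F e ≡ true →
               S (proj₁ (ends e)) ≡ true × S (proj₂ (ends e)) ≡ true

  whole : Subgraph
  whole = record { S = λ _ → true ; F = λ _ → true ; closed = λ _ _ → _≡_.refl , _≡_.refl }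

  SAdj : (Fin m → Bool) → Fin n → Fin n → Set
  SAdj F u v = ∃ λ e → F e ≡ true × SameEnds (ends e) (u , v)

  data Reach (S : Fin n → Bool) (F : Fin m → Bool) : Fin n → Fin n → Set where
    here : ∀ {u} → S u ≡ true → Reach S F u u
    step : ∀ {u w v} → S u ≡ true → S w ≡ true → SAdj F u w → Reach S F w v → Reach S F u v

  ConnectedSub : Subgraph → Set
  ConnectedSub H = (∃ λ u → S u ≡ true) ×
                   (∀ u v → S u ≡ true → S v ≡ true → Reach S F u v)
    where open Subgraph H

  deleteS : (Fin n → Bool) → Fin n → Fin n → Bool
  deleteS S x u = S u ∧ Data.Bool.not ⌊ u Fin.≟ x ⌋
    where import Data.Bool

  deleteF : (Fin m → Bool) → Fin n → Fin m → Bool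
  deleteF F x e = F e ∧ Data.Bool.not (incident? e x)
    where import Data.Bool

  -- (for connected H) x is a cut vertex of H iff H - x is disconnected
  CutVertex : Subgraph → Fin n → Set
  CutVertex H x = S x ≡ true ×
    ∃ λ u → ∃ λ v → deleteS S x u ≡ true × deleteS S x v ≡ true ×
      ¬ Reach (deleteS S x) (deleteF F x) u v
    where open Subgraph H

  _⊆ₛ_ : Subgraph → Subgraph → Set
  H ⊆ₛ H′ = (∀ u → Subgraph.S H u ≡ true → Subgraph.S H′ u ≡ true) ×
            (∀ e → Subgraph.F H e ≡ true → Subgraph.F H′ e ≡ true)

  Biconn : Subgraph → Set
  Biconn H = ConnectedSub H × (∀ x → ¬ CutVertex H x)

  Block : Subgraph → Set
  Block H = Biconn H × (∀ H′ → Biconn H′ → H ⊆ₛ H′ → H′ ⊆ₛ H)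

  BipartiteSub : Subgraph → Set
  BipartiteSub H = ∃ λ (c : Fin n → Bool) →
    ∀ e → Subgraph.F H e ≡ true → c (proj₁ (ends e)) ≢ c (proj₂ (ends e))

  IsoTo : Subgraph → (k : ℕ) → (Fin k → Fin k → Bool) → Set
  IsoTo H k A = ∃ λ (f : Fin n → Fin k) → ∃ λ (g : Fin k → Fin n) →
      (∀ i → S (g i) ≡ true) × (∀ i → f (g i) ≡ i) ×
      (∀ u → S u ≡ true → g (f u) ≡ u) ×
      (∀ u v → S u ≡ true → S v ≡ true →
         (SAdj F u v → A (f u) (f v) ≡ true) × (A (f u) (f v) ≡ true → SAdj F u v))
    where open Subgraph H

  Connected : Set
  Connected = ConnectedSub whole

  Bipartite : Set
  Bipartite = BipartiteSub whole

  IsMatching : (Fin m → Bool) → Set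
  IsMatching M = ∀ e e′ → M e ≡ true → M e′ ≡ true → e ≢ e′ →
                 ∀ u → Incident e u → ¬ Incident e′ u

  indicator : (Fin m → Bool) → Fin m → ℚ
  indicator M e with M e
  ... | true  = 1ℚ
  ... | false = 0ℚ

adjFromList : ∀ {k} → List (ℕ × ℕ) → Fin k → Fin k → Bool
adjFromList []             i j = false
adjFromList ((a , b) ∷ es) i j =
  (⌊ toℕ i ℕ.≟ a ⌋ ∧ ⌊ toℕ j ℕ.≟ b ⌋) ∨ (⌊ toℕ i ℕ.≟ b ⌋ ∧ ⌊ toℕ j ℕ.≟ a ⌋)
  ∨ adjFromList es i j

K3-adj : Fin 3 → Fin 3 → Bool
K3-adj = adjFromList ((0 , 1) ∷ (0 , 2) ∷ (1 , 2) ∷ [])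

K4-adj : Fin 4 → Fin 4 → Bool
K4-adj = adjFromList ((0 , 1) ∷ (0 , 2) ∷ (0 , 3) ∷ (1 , 2) ∷ (1 , 3) ∷ (2 , 3) ∷ [])

-- K_{1,1,2}: parts {0},{1},{2,3}  (K4 minus the edge {2,3})
K112-adj : Fin 4 → Fin 4 → Bool
K112-adj = adjFromList ((0 , 1) ∷ (0 , 2) ∷ (0 , 3) ∷ (1 , 2) ∷ (1 , 3) ∷ [])

C5-adj : Fin 5 → Fin 5 → Bool
C5-adj = adjFromList ((0 , 1) ∷ (1 , 2) ∷ (2 , 3) ∷ (3 , 4) ∷ (4 , 0) ∷ [])

-- C'_5: the 5-cycle with chords {1,3},{2,4}
C5′-adj : Fin 5 → Fin 5 → Bool
C5′-adj = adjFromList ((0 , 1) ∷ (1 , 2) ∷ (2 , 3) ∷ (3 , 4) ∷ (4 , 0) ∷ (1 , 3) ∷ (2 , 4) ∷ [])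

Vecℚ : ℕ → Set
Vecℚ d = Fin d → ℚ

∑ : ∀ {k} → (Fin k → ℚ) → ℚ
∑ {zero}  f = 0ℚ
∑ {suc k} f = f Fin.zero ℚ.+ ∑ (λ i → f (Fin.suc i))

_·_ : ∀ {d} → Vecℚ d → Vecℚ d → ℚ
x · y = ∑ (λ j → x j ℚ.* y j)

ConvFam : ∀ {d} (k : ℕ) → (Fin k → Vecℚ d) → Vecℚ d → Set
ConvFam k w x = ∃ λ (c : Fin k → ℚ) →
  (∀ i → 0ℚ ℚ.≤ c i) × (∑ c ≡ 1ℚ) × (∀ j → x j ≡ ∑ (λ i → c i ℚ.* w i j))

Conv : ∀ {d} → (Vecℚ d → Set) → Vecℚ d → Set
Conv S x = ∃ λ k → ∃ λ (w : Fin k → Vecℚ _) → (∀ i → S (w i)) × ConvFam k w x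

embedℤ : ∀ {d} → (Fin d → ℤ) → Vecℚ d
embedℤ v j = v j ℚ./ 1

LatticePolytope : ∀ {d} → (Vecℚ d → Set) → Set
LatticePolytope {d} Q = ∃ λ k → ∃ λ (v : Fin k → Fin d → ℤ) →
  ∀ x → (Q x → ConvFam k (λ i → embedℤ (v i)) x) × (ConvFam k (λ i → embedℤ (v i)) x → Q x)

Polar : ∀ {d} → (Vecℚ d → Set) → Vecℚ d → Set
Polar Q y = ∀ x → Q x → ℚ.- 1ℚ ℚ.≤ x · y

Reflexive : ∀ {d} → (Vecℚ d → Set) → Set
Reflexive Q = LatticePolytope Q × LatticePolytope (Polar Q)

DilateShift : ∀ {d} → ℕ → (Fin d → ℤ) → (Vecℚ d → Set) → Vecℚ d → Set
DilateShift k α Q x = ∃ λ p → Q p × (∀ j → x j ≡ (ℤ.+ k ℚ./ 1) ℚ.* p j ℚ.- (α j ℚ./ 1))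

Gorenstein : ∀ {d} → (Vecℚ d → Set) → Set
Gorenstein {d} Q = ∃ λ (k : ℕ) → ∃ λ (α : Fin d → ℤ) → 1 ℕ.≤ k × Reflexive (DilateShift k α Q)

MatchingPolytope : (G : Graph) → Vecℚ (Graph.m G) → Set
MatchingPolytope G = Conv (λ y → ∃ λ M → IsMatching G M × (∀ e → y e ≡ indicator G M e))

CaseA : Graph → Set
CaseA G = Bipartite G × ∃ λ r → ∀ u → Essential G u → degree G u ≡ r

CaseB : Graph → Set
CaseB G = IsoTo G (whole G) 5 C5-adj

CaseC : Graph → Set
CaseC G = (∀ u → Essential G u → degree G u ≡ 3) ×
  (∀ H → Block G H →
     BipartiteSub G H ⊎ IsoTo G H 3 K3-adj ⊎ IsoTo G H 4 K4-adj ⊎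
     IsoTo G H 4 K112-adj ⊎ IsoTo G H 5 C5′-adj)

{-# OPTIONS --safe #-}

-- For a facet f x ≤ b of P with f a primitive integer vector, k P − α is reflexive exactly when
-- k b − f(α) = 1 for all facets. The facets x_e ≥ 0 force α = (1, …, 1). The star of an essential
-- vertex v then gives deg v = k − 1, and the vertex set S of an odd cycle on 2t + 1 vertices gives
-- |E[S]| = k t − 1; that these inequalities define facets is seen by exchanging edges in (near-)perfect
-- matchings. A chordless odd cycle has |E[S]| = 2t + 1, so (k − 2) t = 2. Either k = 3, t = 2 and G is
-- C₅, or k = 4: then degrees are at most 3, odd cycles have length 3 or 5, a 5-cycle spans C₅′ and
-- fills its block, and a triangle grows by ears inside its block only to K_{1,1,2} and K₄.
--
-- Conversely, y lies in the polar of k P − (1, …, 1) iff the integer weights w obtained from −y by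
-- clearing denominators have small maximum matchings, and an optimal dual solution for w made of facets
-- at distance one writes y as a convex combination of lattice points of the polar. Edmonds' theorem
-- (after Cunningham and Marsh, by induction on the total weight) provides a dual solution made of stars
-- and odd sets. Stars of inessential vertices are absorbed by neighbouring stars or triangles, a
-- bipartite odd set by the stars of its smaller colour class, and sets of at most five vertices are
-- treated directly. Solutions on two sides of a cut vertex x are glued by adding a multiple of the star
-- of x, which reduces case (c) to blocks.
module Submission where

open import Defs
open import Algebra.Bundles using (CommutativeMonoid; module AbelianGroup; module CommutativeRing)
import Algebra.Properties.CommutativeMonoid.Sum as CommutativeMonoidSum
import Algebra.Properties.Group as GroupProperties
import Algebra.Properties.Semiring.Sum as SemiringSum
open import Data.Bool using (Bool; true; false; _∧_; _∨_; not; if_then_else_)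
import Data.Bool as Bool
open import Data.Bool.Properties using (¬-not)
open import Data.Empty using (⊥; ⊥-elim)
open import Data.Fin using (Fin; zero; suc; #_)
import Data.Fin as Fin
import Data.Fin.Properties as Finₚ
open import Data.Fin.Subset using (Subset)
open import Data.Fin.Subset.Properties using (anySubset?)
open import Data.Integer using (ℤ)
import Data.Integer as ℤ
import Data.Integer.Properties as ℤₚ
import Data.Integer.Tactic.RingSolver as ℤRing
open import Data.List using (List; []; _∷_; length; _++_)
import Data.List as List
import Data.List.Membership.DecPropositional as DecMembership
open import Data.List.Membership.Propositional using (_∈_; _∉_)
open import Data.List.Membership.Propositional.Properties
  using (∈-allFin; ∈-cartesianProduct⁺; ∈-∃++; ∈-++⁻; ∈-++⁺ˡ; ∈-++⁺ʳ; ∈-tabulate⁺; ∈-map⁻; ∈-lookup)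
import Data.List.Properties as Listₚ
open import Data.List.Relation.Unary.All using (All; []; _∷_)
import Data.List.Relation.Unary.All as All
import Data.List.Relation.Unary.All.Properties as Allₚ
open import Data.List.Relation.Unary.AllPairs using ([]; _∷_)
import Data.List.Relation.Unary.AllPairs as AllPairs
open import Data.List.Relation.Unary.Any using (Any; here; there)
import Data.List.Relation.Unary.Any as Any
import Data.List.Relation.Unary.Any.Properties as Anyₚ
open import Data.List.Relation.Unary.Unique.Propositional using (Unique)
import Data.List.Relation.Unary.Unique.Propositional.Properties as Uniqueₚ
open import Data.Nat hiding (parity)
open import Data.Nat.Coprimality using (1-coprimeTo) renaming (sym to coprime-sym)
import Data.Nat.ListAction as ListAction
open import Data.Nat.Properties
import Data.Nat.Tactic.RingSolver as ℕRing
open import Data.Product using (∃; ∃₂; _×_; _,_; proj₁; proj₂)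
open import Data.Product.Properties using (≡-dec)
open import Data.Rational using (ℚ; 0ℚ; 1ℚ)
import Data.Rational as ℚ
import Data.Rational.Properties as ℚₚ
import Data.Rational.Solver as ℚSolver
import Data.Rational.Unnormalised as ℚᵘ
open import Data.Sum using (_⊎_; inj₁; inj₂; [_,_]′)
import Data.Sum as Sum
import Data.Vec as Vec
open import Data.Vec.Functional using (updateAt)
open import Data.Vec.Functional.Properties using (updateAt-updates; updateAt-minimal)
import Data.Vec.Properties as Vecₚ
open import Function using (_∘_; id; const; case_of_)
open import Relation.Binary using (DecidableEquality)
open import Relation.Binary.Construct.Closure.ReflexiveTransitive using (Star; _◅_; _◅◅_)
import Relation.Binary.Construct.Closure.ReflexiveTransitive as Star
open import Relation.Binary.PropositionalEquality
open import Relation.Nullary using (¬_; Dec; yes; no; contradiction)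
open import Relation.Nullary.Decidable
  using (⌊_⌋; _×-dec_; _⊎-dec_; _→-dec_; ¬?; decidable-stable; from-yes; toSum)

-- No face lattice and no dimension is computed. That an inequality defines a facet is replaced by
-- rigidity: an integer vector that is constant on the matchings attaining the inequality is a
-- multiple of its coefficient vector. A lattice generator of the polar that occurs with positive
-- coefficient in the representation of the normalised inequality is such a vector, and integrality
-- forces the lattice distance to divide one. In the converse direction, distance one says that the
-- number of edges of a facet plus one is `k` times its right-hand side. Summed over a dual
-- solution, the total coefficient plus the number of facets is therefore at most `k` times the
-- maximum weight, and this is exactly what the inequality of the polar at a maximum matching can
-- pay for. The facets in Edmonds' theorem need not have distance one, so each has to be replaced by
-- a cover of no larger right-hand side. Integral dual solutions keep these counts in the natural
-- numbers and permit induction on the total weight.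

-- Weights of finite sets

module Weight {c} (CM : CommutativeMonoid c c) where
  private module M = CommutativeMonoid CM
  open M using (Carrier; _≈_; _∙_; ε)
  open CommutativeMonoidSum CM using (sum)

  infixr 7 _⊙_
  _⊙_ : Bool → Carrier → Carrier
  true  ⊙ x = x
  false ⊙ x = ε

  wt : ∀ {m} → (Fin m → Carrier) → (Fin m → Bool) → Carrier
  wt g M = sum (λ e → M e ⊙ g e)

  wt-cong : ∀ {m} (g : Fin m → Carrier) {M N : Fin m → Bool} → M ≗ N → wt g M ≡ wt g N
  wt-cong g M≗N = CommutativeMonoidSum.sum-cong-≗ CM λ e → cong (_⊙ g e) (M≗N e)

  wt-∅ : ∀ {m} (g : Fin m → Carrier) → wt g (const false) ≈ ε
  wt-∅ {zero}  g = M.refl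
  wt-∅ {suc m} g = M.trans (M.identityˡ _) (wt-∅ (g ∘ suc))

  wt-set : ∀ {m} (g : Fin m → Carrier) M e → M e ≡ false →
           wt g (updateAt M e (const true)) ≈ g e ∙ wt g M
  wt-set g M zero    eq rewrite eq = M.∙-congˡ (M.sym (M.identityˡ _))
  wt-set g M (suc e) eq = M.trans (M.∙-congˡ (wt-set (g ∘ suc) (M ∘ suc) e eq))
    (M.trans (M.sym (M.assoc _ _ _)) (M.trans (M.∙-congʳ (M.comm _ _)) (M.assoc _ _ _)))

  wt-unset : ∀ {m} (g : Fin m → Carrier) M e → M e ≡ true →
             wt g M ≈ g e ∙ wt g (updateAt M e (const false))
  wt-unset g M zero    eq rewrite eq = M.∙-congˡ (M.sym (M.identityˡ _))
  wt-unset g M (suc e) eq = M.trans (M.∙-congˡ (wt-unset (g ∘ suc) (M ∘ suc) e eq))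
    (M.trans (M.sym (M.assoc _ _ _)) (M.trans (M.∙-congʳ (M.comm _ _)) (M.assoc _ _ _)))

open Weight +-0-commutativeMonoid
open SemiringSum +-*-semiring using (sum; sum-cong-≗; ∑-distrib-+; ∑-comm; *-distribˡ-sum; sum-replicate-zero)

b2n : Bool → ℕ
b2n b = b ⊙ 1

count : ∀ {m} → (Fin m → Bool) → ℕ
count = wt (const 1)

⊙-* : ∀ b x → b ⊙ x ≡ b2n b * x
⊙-* true  x = sym (+-identityʳ x)
⊙-* false x = refl

⊙-∧ : ∀ a {b} → a ⊙ b2n b ≡ b2n (a ∧ b)
⊙-∧ true  = refl
⊙-∧ false = refl

b2n≤1 : ∀ b → b2n b ≤ 1
b2n≤1 true  = ≤-refl
b2n≤1 false = z≤n

⊙-mono : ∀ {b b′ x y} → (b ≡ true → b′ ≡ true) → x ≤ y → b ⊙ x ≤ b′ ⊙ y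
⊙-mono {false}        _ _   = z≤n
⊙-mono {true} {true}  _ x≤y = x≤y
⊙-mono {true} {false} f _   with () ← f refl

bool-ext : ∀ {a b : Bool} → (a ≡ true → b ≡ true) → (b ≡ true → a ≡ true) → a ≡ b
bool-ext {true}  {true}  _ _ = refl
bool-ext {false} {false} _ _ = refl
bool-ext {true}  {false} f _ with () ← f refl
bool-ext {false} {true}  _ g with () ← g refl

∧-elim : ∀ a {b} → a ∧ b ≡ true → a ≡ true × b ≡ true
∧-elim true {true} _ = refl , refl

∧-intro : ∀ {a b} → a ≡ true → b ≡ true → a ∧ b ≡ true
∧-intro refl refl = refl

true? : ∀ b → Dec (b ≡ true)
true? b = b Bool.≟ true

dec⇒true : ∀ {A : Set} (d : Dec A) → A → ⌊ d ⌋ ≡ true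
dec⇒true (yes _) _ = refl
dec⇒true (no ¬a) a = ⊥-elim (¬a a)

true⇒dec : ∀ {A : Set} (d : Dec A) → ⌊ d ⌋ ≡ true → A
true⇒dec (yes a) _ = a

dec⇒false : ∀ {A : Set} (d : Dec A) → ¬ A → ⌊ d ⌋ ≡ false
dec⇒false (yes a) ¬a = ⊥-elim (¬a a)
dec⇒false (no _)  _  = refl

sum-mono : ∀ {m} {f g : Fin m → ℕ} → (∀ i → f i ≤ g i) → sum f ≤ sum g
sum-mono {zero}  _   = z≤n
sum-mono {suc m} f≤g = +-mono-≤ (f≤g zero) (sum-mono (f≤g ∘ suc))

sum-const : ∀ m c → sum {m} (const c) ≡ m * c
sum-const zero    c = refl
sum-const (suc m) c = cong (c +_) (sum-const m c)

term≤sum : ∀ {m} (f : Fin m → ℕ) i → f i ≤ sum f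
term≤sum f zero    = m≤m+n _ _
term≤sum f (suc i) = ≤-trans (term≤sum (f ∘ suc) i) (m≤n+m _ _)

sum-strict : ∀ {m} {f g : Fin m → ℕ} → (∀ i → f i ≤ g i) → ∀ i → f i < g i → sum f < sum g
sum-strict f≤g zero    lt = +-mono-<-≤ lt (sum-mono (f≤g ∘ suc))
sum-strict f≤g (suc i) lt = +-mono-≤-< (f≤g zero) (sum-strict (f≤g ∘ suc) i lt)

sum-δ : ∀ {m} (g : Fin m → ℕ) i → sum (λ j → ⌊ i Fin.≟ j ⌋ ⊙ g j) ≡ g i
sum-δ g zero    = trans (cong (g zero +_) (wt-∅ (g ∘ suc))) (+-identityʳ _)
sum-δ g (suc i) = trans (sum-cong-≗ λ j → cong (_⊙ g (suc j)) (bool-ext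
    (λ t → dec⇒true (i Fin.≟ j) (Finₚ.suc-injective (true⇒dec (suc i Fin.≟ suc j) t)))
    (λ t → dec⇒true (suc i Fin.≟ suc j) (cong suc (true⇒dec (i Fin.≟ j) t)))))
  (sum-δ (g ∘ suc) i)

wt-mono : ∀ {m} {g h : Fin m → ℕ} {M N : Fin m → Bool} →
          (∀ e → M e ≡ true → N e ≡ true) → (∀ e → g e ≤ h e) → wt g M ≤ wt h N
wt-mono M⊆N g≤h = sum-mono λ e → ⊙-mono (M⊆N e) (g≤h e)

wt-+ : ∀ {m} (g h : Fin m → ℕ) M → wt (λ e → g e + h e) M ≡ wt g M + wt h M
wt-+ g h M = trans (sum-cong-≗ λ e → ⊙-+ (M e)) (∑-distrib-+ (λ e → M e ⊙ g e) (λ e → M e ⊙ h e))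
  where
  ⊙-+ : ∀ b {x y} → b ⊙ (x + y) ≡ b ⊙ x + b ⊙ y
  ⊙-+ true  = refl
  ⊙-+ false = refl

wt≤sum : ∀ {m} (g : Fin m → ℕ) M → wt g M ≤ sum g
wt≤sum g M = sum-mono λ e → ⊙-mono {M e} {true} (λ _ → refl) ≤-refl

count-mono : ∀ {m} {f g : Fin m → Bool} → (∀ i → f i ≡ true → g i ≡ true) → count f ≤ count g
count-mono f⊆g = wt-mono f⊆g (λ _ → ≤-refl)

count-strict : ∀ {m} {f g : Fin m → Bool} → (∀ i → f i ≡ true → g i ≡ true) →
               ∀ i → f i ≡ false → g i ≡ true → count f < count g
count-strict f⊆g i fi gi =
  sum-strict (λ j → ⊙-mono (f⊆g j) ≤-refl) i (subst₂ (λ a b → b2n a < b2n b) (sym fi) (sym gi) ≤-refl)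

count≤size : ∀ {m} (f : Fin m → Bool) → count f ≤ m
count≤size {m} f = ≤-trans (wt≤sum (const 1) f) (≤-reflexive (trans (sum-const m 1) (*-identityʳ m)))

unset : ∀ {m} → (Fin m → Bool) → Fin m → Fin m → Bool
unset M e = updateAt M e (const false)

set : ∀ {m} → (Fin m → Bool) → Fin m → Fin m → Bool
set M e = updateAt M e (const true)

set-⊆ : ∀ {m} (M : Fin m → Bool) e {e′} → set M e e′ ≡ true → e′ ≡ e ⊎ M e′ ≡ true
set-⊆ M zero    {zero}   _ = inj₁ refl
set-⊆ M zero    {suc e′} t = inj₂ t
set-⊆ M (suc e) {zero}   t = inj₂ t
set-⊆ M (suc e) {suc e′} t = Sum.map₁ (cong suc) (set-⊆ (M ∘ suc) e t)

unset-⊆ : ∀ {m} (M : Fin m → Bool) e {e′} → unset M e e′ ≡ true → M e′ ≡ true × e′ ≢ e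
unset-⊆ M zero    {suc e′} t = t , λ ()
unset-⊆ M (suc e) {zero}   t = t , λ ()
unset-⊆ M (suc e) {suc e′} t =
  let (a , b) = unset-⊆ (M ∘ suc) e t in a , b ∘ Finₚ.suc-injective

unset-⊇ : ∀ {m} (M : Fin m → Bool) e {e′} → M e′ ≡ true → e′ ≢ e → unset M e e′ ≡ true
unset-⊇ M e t e′≢e = trans (updateAt-minimal _ e M e′≢e) t

length≤count : ∀ {m} (f : Fin m → Bool) L → Unique L → All (λ e → f e ≡ true) L → length L ≤ count f
length≤count f []      _          _          = z≤n
length≤count f (e ∷ L) (e∉L ∷ uL) (fe ∷ fL) rewrite wt-unset (const 1) f e fe =
  s≤s (length≤count (unset f e) L uL
    (All.zipWith (λ (fx , e≢x) → unset-⊇ f e fx (e≢x ∘ sym)) (fL , e∉L)))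

count≤length : ∀ {m} (f : Fin m → Bool) L → (∀ e → f e ≡ true → e ∈ L) → count f ≤ length L
count≤length {m} f [] cover = ≤-trans (count-mono {g = const false} λ e t → case cover e t of λ ()) (≤-reflexive (wt-∅ {m} (const 1)))
count≤length f (e ∷ L) cover with true? (f e)
... | no  ¬fe = m≤n⇒m≤1+n (count≤length f L λ x t → case cover x t of λ where
  (here refl) → ⊥-elim (¬fe t)
  (there x∈L) → x∈L)
... | yes fe rewrite wt-unset (const 1) f e fe = s≤s (count≤length (unset f e) L λ x t →
  let (fx , x≢e) = unset-⊆ f e t in case cover x fx of λ where
    (here x≡e)  → ⊥-elim (x≢e x≡e)
    (there x∈L) → x∈L)

count-list : ∀ {m} (f : Fin m → Bool) L → Unique L → All (λ e → f e ≡ true) L →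
             (∀ e → f e ≡ true → e ∈ L) → count f ≡ length L
count-list f L u a c = ≤-antisym (count≤length f L c) (length≤count f L u a)

count≥1 : ∀ {m} (f : Fin m → Bool) e → f e ≡ true → 1 ≤ count f
count≥1 f e fe = length≤count f (e ∷ []) ([] ∷ []) (fe ∷ [])

count≤1 : ∀ {m} (f : Fin m → Bool) → (∀ e e′ → f e ≡ true → f e′ ≡ true → e ≡ e′) → count f ≤ 1
count≤1 f uniq with Finₚ.any? (λ e → true? (f e))
... | yes (e , fe) = count≤length f (e ∷ []) λ x fx → here (uniq x e fx fe)
... | no  none     = ≤-trans (count≤length f [] λ x fx → ⊥-elim (none (x , fx))) z≤n

count≡0 : ∀ {m} (f : Fin m → Bool) → (∀ e → f e ≡ false) → count f ≡ 0
count≡0 f none = n≤0⇒n≡0 (count≤length f [] λ x fx → case trans (sym (none x)) fx of λ ())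

member : ∀ {m} (f : Fin m → Bool) → 1 ≤ count f → ∃ λ e → f e ≡ true
member f pos with Finₚ.any? (λ e → true? (f e))
... | yes r    = r
... | no  none = contradiction pos (<⇒≱ (s≤s (count≤length f [] λ x fx → ⊥-elim (none (x , fx)))))

members₂ : ∀ {m} (f : Fin m → Bool) → 2 ≤ count f → ∃₂ λ e e′ → f e ≡ true × f e′ ≡ true × e ≢ e′
members₂ f two with member f (≤-trans (s≤s z≤n) two)
... | e , fe with member (unset f e) (≤-pred (subst (2 ≤_) (wt-unset (const 1) f e fe) two))
... | e′ , fe′ = let (a , b) = unset-⊆ f e fe′ in e , e′ , fe , a , b ∘ sym

abstract
  -- Hill climbing: while an admissible subset is strictly better, move to it. The invariant
  -- `B ≤ d + f M` makes `d` a bound on the moves left. The search runs over vectors, of which there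
  -- are finitely many, hence the demand that `P` and `f` respect pointwise equality.
  argmax : ∀ {m} (P : (Fin m → Bool) → Set) (P? : ∀ M → Dec (P M)) (f : (Fin m → Bool) → ℕ) (B : ℕ) →
           (∀ {M N} → M ≗ N → P M → P N) → (∀ {M N} → M ≗ N → f M ≡ f N) → (∀ M → f M ≤ B) →
           ∃ P → ∃ λ M → P M × (∀ N → P N → f N ≤ f M)
  argmax P P? f B P-resp f-resp bound (M₀ , PM₀) = go B M₀ PM₀ (m≤m+n B (f M₀))
    where
    go : ∀ d M → P M → B ≤ d + f M → ∃ λ M → P M × (∀ N → P N → f N ≤ f M)
    go d M PM close with anySubset? (λ s → P? (Vec.lookup s) ×-dec (f M <? f (Vec.lookup s)))
    ... | no none = M , PM , λ N PN → ≮⇒≥ λ lt → none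
      (Vec.tabulate N , P-resp (λ i → sym (Vecₚ.lookup∘tabulate N i)) PN
        , subst (f M <_) (f-resp λ i → sym (Vecₚ.lookup∘tabulate N i)) lt)
    go zero    M PM close | yes (s , _ , lt) = contradiction (≤-trans lt (bound _)) (≤⇒≯ close)
    go (suc d) M PM close | yes (s , Ps , lt) = go d (Vec.lookup s) Ps
      (≤-trans close (≤-trans (≤-reflexive (sym (+-suc d (f M)))) (+-monoʳ-≤ d lt)))

tally : ∀ {k} → (Fin k → Bool) → ℕ
tally {zero}  f = 0
tally {suc k} f = b2n (f zero) + tally (f ∘ suc)

tally≡count : ∀ {k} (f : Fin k → Bool) → tally f ≡ count f
tally≡count {zero}  f = refl
tally≡count {suc k} f = cong (b2n (f zero) +_) (tally≡count (f ∘ suc))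

mutual
  degreeLoop : (G : Graph) (u : Fin (Graph.n G)) (k : ℕ) → (Fin k → Bool) → ℕ
  degreeLoop G u = _

  degree≡tally : ∀ G u → degree G u ≡ tally (λ e → incident? G e u)
  degree≡tally G u with Graph.m G | (λ e → incident? G e u)
  ... | k | f = degreeLoop≡tally G u k f

  -- The counting loop local to degree has no name of its own; the underscore above is solved to it.
  degreeLoop≡tally : ∀ G u k f → degreeLoop G u k f ≡ tally f
  degreeLoop≡tally G u zero f = refl
  degreeLoop≡tally G u (suc k) f with f zero
  ... | true  = cong suc (degreeLoop≡tally G u k (f ∘ suc))
  ... | false = degreeLoop≡tally G u k (f ∘ suc)

degree≡count : ∀ G u → degree G u ≡ count (λ e → incident? G e u)
degree≡count G u = trans (degree≡tally G u) (tally≡count (λ e → incident? G e u))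

-- Component labels of a finitely generated relation

module Labelling {X I : Set} (_≟X_ : DecidableEquality X) (R : X → X → Set)
                 (R-sym : ∀ {x y} → R x y → R y x) (a b : I → X) (active : I → Bool)
                 (R-ab : ∀ i → active i ≡ true → R (a i) (b i)) where

  -- Items are processed one by one, and an active one renames the label of its first end to that of
  -- its second. Equality of labels decides connectivity, and soundness returns an actual walk.
  labelling : (L : List I) → ∃ λ (c : X → X) → (∀ u v → c u ≡ c v → Star R u v) ×
                                       (∀ i → i ∈ L → active i ≡ true → c (a i) ≡ c (b i))
  labelling [] = id , (λ { u .u refl → Star.ε }) , λ _ ()
  labelling (i ∷ L) with labelling L | true? (active i)
  ... | c , sound , joined | no inactive = c , sound , λ where
    j (here refl) act → ⊥-elim (inactive act)
    j (there j∈L) act → joined j j∈L act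
  ... | c , sound , joined | yes act = relabel ∘ c , sound′ , joined′
    where
    relabel : X → X
    relabel x = if ⌊ x ≟X c (a i) ⌋ then c (b i) else x
    relabel-a : relabel (c (a i)) ≡ c (b i)
    relabel-a rewrite dec⇒true (c (a i) ≟X c (a i)) refl = refl
    relabel-b : relabel (c (b i)) ≡ c (b i)
    relabel-b with c (b i) ≟X c (a i)
    ... | yes _ = refl
    ... | no _  = refl
    sound′ : ∀ u v → relabel (c u) ≡ relabel (c v) → Star R u v
    sound′ u v eq with c u ≟X c (a i) | c v ≟X c (a i)
    ... | yes ua | yes va = sound u v (trans ua (sym va))
    ... | yes ua | no _   = sound u (a i) ua ◅◅ R-ab i act ◅ sound (b i) v eq
    ... | no _   | yes va = sound u (b i) eq ◅◅ R-sym (R-ab i act) ◅ sound (a i) v (sym va)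
    ... | no _   | no _   = sound u v eq
    joined′ : ∀ j → j ∈ i ∷ L → active j ≡ true → relabel (c (a j)) ≡ relabel (c (b j))
    joined′ j (here refl) _   = trans relabel-a (sym relabel-b)
    joined′ j (there j∈L) act = cong relabel (joined j j∈L act)

-- Integral dual solutions

module Covers {E : Set} where

  -- An integral dual solution for the weights w, as a list of facets with repetitions.
  data Cov (Facet : (E → ℕ) → ℕ → Set) : (E → ℕ) → ℕ → Set where
    nil  : ∀ {w c} → (∀ e → w e ≡ 0) → Cov Facet w c
    cons : ∀ {χ b w w′ b′ c} → Facet χ b → Cov Facet w′ b′ → (∀ e → w e ≤ χ e + w′ e) → b + b′ ≤ c → Cov Facet w c

  cov-mono : ∀ {F w w′ b b′} → (∀ e → w e ≤ w′ e) → b′ ≤ b → Cov F w′ b′ → Cov F w b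
  cov-mono w≤ b≤ (nil z)         = nil λ e → n≤0⇒n≡0 (≤-trans (w≤ e) (≤-reflexive (z e)))
  cov-mono w≤ b≤ (cons f D c b″) = cons f D (λ e → ≤-trans (w≤ e) (c e)) (≤-trans b″ b≤)

  cov-+ : ∀ {F w w₁ w₂ b b₁ b₂} → Cov F w₁ b₁ → Cov F w₂ b₂ → (∀ e → w e ≤ w₁ e + w₂ e) → b₁ + b₂ ≤ b → Cov F w b
  cov-+ {b₁ = b₁} (nil z) D w≤ b≤ =
    cov-mono (λ e → ≤-trans (w≤ e) (≤-reflexive (cong (_+ _) (z e)))) (m+n≤o⇒n≤o b₁ b≤) D
  cov-+ (cons {χ} {b} {w′ = w′} {b′} f D c b″) D₂ w≤ b≤ =
    cons f (cov-+ D D₂ (λ _ → ≤-refl) ≤-refl)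
      (λ e → ≤-trans (w≤ e) (≤-trans (+-monoˡ-≤ _ (c e)) (≤-reflexive (+-assoc (χ e) (w′ e) _))))
      (≤-trans (≤-reflexive (sym (+-assoc b b′ _))) (≤-trans (+-monoˡ-≤ _ b″) b≤))

  cov-facet : ∀ {F : (E → ℕ) → ℕ → Set} {χ b} → F χ b → Cov F χ b
  cov-facet {b = b} f = cons f (nil {w = const 0} {c = 0} λ _ → refl) (λ e → m≤m+n _ 0) (≤-reflexive (+-identityʳ b))

  -- Dual solutions compose: a cover of every single facet at its own cost transfers a whole
  -- solution. In this way a solution by Edmonds' facets becomes one by facets at distance one.
  cov-bind : ∀ {F F′ : (E → ℕ) → ℕ → Set} {w b} → (∀ {χ c} → F χ c → Cov F′ χ c) → Cov F w b → Cov F′ w b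
  cov-bind h (nil z)        = nil z
  cov-bind h (cons f D c b) = cov-+ (h f) (cov-bind h D) c b

open Covers public

-- Base `m + 1` encodes a lexicographic order: a remainder of at most `m` cannot make up for a
-- smaller leading term.
lex-≤ : ∀ m {a b x y} → a * suc m + x ≤ b * suc m + y → y ≤ m → a ≤ b
lex-≤ m {a} {b} {x} {y} le y≤m = ≮⇒≥ λ b<a → <⇒≱ (s≤s y≤m) (+-cancelˡ-≤ (b * suc m) _ _ (begin
  b * suc m + suc m ≡⟨ +-comm (b * suc m) (suc m) ⟩
  suc b * suc m     ≤⟨ *-monoˡ-≤ (suc m) b<a ⟩
  a * suc m         ≤⟨ m≤m+n _ x ⟩
  a * suc m + x     ≤⟨ le ⟩
  b * suc m + y     ∎))
  where open ≤-Reasoning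

-- Integers among the rationals

module ℤΣ = SemiringSum (CommutativeRing.semiring ℤₚ.+-*-commutativeRing)
module ℚΣ = SemiringSum (CommutativeRing.semiring ℚₚ.+-*-commutativeRing)

sumℤ : ∀ {k} → (Fin k → ℤ) → ℤ
sumℤ = ℤΣ.sum

ι : ℤ → ℚ
ι z = z ℚ./ 1

-- Division by one normalises by a gcd that does not reduce for a variable numerator. After
-- rewriting to this form, sums, products and comparisons do.
ι-mkℚ : ∀ z → ι z ≡ ℚ.mkℚ z 0 (coprime-sym (1-coprimeTo ℤ.∣ z ∣))
ι-mkℚ z = ℚₚ.↥p/↧p≡p (ℚ.mkℚ z 0 (coprime-sym (1-coprimeTo ℤ.∣ z ∣)))

ι-+ : ∀ a b → ι (a ℤ.+ b) ≡ ι a ℚ.+ ι b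
ι-+ a b rewrite ι-mkℚ a | ι-mkℚ b = cong ι (sym (cong₂ ℤ._+_ (ℤₚ.*-identityʳ a) (ℤₚ.*-identityʳ b)))

ι-* : ∀ a b → ι (a ℤ.* b) ≡ ι a ℚ.* ι b
ι-* a b rewrite ι-mkℚ a | ι-mkℚ b = refl

ι-neg : ∀ a → ι (ℤ.- a) ≡ ℚ.- ι a
ι-neg a = trans (cong ι (sym (ℤₚ.-1*i≡-i a))) (trans (ι-* (ℤ.- ℤ.1ℤ) a)
  (trans (sym (ℚₚ.neg-distribˡ-* 1ℚ (ι a))) (cong ℚ.-_ (ℚₚ.*-identityˡ (ι a)))))

ι-− : ∀ a b → ι (a ℤ.- b) ≡ ι a ℚ.- ι b
ι-− a b = trans (ι-+ a (ℤ.- b)) (cong (ι a ℚ.+_) (ι-neg b))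

ι-≤ : ∀ {a b} → a ℤ.≤ b → ι a ℚ.≤ ι b
ι-≤ {a} {b} a≤b rewrite ι-mkℚ a | ι-mkℚ b =
  ℚ.*≤* (subst₂ ℤ._≤_ (sym (ℤₚ.*-identityʳ a)) (sym (ℤₚ.*-identityʳ b)) a≤b)

ι-≤⁻ : ∀ {a b} → ι a ℚ.≤ ι b → a ℤ.≤ b
ι-≤⁻ {a} {b} le rewrite ι-mkℚ a | ι-mkℚ b =
  subst₂ ℤ._≤_ (ℤₚ.*-identityʳ a) (ℤₚ.*-identityʳ b) (ℚₚ.drop-*≤* le)

ι-injective : ∀ {a b} → ι a ≡ ι b → a ≡ b
ι-injective eq = ℤₚ.≤-antisym (ι-≤⁻ (ℚₚ.≤-reflexive eq)) (ι-≤⁻ (ℚₚ.≤-reflexive (sym eq)))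

ι-denominator : ∀ x → x ℚ.* ι (ℚ.↧ x) ≡ ι (ℚ.↥ x)
ι-denominator (ℚ.mkℚ a d c) rewrite ι-mkℚ (ℤ.+ suc d) = ℚₚ.fromℚᵘ-cong {ℚᵘ.mkℚᵘ (a ℤ.* ℤ.+ suc d) (d * 1)} {ℚᵘ.mkℚᵘ a 0}
  (ℚᵘ.*≡* (trans (ℤₚ.*-identityʳ (a ℤ.* ℤ.+ suc d)) (cong (λ x → a ℤ.* ℤ.+ suc x) (sym (*-identityʳ d)))))

clear-denominators : ∀ {d} (y : Fin d → ℚ) → ∃₂ λ D (Y : Fin d → ℤ) → 1 ≤ D × (∀ e → ι (ℤ.+ D) ℚ.* y e ≡ ι (Y e))
clear-denominators {zero}  y = 1 , (λ ()) , ≤-refl , λ ()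
clear-denominators {suc d} y with clear-denominators (y ∘ suc)
... | D , Y , D≥1 , eq = ℚ.↧ₙ (y zero) * D , Y′ , *-mono-≤ {1} {ℚ.↧ₙ (y zero)} {1} {D} (s≤s z≤n) D≥1 , eq′
  where
  y₀ : ℚ
  y₀ = y zero
  Y′ : Fin (suc d) → ℤ
  Y′ zero    = ℤ.+ D ℤ.* ℚ.↥ y₀
  Y′ (suc e) = ℚ.↧ y₀ ℤ.* Y e
  split : ι (ℤ.+ (ℚ.↧ₙ y₀ * D)) ≡ ι (ℚ.↧ y₀) ℚ.* ι (ℤ.+ D)
  split = trans (cong ι (ℤₚ.pos-* (ℚ.↧ₙ y₀) D)) (ι-* (ℚ.↧ y₀) (ℤ.+ D))
  eq′ : ∀ e → ι (ℤ.+ (ℚ.↧ₙ y₀ * D)) ℚ.* y e ≡ ι (Y′ e)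
  eq′ zero = begin
    ι (ℤ.+ (ℚ.↧ₙ y₀ * D)) ℚ.* y₀          ≡⟨ cong (ℚ._* y₀) (trans split (ℚₚ.*-comm (ι (ℚ.↧ y₀)) (ι (ℤ.+ D)))) ⟩
    (ι (ℤ.+ D) ℚ.* ι (ℚ.↧ y₀)) ℚ.* y₀     ≡⟨ ℚₚ.*-assoc (ι (ℤ.+ D)) (ι (ℚ.↧ y₀)) y₀ ⟩
    ι (ℤ.+ D) ℚ.* (ι (ℚ.↧ y₀) ℚ.* y₀)     ≡⟨ cong (ι (ℤ.+ D) ℚ.*_) (trans (ℚₚ.*-comm _ y₀) (ι-denominator y₀)) ⟩
    ι (ℤ.+ D) ℚ.* ι (ℚ.↥ y₀)              ≡⟨ ι-* (ℤ.+ D) (ℚ.↥ y₀) ⟨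
    ι (ℤ.+ D ℤ.* ℚ.↥ y₀)                  ∎
    where open ≡-Reasoning
  eq′ (suc e) = trans (cong (ℚ._* y (suc e)) split) (trans (ℚₚ.*-assoc (ι (ℚ.↧ y₀)) (ι (ℤ.+ D)) (y (suc e)))
    (trans (cong (ι (ℚ.↧ y₀) ℚ.*_) (eq e)) (sym (ι-* (ℚ.↧ y₀) (Y e)))))

-- Rational sums, cones and convex combinations

ℚ-swap : ∀ a b c → a ℚ.* (b ℚ.* c) ≡ b ℚ.* (a ℚ.* c)
ℚ-swap a b c = trans (sym (ℚₚ.*-assoc a b c)) (trans (cong (ℚ._* c) (ℚₚ.*-comm a b)) (ℚₚ.*-assoc b a c))

∑≡sum : ∀ {k} (f : Fin k → ℚ) → ∑ f ≡ ℚΣ.sum f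
∑≡sum {zero}  f = refl
∑≡sum {suc k} f = cong (f zero ℚ.+_) (∑≡sum (f ∘ suc))

∑-cong : ∀ {k} {f g : Fin k → ℚ} → f ≗ g → ∑ f ≡ ∑ g
∑-cong {zero}  _   = refl
∑-cong {suc k} f≗g = cong₂ ℚ._+_ (f≗g zero) (∑-cong (f≗g ∘ suc))

∑-+ : ∀ {k} (f g : Fin k → ℚ) → ∑ (λ i → f i ℚ.+ g i) ≡ ∑ f ℚ.+ ∑ g
∑-+ f g = trans (∑≡sum (λ i → f i ℚ.+ g i)) (trans (ℚΣ.∑-distrib-+ f g) (sym (cong₂ ℚ._+_ (∑≡sum f) (∑≡sum g))))

∑-*ˡ : ∀ {k} c (f : Fin k → ℚ) → ∑ (λ i → c ℚ.* f i) ≡ c ℚ.* ∑ f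
∑-*ˡ c f = trans (∑≡sum (λ i → c ℚ.* f i)) (trans (sym (ℚΣ.*-distribˡ-sum c f)) (cong (c ℚ.*_) (sym (∑≡sum f))))

∑-*ʳ : ∀ {k} c (f : Fin k → ℚ) → ∑ (λ i → f i ℚ.* c) ≡ ∑ f ℚ.* c
∑-*ʳ c f = trans (∑-cong λ i → ℚₚ.*-comm (f i) c) (trans (∑-*ˡ c f) (ℚₚ.*-comm c (∑ f)))

∑-swap : ∀ {k l} (f : Fin k → Fin l → ℚ) → ∑ (λ i → ∑ (f i)) ≡ ∑ (λ j → ∑ (λ i → f i j))
∑-swap f = begin
  ∑ (λ i → ∑ (f i))                         ≡⟨ trans (∑-cong λ i → ∑≡sum (f i)) (∑≡sum (λ i → ℚΣ.sum (f i))) ⟩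
  ℚΣ.sum (λ i → ℚΣ.sum (f i))               ≡⟨ ℚΣ.∑-comm f ⟩
  ℚΣ.sum (λ j → ℚΣ.sum (λ i → f i j))       ≡⟨ trans (∑-cong λ j → ∑≡sum (λ i → f i j)) (∑≡sum (λ j → ℚΣ.sum (λ i → f i j))) ⟨
  ∑ (λ j → ∑ (λ i → f i j))                 ∎
  where open ≡-Reasoning

∑-mono : ∀ {k} {f g : Fin k → ℚ} → (∀ i → f i ℚ.≤ g i) → ∑ f ℚ.≤ ∑ g
∑-mono {zero}  _   = ℚₚ.≤-refl
∑-mono {suc k} f≤g = ℚₚ.+-mono-≤ (f≤g zero) (∑-mono (f≤g ∘ suc))

∑-0 : ∀ k → ∑ {k} (const 0ℚ) ≡ 0ℚ
∑-0 zero    = refl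
∑-0 (suc k) = trans (ℚₚ.+-identityˡ _) (∑-0 k)

∑-δ : ∀ {k} (i : Fin k) (f : Fin k → ℚ) → ∑ (λ j → (if ⌊ i Fin.≟ j ⌋ then 1ℚ else 0ℚ) ℚ.* f j) ≡ f i
∑-δ {suc k} zero f = trans (cong₂ ℚ._+_ (ℚₚ.*-identityˡ (f zero))
  (trans (∑-cong λ j → ℚₚ.*-zeroˡ (f (suc j))) (∑-0 k))) (ℚₚ.+-identityʳ (f zero))
∑-δ {suc k} (suc i) f = trans (cong₂ ℚ._+_ (ℚₚ.*-zeroˡ (f zero)) (trans (∑-cong λ j → cong (ℚ._* f (suc j)) (shift j)) (∑-δ i (f ∘ suc))))
  (ℚₚ.+-identityˡ (f (suc i)))
  where
  shift : ∀ j → (if ⌊ suc i Fin.≟ suc j ⌋ then 1ℚ else 0ℚ) ≡ (if ⌊ i Fin.≟ j ⌋ then 1ℚ else 0ℚ)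
  shift j with i Fin.≟ j
  ... | yes _ = refl
  ... | no _  = refl

ι-sum : ∀ {k} (f : Fin k → ℤ) → ι (sumℤ f) ≡ ∑ (ι ∘ f)
ι-sum {zero}  f = refl
ι-sum {suc k} f = trans (ι-+ (f zero) (sumℤ (f ∘ suc))) (cong (ι (f zero) ℚ.+_) (ι-sum (f ∘ suc)))

ι-dot : ∀ {d} (a b : Fin d → ℤ) → embedℤ a · embedℤ b ≡ ι (sumℤ (λ e → a e ℤ.* b e))
ι-dot a b = trans (∑-cong λ e → sym (ι-* (a e) (b e))) (sym (ι-sum (λ e → a e ℤ.* b e)))

·-comm : ∀ {d} (x y : Vecℚ d) → x · y ≡ y · x
·-comm x y = ∑-cong λ j → ℚₚ.*-comm (x j) (y j)

*-monoˡ : ∀ {c x y} → 0ℚ ℚ.≤ c → x ℚ.≤ y → c ℚ.* x ℚ.≤ c ℚ.* y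
*-monoˡ {c} 0≤c x≤y = ℚₚ.*-monoˡ-≤-nonNeg c {{ℚ.nonNegative 0≤c}} x≤y

*-nonneg : ∀ {c x} → 0ℚ ℚ.≤ c → 0ℚ ℚ.≤ x → 0ℚ ℚ.≤ c ℚ.* x
*-nonneg {c} 0≤c 0≤x = ℚₚ.≤-trans (ℚₚ.≤-reflexive (sym (ℚₚ.*-zeroʳ c))) (*-monoˡ 0≤c 0≤x)

-- Leaving the total coefficient `s` free makes these combinations closed under sums and nonnegative
-- multiples; `ConvFam` is the case `s = 1`.
Cone : ∀ {d N} → (Fin N → Vecℚ d) → Vecℚ d → ℚ → Set
Cone {d} {N} V x s = ∃ λ (c : Fin N → ℚ) → (∀ i → 0ℚ ℚ.≤ c i) × (∑ c ≡ s) × (∀ j → x j ≡ ∑ (λ i → c i ℚ.* V i j))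

average-≥ : ∀ {N} {c x : Fin N → ℚ} {l} → (∀ i → 0ℚ ℚ.≤ c i) → ∑ c ≡ 1ℚ → (∀ i → l ℚ.≤ x i) → l ℚ.≤ ∑ (λ i → c i ℚ.* x i)
average-≥ {c = c} {x} {l} c≥0 sc bound = begin
  l                             ≡⟨ trans (cong (ℚ._* l) sc) (ℚₚ.*-identityˡ l) ⟨
  ∑ c ℚ.* l                     ≡⟨ ∑-*ʳ l c ⟨
  ∑ (λ i → c i ℚ.* l)           ≤⟨ ∑-mono (λ i → *-monoˡ (c≥0 i) (bound i)) ⟩
  ∑ (λ i → c i ℚ.* x i)         ∎
  where open ℚₚ.≤-Reasoning

module _ {d N} {V : Fin N → Vecℚ d} where

  cone-resp : ∀ {x y s t} → (∀ j → y j ≡ x j) → s ≡ t → Cone V x s → Cone V y t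
  cone-resp y≗x refl (c , c≥0 , sum , eq) = c , c≥0 , sum , λ j → trans (y≗x j) (eq j)

  cone-0 : Cone V (const 0ℚ) 0ℚ
  cone-0 = const 0ℚ , (λ _ → ℚₚ.≤-refl) , ∑-0 N , λ j → sym (trans (∑-cong λ i → ℚₚ.*-zeroˡ (V i j)) (∑-0 N))

  cone-unit : ∀ i → Cone V (V i) 1ℚ
  cone-unit i = (λ j → if ⌊ i Fin.≟ j ⌋ then 1ℚ else 0ℚ) , nonneg
    , trans (∑-cong λ j → sym (ℚₚ.*-identityʳ (if ⌊ i Fin.≟ j ⌋ then 1ℚ else 0ℚ))) (∑-δ i (const 1ℚ)) , λ j → sym (∑-δ i (λ i → V i j))
    where
    nonneg : ∀ j → 0ℚ ℚ.≤ (if ⌊ i Fin.≟ j ⌋ then 1ℚ else 0ℚ)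
    nonneg j with ⌊ i Fin.≟ j ⌋
    ... | true  = ι-≤ {ℤ.+ 0} {ℤ.+ 1} (ℤ.+≤+ z≤n)
    ... | false = ℚₚ.≤-refl

  cone-+ : ∀ {x y s t} → Cone V x s → Cone V y t → Cone V (λ j → x j ℚ.+ y j) (s ℚ.+ t)
  cone-+ (c , c≥0 , sc , xc) (c′ , c′≥0 , sc′ , yc′) = (λ i → c i ℚ.+ c′ i)
    , (λ i → ℚₚ.≤-trans (ℚₚ.≤-reflexive (sym (ℚₚ.+-identityˡ 0ℚ))) (ℚₚ.+-mono-≤ (c≥0 i) (c′≥0 i)))
    , trans (∑-+ c c′) (cong₂ ℚ._+_ sc sc′)
    , λ j → trans (cong₂ ℚ._+_ (xc j) (yc′ j)) (trans (sym (∑-+ (λ i → c i ℚ.* V i j) (λ i → c′ i ℚ.* V i j)))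
        (∑-cong λ i → sym (ℚₚ.*-distribʳ-+ (V i j) (c i) (c′ i))))

  cone-scale : ∀ {x s} a → 0ℚ ℚ.≤ a → Cone V x s → Cone V (λ j → a ℚ.* x j) (a ℚ.* s)
  cone-scale a a≥0 (c , c≥0 , sc , xc) = (λ i → a ℚ.* c i) , (λ i → *-nonneg a≥0 (c≥0 i))
    , trans (∑-*ˡ a c) (cong (a ℚ.*_) sc)
    , λ j → trans (cong (a ℚ.*_) (xc j)) (trans (sym (∑-*ˡ a (λ i → c i ℚ.* V i j)))
        (∑-cong λ i → sym (ℚₚ.*-assoc a (c i) (V i j))))

  cone-∑ : ∀ {k} {x : Fin k → Vecℚ d} {s : Fin k → ℚ} → (∀ i → Cone V (x i) (s i)) → Cone V (λ j → ∑ (λ i → x i j)) (∑ s)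
  cone-∑ {zero}  cs = cone-0
  cone-∑ {suc k} cs = cone-+ (cs zero) (cone-∑ (cs ∘ suc))

  conv-trans : ∀ {k} {w : Fin k → Vecℚ d} {x} → (∀ i → Cone V (w i) 1ℚ) → ConvFam k w x → ConvFam N V x
  conv-trans ws (c , c≥0 , sc , xc) = cone-resp xc (trans (∑-cong λ i → ℚₚ.*-identityʳ (c i)) sc)
    (cone-∑ λ i → cone-scale (c i) (c≥0 i) (ws i))

  conv-dot : ∀ {x} (y : Vecℚ d) {c : Fin N → ℚ} → (∀ j → x j ≡ ∑ (λ i → c i ℚ.* V i j)) →
             x · y ≡ ∑ (λ i → c i ℚ.* (V i · y))
  conv-dot {x} y {c} xc = begin
    ∑ (λ j → x j ℚ.* y j)                               ≡⟨ ∑-cong (λ j → trans (cong (ℚ._* y j) (xc j)) (sym (∑-*ʳ (y j) (λ i → c i ℚ.* V i j)))) ⟩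
    ∑ (λ j → ∑ (λ i → c i ℚ.* V i j ℚ.* y j))           ≡⟨ ∑-swap (λ j i → c i ℚ.* V i j ℚ.* y j) ⟩
    ∑ (λ i → ∑ (λ j → c i ℚ.* V i j ℚ.* y j))           ≡⟨ ∑-cong (λ i → trans (∑-cong λ j → ℚₚ.*-assoc (c i) (V i j) (y j)) (∑-*ˡ (c i) (λ j → V i j ℚ.* y j))) ⟩
    ∑ (λ i → c i ℚ.* (V i · y))                         ∎
    where open ≡-Reasoning

  conv-dot-≥ : ∀ {x} (y : Vecℚ d) {l} → (∀ i → l ℚ.≤ V i · y) → ConvFam N V x → l ℚ.≤ x · y
  conv-dot-≥ {x} y {l} bound (c , c≥0 , sc , xc) =
    ℚₚ.≤-trans (average-≥ c≥0 sc bound) (ℚₚ.≤-reflexive (sym (conv-dot {x} y {c} xc)))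

  conv-affine : ∀ {x : Vecℚ d} {c} a (b : Vecℚ d) → ∑ {N} c ≡ 1ℚ → (∀ j → x j ≡ ∑ (λ i → c i ℚ.* V i j)) →
                ∀ j → a ℚ.* x j ℚ.- b j ≡ ∑ (λ i → c i ℚ.* (a ℚ.* V i j ℚ.- b j))
  conv-affine {x} {c} a b sc xc j = sym (begin
    ∑ (λ i → c i ℚ.* (a ℚ.* V i j ℚ.- b j))
      ≡⟨ ∑-cong (λ i → expand (c i) a (V i j) (b j)) ⟩
    ∑ (λ i → a ℚ.* (c i ℚ.* V i j) ℚ.+ c i ℚ.* (ℚ.- b j))
      ≡⟨ ∑-+ (λ i → a ℚ.* (c i ℚ.* V i j)) (λ i → c i ℚ.* (ℚ.- b j)) ⟩
    ∑ (λ i → a ℚ.* (c i ℚ.* V i j)) ℚ.+ ∑ (λ i → c i ℚ.* (ℚ.- b j))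
      ≡⟨ cong₂ ℚ._+_ (trans (∑-*ˡ a (λ i → c i ℚ.* V i j)) (cong (a ℚ.*_) (sym (xc j)))) (trans (∑-*ʳ (ℚ.- b j) c) (trans (cong (ℚ._* (ℚ.- b j)) sc) (ℚₚ.*-identityˡ (ℚ.- b j)))) ⟩
    a ℚ.* x j ℚ.- b j ∎)
    where
    open ≡-Reasoning
    open ℚSolver.+-*-Solver
    expand : ∀ c a v b → c ℚ.* (a ℚ.* v ℚ.- b) ≡ a ℚ.* (c ℚ.* v) ℚ.+ c ℚ.* (ℚ.- b)
    expand = solve 4 (λ c a v b → c :* (a :* v :- b) := a :* (c :* v) :+ c :* (:- b)) refl

-- Enumeration of vectors with entries in a finite list

grid : ∀ {A : Set} → List A → ∀ m → List (Fin m → A)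
grid vals zero    = (λ ()) ∷ []
grid vals (suc m) = List.cartesianProductWith (λ { a f zero → a ; a f (suc i) → f i }) vals (grid vals m)

grid-complete : ∀ {A : Set} (vals : List A) {m} (f : Fin m → A) → (∀ e → f e ∈ vals) → Any (λ g → g ≗ f) (grid vals m)
grid-complete vals {zero}  f f∈ = here λ ()
grid-complete vals {suc m} f f∈ = Anyₚ.cartesianProductWith⁺ _ (λ { a≡ g≗ zero → sym a≡ ; a≡ g≗ (suc i) → g≗ i })
  (f∈ zero) (grid-complete vals (f ∘ suc) (f∈ ∘ suc))

-- Grid points violating P are replaced by the default one, so that no filtering is needed.
family : ∀ {A : Set} (vals : List A) {m} (P : (Fin m → A) → Set) → (∀ f → Dec (P f)) →
         (∀ {f g} → g ≗ f → P f → P g) → ∃ P →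
         ∃₂ λ N (F : Fin N → Fin m → A) → (∀ i → P (F i)) × (∀ f → (∀ e → f e ∈ vals) → P f → ∃ λ i → F i ≗ f)
family vals {m} P P? resp (f₀ , Pf₀) = length (grid vals m) , (λ i → pick (List.lookup (grid vals m) i))
  , (λ i → pick-P (List.lookup (grid vals m) i))
  , λ f f∈ Pf → let any = grid-complete vals f f∈ in Any.index any
      , λ e → trans (cong (λ h → h e) (pick-id _ (resp (Anyₚ.lookup-index any) Pf))) (Anyₚ.lookup-index any e)
  where
  pick : (Fin m → _) → Fin m → _
  pick f with P? f
  ... | yes _ = f
  ... | no _  = f₀
  pick-P : ∀ f → P (pick f)
  pick-P f with P? f
  ... | yes Pf = Pf
  ... | no _   = Pf₀
  pick-id : ∀ f → P f → pick f ≡ f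
  pick-id f Pf with P? f
  ... | yes _ = refl
  ... | no ¬Pf = ⊥-elim (¬Pf Pf)

-- Integer weights and vertex sets given by lists

module Wℤ = Weight ℤₚ.+-0-commutativeMonoid

wtℤ : ∀ {m} → (Fin m → ℤ) → (Fin m → Bool) → ℤ
wtℤ = Wℤ.wt

b2z : Bool → ℤ
b2z b = ℤ.+ b2n b

sumℤ-+ : ∀ {m} (f g : Fin m → ℤ) → sumℤ (λ e → f e ℤ.+ g e) ≡ sumℤ f ℤ.+ sumℤ g
sumℤ-+ = ℤΣ.∑-distrib-+

sumℤ-cong : ∀ {m} {f g : Fin m → ℤ} → f ≗ g → sumℤ f ≡ sumℤ g
sumℤ-cong = ℤΣ.sum-cong-≗

sumℤ-*ˡ : ∀ {m} c (f : Fin m → ℤ) → sumℤ (λ e → c ℤ.* f e) ≡ c ℤ.* sumℤ f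
sumℤ-*ˡ c f = sym (ℤΣ.*-distribˡ-sum c f)

sumℤ-neg : ∀ {m} (f : Fin m → ℤ) → sumℤ (λ e → ℤ.- f e) ≡ ℤ.- sumℤ f
sumℤ-neg f = trans (sumℤ-cong λ e → sym (ℤₚ.-1*i≡-i (f e))) (trans (sumℤ-*ˡ ℤ.-1ℤ f) (ℤₚ.-1*i≡-i (sumℤ f)))

sumℤ-pos : ∀ {m} (f : Fin m → ℕ) → sumℤ (λ e → ℤ.+ f e) ≡ ℤ.+ sum f
sumℤ-pos {zero}  f = refl
sumℤ-pos {suc m} f = cong (ℤ._+_ (ℤ.+ f zero)) (sumℤ-pos (f ∘ suc))

⊙ℤ-* : ∀ b x → b Wℤ.⊙ x ≡ b2z b ℤ.* x
⊙ℤ-* true  x = sym (ℤₚ.*-identityˡ x)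
⊙ℤ-* false x = sym (ℤₚ.*-zeroˡ x)

wtℤ-pos : ∀ {m} (g : Fin m → ℕ) M → wtℤ (λ e → ℤ.+ g e) M ≡ ℤ.+ wt g M
wtℤ-pos g M = trans (sumℤ-cong λ e → pos-⊙ (M e)) (sumℤ-pos (λ e → M e ⊙ g e))
  where
  pos-⊙ : ∀ b {x} → b Wℤ.⊙ (ℤ.+ x) ≡ ℤ.+ (b ⊙ x)
  pos-⊙ true  = refl
  pos-⊙ false = refl

wtℤ-neg : ∀ {m} (g : Fin m → ℤ) M → wtℤ (λ e → ℤ.- g e) M ≡ ℤ.- wtℤ g M
wtℤ-neg g M = trans (sumℤ-cong λ e → neg-⊙ (M e)) (sumℤ-neg (λ e → M e Wℤ.⊙ g e))
  where
  neg-⊙ : ∀ b {x} → b Wℤ.⊙ (ℤ.- x) ≡ ℤ.- (b Wℤ.⊙ x)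
  neg-⊙ true  = refl
  neg-⊙ false = refl

infix 4 _∈?_
_∈?_ : ∀ {n} (v : Fin n) xs → Dec (v ∈ xs)
_∈?_ = DecMembership._∈?_ Fin._≟_

set⟦_⟧ : ∀ {n} → List (Fin n) → Fin n → Bool
set⟦ xs ⟧ v = ⌊ v ∈? xs ⌋

∈⇒set : ∀ {n} {v : Fin n} xs → v ∈ xs → set⟦ xs ⟧ v ≡ true
∈⇒set xs = dec⇒true (_ ∈? xs)

set⇒∈ : ∀ {n} {v : Fin n} xs → set⟦ xs ⟧ v ≡ true → v ∈ xs
set⇒∈ xs = true⇒dec (_ ∈? xs)

count-set≤ : ∀ {n} (xs : List (Fin n)) → count set⟦ xs ⟧ ≤ length xs
count-set≤ xs = count≤length set⟦ xs ⟧ xs λ v → set⇒∈ xs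

count-set : ∀ {n} (xs : List (Fin n)) → Unique xs → count set⟦ xs ⟧ ≡ length xs
count-set xs u = count-list set⟦ xs ⟧ xs u (All.tabulate (∈⇒set xs)) (λ v → set⇒∈ xs)

elements : ∀ {n} (S : Fin n → Bool) → ∃ λ xs → length xs ≡ count S × (∀ v → S v ≡ true → v ∈ xs) × All (λ v → S v ≡ true) xs
elements {n} S = go (count S) S refl
  where
  go : ∀ k (S : Fin n → Bool) → count S ≡ k → ∃ λ xs → length xs ≡ k × (∀ v → S v ≡ true → v ∈ xs) × All (λ v → S v ≡ true) xs
  go zero    S eq = [] , refl , (λ v Sv → contradiction (count≥1 S v Sv) (<⇒≱ (s≤s (≤-reflexive eq)))) , []
  go (suc k) S eq with member S (subst (1 ≤_) (sym eq) (s≤s z≤n))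
  ... | x , Sx with go k (unset S x) (suc-injective (trans (sym (wt-unset (const 1) S x Sx)) eq))
  ... | xs , len , all , sub = x ∷ xs , cong suc len , covers , Sx ∷ All.map (λ t → proj₁ (unset-⊆ S x t)) sub
    where
    covers : ∀ v → S v ≡ true → v ∈ x ∷ xs
    covers v Sv with v Fin.≟ x
    ... | yes refl = here refl
    ... | no v≢x   = there (all v (unset-⊇ S x Sv v≢x))

-- The cyclic order on five points

next₅ prev₅ : Fin 5 → Fin 5
next₅ zero                               = suc zero
next₅ (suc zero)                         = suc (suc zero)
next₅ (suc (suc zero))                   = suc (suc (suc zero))
next₅ (suc (suc (suc zero)))             = suc (suc (suc (suc zero)))
next₅ (suc (suc (suc (suc zero))))       = zero
prev₅ zero                               = suc (suc (suc (suc zero)))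
prev₅ (suc zero)                         = zero
prev₅ (suc (suc zero))                   = suc zero
prev₅ (suc (suc (suc zero)))             = suc (suc zero)
prev₅ (suc (suc (suc (suc zero))))       = suc (suc (suc zero))

C5-next : ∀ i → C5-adj i (next₅ i) ≡ true
C5-next = from-yes (Finₚ.all? λ i → true? (C5-adj i (next₅ i)))

C5-prev : ∀ i → C5-adj i (prev₅ i) ≡ true
C5-prev = from-yes (Finₚ.all? λ i → true? (C5-adj i (prev₅ i)))

next≢prev : ∀ i → next₅ i ≢ prev₅ i
next≢prev = from-yes (Finₚ.all? λ i → ¬? (next₅ i Fin.≟ prev₅ i))

C5-only : ∀ i j → C5-adj i j ≡ true → j ≡ next₅ i ⊎ j ≡ prev₅ i
C5-only = from-yes (Finₚ.all? λ i → Finₚ.all? λ j → true? (C5-adj i j) →-dec ((j Fin.≟ next₅ i) ⊎-dec (j Fin.≟ prev₅ i)))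

C5-no-triangle : ∀ i j k → C5-adj i j ≡ true → C5-adj j k ≡ true → ¬ C5-adj i k ≡ true
C5-no-triangle = from-yes (Finₚ.all? λ i → Finₚ.all? λ j → Finₚ.all? λ k → true? (C5-adj i j) →-dec (true? (C5-adj j k) →-dec ¬? (true? (C5-adj i k))))

-- Tight averages

ℚ<⇒≱ : ∀ {x y} → x ℚ.< y → ¬ y ℚ.≤ x
ℚ<⇒≱ x<y y≤x = ℚₚ.<-irrefl refl (ℚₚ.<-≤-trans x<y y≤x)

term≤∑ : ∀ {N} {x : Fin N → ℚ} → (∀ i → 0ℚ ℚ.≤ x i) → ∀ i → x i ℚ.≤ ∑ x
term≤∑ {suc N} {x} x≥0 zero    = ℚₚ.≤-trans (ℚₚ.≤-reflexive (sym (ℚₚ.+-identityʳ (x zero)))) (ℚₚ.+-monoʳ-≤ (x zero)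
  (ℚₚ.≤-trans (ℚₚ.≤-reflexive (sym (∑-0 N))) (∑-mono (x≥0 ∘ suc))))
term≤∑ {suc N} {x} x≥0 (suc i) = ℚₚ.≤-trans (term≤∑ (x≥0 ∘ suc) i)
  (ℚₚ.≤-trans (ℚₚ.≤-reflexive (sym (ℚₚ.+-identityˡ _))) (ℚₚ.+-monoˡ-≤ (∑ (x ∘ suc)) (x≥0 zero)))

-- All terms `c j * (z j + 1)` are nonnegative and their sum is zero. An integer above -1 exceeds it
-- by at least one, so its coefficient would be bounded by that sum.
average-tight : ∀ {N} {c : Fin N → ℚ} (z : Fin N → ℤ) → (∀ i → 0ℚ ℚ.≤ c i) → ∑ c ≡ 1ℚ → (∀ i → ℤ.-1ℤ ℤ.≤ z i) →
                ∑ (λ i → c i ℚ.* ι (z i)) ≡ ℚ.- 1ℚ → ∀ i → 0ℚ ℚ.< c i → z i ≡ ℤ.-1ℤ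
average-tight {c = c} z c≥0 sc bound attained i c>0 = ℤₚ.≤-antisym (ℤₚ.≮⇒≥ (λ lt → ℚ<⇒≱ c>0 (begin
  c i                                        ≡⟨ ℚₚ.*-identityʳ (c i) ⟨
  c i ℚ.* 1ℚ                                 ≤⟨ *-monoˡ (c≥0 i) (ι-≤ {ℤ.1ℤ} {z i ℤ.+ ℤ.1ℤ} (ℤₚ.+-monoˡ-≤ ℤ.1ℤ (ℤₚ.i<j⇒suc[i]≤j lt))) ⟩
  c i ℚ.* ι (z i ℤ.+ ℤ.1ℤ)                   ≤⟨ term≤∑ (λ j → *-nonneg (c≥0 j) (ι-≤ {ℤ.0ℤ} {z j ℤ.+ ℤ.1ℤ} (ℤₚ.+-monoˡ-≤ ℤ.1ℤ (bound j)))) i ⟩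
  ∑ (λ j → c j ℚ.* ι (z j ℤ.+ ℤ.1ℤ))         ≡⟨ ∑-cong (λ j → trans (cong (c j ℚ.*_) (ι-+ (z j) ℤ.1ℤ)) (ℚₚ.*-distribˡ-+ (c j) (ι (z j)) 1ℚ)) ⟩
  ∑ (λ j → c j ℚ.* ι (z j) ℚ.+ c j ℚ.* 1ℚ)   ≡⟨ ∑-+ (λ j → c j ℚ.* ι (z j)) (λ j → c j ℚ.* 1ℚ) ⟩
  ∑ (λ j → c j ℚ.* ι (z j)) ℚ.+ ∑ (λ j → c j ℚ.* 1ℚ)
    ≡⟨ cong₂ ℚ._+_ attained (trans (∑-cong λ j → ℚₚ.*-identityʳ (c j)) sc) ⟩
  0ℚ                                         ∎))) (bound i)
  where open ℚₚ.≤-Reasoning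

positive-coefficient : ∀ {N} (c : Fin N → ℚ) → ∑ c ≡ 1ℚ → ∃ λ i → 0ℚ ℚ.< c i
positive-coefficient {N} c sc with Finₚ.any? (λ i → 0ℚ ℚ.<? c i)
... | yes r   = r
... | no none = ⊥-elim (ℚ<⇒≱ (ℚ.*<* (ℤ.+<+ (s≤s z≤n))) (ℚₚ.≤-trans (ℚₚ.≤-reflexive (sym sc))
      (ℚₚ.≤-trans (∑-mono {g = const 0ℚ} λ i → ℚₚ.≮⇒≥ λ lt → none (i , lt)) (ℚₚ.≤-reflexive (∑-0 N)))))

-- Lists, walks and odd cycles

∈-swap : ∀ {A : Set} {v : A} xs ys → v ∈ xs ++ ys → v ∈ ys ++ xs
∈-swap xs ys v∈ with ∈-++⁻ xs v∈
... | inj₁ v∈xs = ∈-++⁺ʳ ys v∈xs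
... | inj₂ v∈ys = ∈-++⁺ˡ v∈ys

∈-split : ∀ {A : Set} {v : A} {xs} → v ∈ xs → ∃₂ λ ys zs → xs ≡ ys ++ v ∷ zs
∈-split = ∈-∃++

unique-++⁻ : ∀ {A : Set} (xs : List A) {ys} → Unique (xs ++ ys) → Unique xs × Unique ys × (∀ {v} → v ∈ xs → v ∉ ys)
unique-++⁻ []       u         = [] , u , λ ()
unique-++⁻ (x ∷ xs) (x∉ ∷ u) with unique-++⁻ xs u
... | ux , uy , disj = (Allₚ.++⁻ˡ xs x∉ ∷ ux) , uy , λ { (here refl) v∈ → All.lookup (Allₚ.++⁻ʳ xs x∉) v∈ refl ; (there v∈) → disj v∈ }

unique-++⁺ : ∀ {A : Set} {xs ys : List A} → Unique xs → Unique ys → (∀ {v} → v ∈ xs → v ∉ ys) → Unique (xs ++ ys)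
unique-++⁺ ux uy disj = Uniqueₚ.++⁺ ux uy (λ (a , b) → disj a b)

unique-head : ∀ {A : Set} {x : A} {xs} → Unique (x ∷ xs) → x ∉ xs
unique-head (x∉ ∷ _) x∈ = All.lookup x∉ x∈ refl

unique-∷ : ∀ {A : Set} {x : A} {xs} → x ∉ xs → Unique xs → Unique (x ∷ xs)
unique-∷ x∉ u = All.tabulate (λ { y∈ refl → x∉ y∈ }) ∷ u

unique-rotate : ∀ {A : Set} (xs : List A) {ys} → Unique (xs ++ ys) → Unique (ys ++ xs)
unique-rotate xs u = let (a , b , d) = unique-++⁻ xs u in unique-++⁺ b a λ v∈ys v∈xs → d v∈xs v∈ys

halve : ∀ n → ∃ λ s → n ≡ 2 * s ⊎ n ≡ suc (2 * s)
halve zero    = 0 , inj₁ refl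
halve (suc n) with halve n
... | s , inj₁ eq = s , inj₂ (cong suc eq)
... | s , inj₂ eq = suc s , inj₁ (trans (cong suc eq) (sym (*-suc 2 s)))

module Chains {V : Set} where

  Chain : (V → V → Set) → V → List V → V → Set
  Chain R u []       v = R u v
  Chain R u (x ∷ xs) v = R u x × Chain R x xs v

  chain-map : ∀ {R R′ : V → V → Set} → (∀ {u v} → R u v → R′ u v) → ∀ {u} xs {v} → Chain R u xs v → Chain R′ u xs v
  chain-map f []       r       = f r
  chain-map f (x ∷ xs) (r , c) = f r , chain-map f xs c

  chain-join : ∀ {R u} xs {y ys v} → Chain R u xs y → Chain R y ys v → Chain R u (xs ++ y ∷ ys) v
  chain-join []       r       c = r , c
  chain-join (x ∷ xs) (r , d) c = r , chain-join xs d c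

  chain-split : ∀ {R u} xs {y ys v} → Chain R u (xs ++ y ∷ ys) v → Chain R u xs y × Chain R y ys v
  chain-split []       (r , c) = r , c
  chain-split (x ∷ xs) (r , c) = let (a , b) = chain-split xs c in (r , a) , b

  -- The parameter `t` is the size of a near-perfect matching of the cycle. For `t = 0` this is a
  -- looped vertex, which the adjacency of a simple graph rules out.
  data OddCycle (R : V → V → Set) (t : ℕ) : List V → Set where
    oddCycle : ∀ {a A} → Unique (a ∷ A) → Chain R a A a → length A ≡ 2 * t → OddCycle R t (a ∷ A)

  cycle-length : ∀ {R t c} → OddCycle R t c → length c ≡ suc (2 * t)
  cycle-length (oddCycle _ _ len) = cong suc len

  cycle-unique : ∀ {R t c} → OddCycle R t c → Unique c
  cycle-unique (oddCycle u _ _) = u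

  length-swap : ∀ (xs : List V) {ys} → length (xs ++ ys) ≡ length (ys ++ xs)
  length-swap xs {ys} = trans (Listₚ.length-++ xs) (trans (+-comm (length xs) (length ys)) (sym (Listₚ.length-++ ys)))

  -- Rotations are carried out on closed walks, so that distinctness and parity need not be threaded
  -- through them.
  data Closed (R : V → V → Set) : List V → Set where
    closedWalk : ∀ {a A} → Chain R a A a → Closed R (a ∷ A)

  closed-rotate₁ : ∀ {R} x D → Closed R (x ∷ D) → Closed R (D ++ x ∷ [])
  closed-rotate₁ x []      cl             = cl
  closed-rotate₁ x (y ∷ D) (closedWalk (r , c)) = closedWalk (chain-join D c r)

  closed-rotate : ∀ {R} xs {ys} → Closed R (xs ++ ys) → Closed R (ys ++ xs)
  closed-rotate {R} []       {ys} cl = subst (Closed R) (sym (Listₚ.++-identityʳ ys)) cl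
  closed-rotate {R} (x ∷ xs) {ys} cl = subst (Closed R) (Listₚ.++-assoc ys (x ∷ []) xs)
    (closed-rotate xs (subst (Closed R) (Listₚ.++-assoc xs ys (x ∷ [])) (closed-rotate₁ x (xs ++ ys) cl)))

  to-closed : ∀ {R t c} → OddCycle R t c → Closed R c
  to-closed (oddCycle _ c _) = closedWalk c

  from-closed : ∀ {R t c} → Closed R c → Unique c → length c ≡ suc (2 * t) → OddCycle R t c
  from-closed (closedWalk c) u len = oddCycle u c (suc-injective len)

  rotate : ∀ {R t} xs {ys} → OddCycle R t (xs ++ ys) → OddCycle R t (ys ++ xs)
  rotate xs {ys} cyc = from-closed (closed-rotate xs (to-closed cyc)) (unique-rotate xs (cycle-unique cyc))
    (trans (length-swap ys) (cycle-length cyc))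

open Chains public

wtℤ-single : ∀ {m} (g : Fin m → ℤ) e → wtℤ g (set (const false) e) ≡ g e
wtℤ-single g e = trans (Wℤ.wt-set g (const false) e refl) (trans (cong (ℤ._+_ (g e)) (Wℤ.wt-∅ g)) (ℤₚ.+-identityʳ (g e)))

wt-inside : ∀ {m} (X M : Fin m → Bool) → (∀ e → M e ≡ true → X e ≡ true) → wt (b2n ∘ X) M ≡ count M
wt-inside X M M⊆X = sum-cong-≗ pointwise
  where
  pointwise : ∀ e → M e ⊙ b2n (X e) ≡ b2n (M e)
  pointwise e with M e in eq
  ... | true  = cong b2n (M⊆X e eq)
  ... | false = refl

unique⊎repeat : ∀ {n} (xs : List (Fin n)) → Unique xs ⊎ ∃₂ λ P x → ∃₂ λ Q S → xs ≡ P ++ x ∷ Q ++ x ∷ S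
unique⊎repeat []       = inj₁ []
unique⊎repeat (x ∷ xs) with x ∈? xs | unique⊎repeat xs
... | yes x∈ | _ = let (Q , S , eq) = ∈-split x∈ in inj₂ ([] , x , Q , S , cong (x ∷_) eq)
... | no x∉  | inj₁ u = inj₁ (unique-∷ x∉ u)
... | no x∉  | inj₂ (P , y , Q , S , eq) = inj₂ (x ∷ P , y , Q , S , cong (x ∷_) eq)

chain-last : ∀ {V : Set} {R : V → V → Set} {u} x xs {w} → Chain R u (x ∷ xs) w → ∃₂ λ ys z → x ∷ xs ≡ ys ++ z ∷ [] × R z w
chain-last x []       (_ , r) = [] , x , refl , r
chain-last x (y ∷ xs) (_ , c) = let (ys , z , eq , r) = chain-last y xs c in x ∷ ys , z , cong (x ∷_) eq , r

-- Splitting an odd closed walk at a repeated vertex leaves a shorter odd closed walk.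
odd-cycle-in : ∀ {n} {R : Fin n → Fin n → Set} k {c} → Closed R c → ∀ s → length c ≡ suc (2 * s) → length c ≤ k → ∃₂ (OddCycle R)
odd-cycle-in zero    (closedWalk _) s len ()
odd-cycle-in {R = R} (suc k) {c} cl s len len≤ with unique⊎repeat c
... | inj₁ u = s , c , from-closed cl u len
... | inj₂ (P , x , Q , S , refl) = split (halve (length Q)) (halve (length (S ++ P)))
  where
  rotated : Closed R (x ∷ (Q ++ x ∷ S) ++ P)
  rotated = closed-rotate P cl
  chains : ∀ {W} → W ≡ (Q ++ x ∷ S) ++ P → Closed R (x ∷ W) → Chain R x Q x × Chain R x (S ++ P) x
  chains eq (closedWalk c) = chain-split Q (subst (λ l → Chain R x l x) (trans eq (Listₚ.++-assoc Q (x ∷ S) P)) c)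
  loops : Chain R x Q x × Chain R x (S ++ P) x
  loops = chains refl rotated
  lengths : suc (length Q) + suc (length (S ++ P)) ≡ suc (2 * s)
  lengths = trans (sym (trans (cong length (cong (x ∷_) (Listₚ.++-assoc Q (x ∷ S) P))) (Listₚ.length-++ (x ∷ Q))))
    (trans (length-swap (x ∷ Q ++ x ∷ S) {P}) len)
  lt₁ : suc (length Q) ≤ k
  lt₁ = ≤-pred (≤-trans (≤-trans (s≤s (m≤m+n (suc (length Q)) (length (S ++ P)))) (≤-reflexive (trans (sym (+-suc (suc (length Q)) _)) (trans lengths (sym len))))) len≤)
  lt₂ : suc (length (S ++ P)) ≤ k
  lt₂ = ≤-pred (≤-trans (≤-trans (s≤s (m≤n+m (suc (length (S ++ P))) (length Q))) (≤-reflexive (trans lengths (sym len)))) len≤)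
  split : (∃ λ h → length Q ≡ 2 * h ⊎ length Q ≡ suc (2 * h)) → (∃ λ h → length (S ++ P) ≡ 2 * h ⊎ length (S ++ P) ≡ suc (2 * h)) → ∃₂ (OddCycle R)
  split (h , inj₁ even) _ = odd-cycle-in k (closedWalk {a = x} {A = Q} (proj₁ loops)) h (cong suc even) lt₁
  split (h , inj₂ odd) (i , inj₁ even) = odd-cycle-in k (closedWalk {a = x} {A = S ++ P} (proj₂ loops)) i (cong suc even) lt₂
  split (h , inj₂ odd) (i , inj₂ odd′) = ⊥-elim (even≢odd (suc h + suc i) s (trans (sym (lemma h i)) (trans (sym (cong₂ (λ a b → suc a + suc b) odd odd′)) lengths)))
    where
    lemma : ∀ h i → suc (suc (2 * h)) + suc (suc (2 * i)) ≡ 2 * (suc h + suc i)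
    lemma = ℕRing.solve-∀

lookup-injective : ∀ {A : Set} {xs : List A} → Unique xs → ∀ i j → List.lookup xs i ≡ List.lookup xs j → i ≡ j
lookup-injective (x∉ ∷ u) zero    zero    eq = refl
lookup-injective (x∉ ∷ u) zero    (suc j) eq = ⊥-elim (All.lookup x∉ (∈-lookup j) eq)
lookup-injective (x∉ ∷ u) (suc i) zero    eq = ⊥-elim (All.lookup x∉ (∈-lookup i) (sym eq))
lookup-injective (x∉ ∷ u) (suc i) (suc j) eq = cong suc (lookup-injective u i j eq)

-- Tables of the small graphs and arithmetic of ears

same? : ∀ {k} (x y : Fin k × Fin k) → Dec (SameEnds x y)
same? (a , b) (c , d) = ((a Fin.≟ c) ×-dec (b Fin.≟ d)) ⊎-dec ((a Fin.≟ d) ×-dec (b Fin.≟ c))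

pairs-adj : ∀ {k} {R : Fin k → Fin k → Set} → (∀ {i j} → R i j → R j i) → ∀ {L} → All (λ (i , j) → R i j) L →
            ∀ {i j} → Any (λ x → SameEnds x (i , j)) L → R i j
pairs-adj R-sym (r ∷ _)  (here (inj₁ (refl , refl))) = r
pairs-adj R-sym (r ∷ _)  (here (inj₂ (refl , refl))) = R-sym r
pairs-adj R-sym (_ ∷ rs) (there x)                   = pairs-adj R-sym rs x

unique? : ∀ {k} (xs : List (Fin k)) → Dec (Unique xs)
unique? = AllPairs.allPairs? (λ i j → ¬? (i Fin.≟ j))

next-prev : ∀ i → next₅ (prev₅ i) ≡ i
next-prev = from-yes (Finₚ.all? λ i → next₅ (prev₅ i) Fin.≟ i)

-- The index 1 goes to `i`, so that the chords starting at `i` and `i + 1` become the chords {1,3}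
-- and {2,4} of C'_5.
rot : Fin 5 → Fin 5 → Fin 5
rot i zero                         = prev₅ i
rot i (suc zero)                   = i
rot i (suc (suc zero))             = next₅ i
rot i (suc (suc (suc zero)))       = next₅ (next₅ i)
rot i (suc (suc (suc (suc zero)))) = next₅ (next₅ (next₅ i))

rot-next : ∀ i j → rot i (next₅ j) ≡ next₅ (rot i j)
rot-next = from-yes (Finₚ.all? λ i → Finₚ.all? λ j → rot i (next₅ j) Fin.≟ next₅ (rot i j))

rot-injective : ∀ i {j j′} → rot i j ≡ rot i j′ → j ≡ j′
rot-injective i {j} {j′} = table i j j′
  where
  table : ∀ i j j′ → rot i j ≡ rot i j′ → j ≡ j′
  table = from-yes (Finₚ.all? λ i → Finₚ.all? λ j → Finₚ.all? λ j′ → (rot i j Fin.≟ rot i j′) →-dec (j Fin.≟ j′))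

five-pairs : ∀ i j → i ≢ j → (j ≡ next₅ i ⊎ i ≡ next₅ j) ⊎ (j ≡ next₅ (next₅ i) ⊎ i ≡ next₅ (next₅ j))
five-pairs = from-yes (Finₚ.all? λ i → Finₚ.all? λ j → ¬? (i Fin.≟ j) →-dec
  (((j Fin.≟ next₅ i) ⊎-dec (i Fin.≟ next₅ j)) ⊎-dec ((j Fin.≟ next₅ (next₅ i)) ⊎-dec (i Fin.≟ next₅ (next₅ j)))))

-- These would be the neighbours of `i + 2` if it had a chord on both sides.
four-neighbours : ∀ i → Unique (next₅ (next₅ (next₅ i)) ∷ next₅ i ∷ i ∷ next₅ (next₅ (next₅ (next₅ i))) ∷ [])
four-neighbours = from-yes (Finₚ.all? λ i →
  unique? (next₅ (next₅ (next₅ i)) ∷ next₅ i ∷ i ∷ next₅ (next₅ (next₅ (next₅ i))) ∷ []))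

cycle-map : ∀ {V : Set} {R R′ : V → V → Set} → (∀ {u v} → R u v → R′ u v) → ∀ {t c} → OddCycle R t c → OddCycle R′ t c
cycle-map f (oddCycle {A = A} u c len) = oddCycle u (chain-map f A c) len

C5′-table : List (Fin 5 × Fin 5)
C5′-table = (# 0 , # 1) ∷ (# 1 , # 2) ∷ (# 2 , # 3) ∷ (# 3 , # 4) ∷ (# 4 , # 0) ∷ (# 1 , # 3) ∷ (# 2 , # 4) ∷ []

C5′-covers : ∀ i j → C5′-adj i j ≡ true → Any (λ x → SameEnds x (i , j)) C5′-table
C5′-covers = from-yes (Finₚ.all? λ i → Finₚ.all? λ j → true? (C5′-adj i j) →-dec Any.any? (λ x → same? x (i , j)) C5′-table)

C5′-symmetric : ∀ i j → C5′-adj i j ≡ true → C5′-adj j i ≡ true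
C5′-symmetric = from-yes (Finₚ.all? λ i → Finₚ.all? λ j → true? (C5′-adj i j) →-dec true? (C5′-adj j i))

K3-table : List (Fin 3 × Fin 3)
K3-table = (# 0 , # 1) ∷ (# 0 , # 2) ∷ (# 1 , # 2) ∷ []

K3-covers : ∀ i j → K3-adj i j ≡ true → Any (λ x → SameEnds x (i , j)) K3-table
K3-covers = from-yes (Finₚ.all? λ i → Finₚ.all? λ j → true? (K3-adj i j) →-dec Any.any? (λ x → same? x (i , j)) K3-table)

K3-complete : ∀ i j → i ≢ j → K3-adj i j ≡ true
K3-complete = from-yes (Finₚ.all? λ i → Finₚ.all? λ j → ¬? (i Fin.≟ j) →-dec true? (K3-adj i j))

K112-table : List (Fin 4 × Fin 4)
K112-table = (# 0 , # 1) ∷ (# 0 , # 2) ∷ (# 0 , # 3) ∷ (# 1 , # 2) ∷ (# 1 , # 3) ∷ []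

K4-covers : ∀ i j → K4-adj i j ≡ true → Any (λ x → SameEnds x (i , j)) ((# 2 , # 3) ∷ K112-table)
K4-covers = from-yes (Finₚ.all? λ i → Finₚ.all? λ j → true? (K4-adj i j) →-dec Any.any? (λ x → same? x (i , j)) ((# 2 , # 3) ∷ K112-table))

K4-complete : ∀ i j → i ≢ j → K4-adj i j ≡ true
K4-complete = from-yes (Finₚ.all? λ i → Finₚ.all? λ j → ¬? (i Fin.≟ j) →-dec true? (K4-adj i j))

K112-covers : ∀ i j → K112-adj i j ≡ true → Any (λ x → SameEnds x (i , j)) K112-table
K112-covers = from-yes (Finₚ.all? λ i → Finₚ.all? λ j → true? (K112-adj i j) →-dec Any.any? (λ x → same? x (i , j)) K112-table)

K112-missing : ∀ i j → i ≢ j → K112-adj i j ≡ true ⊎ SameEnds (# 2 , # 3) (i , j)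
K112-missing = from-yes (Finₚ.all? λ i → Finₚ.all? λ j → ¬? (i Fin.≟ j) →-dec (true? (K112-adj i j) ⊎-dec same? (# 2 , # 3) (i , j)))


slack-regroup : ∀ d y z s → (d ℤ.- y) ℤ.- (z ℤ.+ s) ≡ d ℤ.- (s ℤ.+ (z ℤ.+ y))
slack-regroup = ℤRing.solve-∀

pairing-regroup : ∀ d k a y → d ℤ.+ (k ℤ.* (ℤ.- a) ℤ.- y) ≡ (d ℤ.- y) ℤ.- k ℤ.* a
pairing-regroup = ℤRing.solve-∀

neg-cancel : ∀ y z → y ≡ ℤ.- z ℤ.+ (z ℤ.+ y)
neg-cancel = ℤRing.solve-∀

add-difference : ∀ d s t → d ≡ (s ℤ.+ t) ℤ.+ (d ℤ.- (s ℤ.+ t))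
add-difference = ℤRing.solve-∀

-- This and the next two identities count a cycle without its starting vertex: the first vertex of
-- the ear, its further vertices, and the old vertices (two, three or one) that close the cycle with
-- the right parity.
ear-odd : ∀ s → suc (suc (2 * s) + 2) ≡ 2 * suc (suc s)
ear-odd = ℕRing.solve-∀

ear-even : ∀ s → suc (2 * s + 3) ≡ 2 * suc (suc s)
ear-even = ℕRing.solve-∀

ear-chord : ∀ s → suc (2 * suc s + 1) ≡ 2 * suc (suc s)
ear-chord = ℕRing.solve-∀

ℤ-cancelʳ : ∀ {a b d : ℤ} → a ℤ.+ d ≡ b ℤ.+ d → a ≡ b
ℤ-cancelʳ {a} {b} {d} = GroupProperties.∙-cancelʳ (AbelianGroup.group ℤₚ.+-0-abelianGroup) d a b

add-zero : ∀ {a b : ℤ} → a ℤ.+ b ≡ b → a ≡ ℤ.0ℤ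
add-zero {a} {b} eq = ℤ-cancelʳ {a} {ℤ.0ℤ} {b} (trans eq (sym (ℤₚ.+-identityˡ b)))

module GraphTheory (G : Graph) where

  -- Incidence and matchings

  module Matchings where
    open Graph G public

    V E : Set
    V = Fin n
    E = Fin m

    p q : E → V
    p e = proj₁ (ends e)
    q e = proj₂ (ends e)

    infix 4 _∋_
    _∋_ : E → V → Set
    e ∋ u = Incident G e u

    ∋⇒incident : ∀ {e u} → e ∋ u → incident? G e u ≡ true
    ∋⇒incident {e} {u} (inj₁ eq) rewrite dec⇒true (p e Fin.≟ u) eq = refl
    ∋⇒incident {e} {u} (inj₂ eq) rewrite dec⇒true (q e Fin.≟ u) eq with ⌊ p e Fin.≟ u ⌋
    ... | true  = refl
    ... | false = refl

    incident⇒∋ : ∀ {e u} → incident? G e u ≡ true → e ∋ u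
    incident⇒∋ {e} {u} t with p e Fin.≟ u | q e Fin.≟ u
    ... | yes eq | _      = inj₁ eq
    ... | no _   | yes eq = inj₂ eq

    _∋?_ : ∀ e u → Dec (e ∋ u)
    e ∋? u = (p e Fin.≟ u) ⊎-dec (q e Fin.≟ u)

    Misses : (E → Bool) → V → Set
    Misses M u = ∀ e → M e ≡ true → ¬ e ∋ u

    cover? : ∀ M u → (∃ λ e → M e ≡ true × e ∋ u) ⊎ Misses M u
    cover? M u with Finₚ.any? (λ e → true? (M e) ×-dec (e ∋? u))
    ... | yes c   = inj₁ c
    ... | no none = inj₂ λ e Me e∋u → none (e , Me , e∋u)

    misses? : ∀ M u → Dec (Misses M u)
    misses? M u = Finₚ.all? λ e → true? (M e) →-dec ¬? (e ∋? u)

    matching? : ∀ M → Dec (IsMatching G M)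
    matching? M = Finₚ.all? λ e → Finₚ.all? λ e′ → true? (M e) →-dec (true? (M e′) →-dec
      (¬? (e Fin.≟ e′) →-dec Finₚ.all? λ u → (e ∋? u) →-dec ¬? (e′ ∋? u)))

    ∅ : E → Bool
    ∅ = const false

    ∅-matching : IsMatching G ∅
    ∅-matching _ _ ()

    misses-resp : ∀ {M N u} → M ≗ N → Misses M u → Misses N u
    misses-resp M≗N miss e Ne = miss e (trans (M≗N e) Ne)

    matching-⊆ : ∀ {M N} → (∀ e → N e ≡ true → M e ≡ true) → IsMatching G M → IsMatching G N
    matching-⊆ N⊆M mat e e′ Ne Ne′ = mat e e′ (N⊆M e Ne) (N⊆M e′ Ne′)

    misses-⊆ : ∀ {M N u} → (∀ e → N e ≡ true → M e ≡ true) → Misses M u → Misses N u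
    misses-⊆ N⊆M miss e Ne = miss e (N⊆M e Ne)

    partner : ∀ {M} → IsMatching G M → ∀ {e e′ u} → M e ≡ true → M e′ ≡ true → e ∋ u → e′ ∋ u → e ≡ e′
    partner mat {e} {e′} {u} Me Me′ e∋u e′∋u with e Fin.≟ e′
    ... | yes eq = eq
    ... | no neq = ⊥-elim (mat e e′ Me Me′ neq u e∋u e′∋u)

    misses-set : ∀ {M e u} → Misses M u → ¬ e ∋ u → Misses (set M e) u
    misses-set {M} {e} miss ¬e∋u e′ t with set-⊆ M e t
    ... | inj₁ refl = ¬e∋u
    ... | inj₂ Me′  = miss e′ Me′

    misses-unset : ∀ {M e} → IsMatching G M → M e ≡ true → ∀ {u} → e ∋ u → Misses (unset M e) u
    misses-unset {M} {e} mat Me e∋u e′ t e′∋u =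
      let (Me′ , e′≢e) = unset-⊆ M e t in e′≢e (partner mat Me′ Me e′∋u e∋u)

    matching-set : ∀ {M e} → IsMatching G M → (∀ {u} → e ∋ u → Misses M u) → IsMatching G (set M e)
    matching-set {M} {e} mat miss x y Mx My x≢y u x∋u y∋u with set-⊆ M e Mx | set-⊆ M e My
    ... | inj₁ refl | inj₁ refl = x≢y refl
    ... | inj₁ refl | inj₂ My′  = miss x∋u y My′ y∋u
    ... | inj₂ Mx′  | inj₁ refl = miss y∋u x Mx′ x∋u
    ... | inj₂ Mx′  | inj₂ My′  = mat x y Mx′ My′ x≢y u x∋u y∋u

    matching-unset : ∀ {M} e → IsMatching G M → IsMatching G (unset M e)
    matching-unset {M} e = matching-⊆ λ e′ t → proj₁ (unset-⊆ M e t)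

    singleton-matching : ∀ e → IsMatching G (set ∅ e)
    singleton-matching e = matching-set {∅} {e} ∅-matching (λ _ _ ())

    other : ∀ {e u} → e ∋ u → ∃ λ v → e ∋ v × u ≢ v × (∀ {x} → e ∋ x → x ≡ u ⊎ x ≡ v)
    other {e} (inj₁ refl) = q e , inj₂ refl , loopless e , Sum.map sym sym
    other {e} (inj₂ refl) = p e , inj₁ refl , loopless e ∘ sym , Sum.swap ∘ Sum.map sym sym

    sameEnds : ∀ {e u v} → e ∋ u → e ∋ v → u ≢ v → SameEnds (ends e) (u , v)
    sameEnds (inj₁ a) (inj₁ b) u≢v = ⊥-elim (u≢v (trans (sym a) b))
    sameEnds (inj₁ a) (inj₂ b) u≢v = inj₁ (a , b)
    sameEnds (inj₂ a) (inj₁ b) u≢v = inj₂ (b , a)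
    sameEnds (inj₂ a) (inj₂ b) u≢v = ⊥-elim (u≢v (trans (sym a) b))

    same⇒∋ : ∀ {e u v} → SameEnds (ends e) (u , v) → e ∋ u × e ∋ v
    same⇒∋ (inj₁ (a , b)) = inj₁ a , inj₂ b
    same⇒∋ (inj₂ (a , b)) = inj₂ b , inj₁ a

    same⇒only : ∀ {e u v x} → SameEnds (ends e) (u , v) → e ∋ x → x ≡ u ⊎ x ≡ v
    same⇒only (inj₁ (refl , refl)) (inj₁ a) = inj₁ (sym a)
    same⇒only (inj₁ (refl , refl)) (inj₂ a) = inj₂ (sym a)
    same⇒only (inj₂ (refl , refl)) (inj₁ a) = inj₂ (sym a)
    same⇒only (inj₂ (refl , refl)) (inj₂ a) = inj₁ (sym a)

    same⇒≢ : ∀ {e u v} → SameEnds (ends e) (u , v) → u ≢ v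
    same⇒≢ {e} (inj₁ (refl , refl)) = loopless e
    same⇒≢ {e} (inj₂ (refl , refl)) = loopless e ∘ sym

    same-sym : ∀ {e u v} → SameEnds (ends e) (u , v) → SameEnds (ends e) (v , u)
    same-sym (inj₁ (a , b)) = inj₂ (a , b)
    same-sym (inj₂ (a , b)) = inj₁ (a , b)

    same-unique : ∀ {e e′ u v} → SameEnds (ends e) (u , v) → SameEnds (ends e′) (u , v) → e ≡ e′
    same-unique {e} {e′} (inj₁ (a , b)) (inj₁ (c , d)) = noMulti e e′ (inj₁ (trans a (sym c) , trans b (sym d)))
    same-unique {e} {e′} (inj₁ (a , b)) (inj₂ (c , d)) = noMulti e e′ (inj₂ (trans a (sym d) , trans b (sym c)))
    same-unique {e} {e′} (inj₂ (a , b)) (inj₁ (c , d)) = noMulti e e′ (inj₂ (trans a (sym d) , trans b (sym c)))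
    same-unique {e} {e′} (inj₂ (a , b)) (inj₂ (c , d)) = noMulti e e′ (inj₁ (trans a (sym c) , trans b (sym d)))

    unique-edge : ∀ {e e′ u v} → u ≢ v → e ∋ u → e ∋ v → e′ ∋ u → e′ ∋ v → e ≡ e′
    unique-edge u≢v a b c d = same-unique (sameEnds a b u≢v) (sameEnds c d u≢v)

    adj? : ∀ u v → Dec (Adj G u v)
    adj? u v = Finₚ.any? λ e → ((p e Fin.≟ u) ×-dec (q e Fin.≟ v)) ⊎-dec ((p e Fin.≟ v) ×-dec (q e Fin.≟ u))

    adj-sym : ∀ {u v} → Adj G u v → Adj G v u
    adj-sym (e , s) = e , same-sym s

    adj⇒≢ : ∀ {u v} → Adj G u v → u ≢ v
    adj⇒≢ (e , s) = same⇒≢ s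

    Inside : (V → Bool) → E → Bool
    Inside S e = S (p e) ∧ S (q e)

    inside⇒ : ∀ S {e u} → Inside S e ≡ true → e ∋ u → S u ≡ true
    inside⇒ S t (inj₁ refl) = proj₁ (∧-elim (S _) t)
    inside⇒ S t (inj₂ refl) = proj₂ (∧-elim (S _) t)

    ⇒inside : ∀ S {e} → (∀ {u} → e ∋ u → S u ≡ true) → Inside S e ≡ true
    ⇒inside S f = ∧-intro (f (inj₁ refl)) (f (inj₂ refl))

    degIn : (E → Bool) → V → ℕ
    degIn X v = count (λ e → X e ∧ incident? G e v)

    incidence : ∀ (S : V → Bool) e → sum (λ v → S v ⊙ b2n (incident? G e v)) ≡ b2n (S (p e)) + b2n (S (q e))
    incidence S e = trans (sum-cong-≗ λ v → split v)
      (trans (∑-distrib-+ (λ v → ⌊ p e Fin.≟ v ⌋ ⊙ b2n (S v)) (λ v → ⌊ q e Fin.≟ v ⌋ ⊙ b2n (S v)))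
        (cong₂ _+_ (sum-δ (b2n ∘ S) (p e)) (sum-δ (b2n ∘ S) (q e))))
      where
      split : ∀ v → S v ⊙ b2n (incident? G e v) ≡ (⌊ p e Fin.≟ v ⌋ ⊙ b2n (S v)) + (⌊ q e Fin.≟ v ⌋ ⊙ b2n (S v))
      split v with p e Fin.≟ v | q e Fin.≟ v
      ... | yes a | yes b = ⊥-elim (loopless e (trans a (sym b)))
      ... | yes a | no _  = sym (+-identityʳ _)
      ... | no _  | yes b = refl
      ... | no _  | no _ with S v
      ... | true  = refl
      ... | false = refl

    -- Double counting of the incidences between `S` and `X`.
    handshake : ∀ (S : V → Bool) (X : E → Bool) →
                sum (λ v → S v ⊙ degIn X v) ≡ sum (λ e → X e ⊙ (b2n (S (p e)) + b2n (S (q e))))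
    handshake S X = begin
      sum (λ v → S v ⊙ degIn X v)
        ≡⟨ sum-cong-≗ (λ v → trans (⊙-* (S v) _) (trans (*-distribˡ-sum (b2n (S v)) (λ e → b2n (X e ∧ incident? G e v)))
             (sum-cong-≗ λ e → shuffle (S v) (X e) (incident? G e v)))) ⟩
      sum (λ v → sum (λ e → b2n (X e) * (S v ⊙ b2n (incident? G e v))))
        ≡⟨ ∑-comm (λ v e → b2n (X e) * (S v ⊙ b2n (incident? G e v))) ⟩
      sum (λ e → sum (λ v → b2n (X e) * (S v ⊙ b2n (incident? G e v))))
        ≡⟨ sum-cong-≗ (λ e → trans (sym (*-distribˡ-sum (b2n (X e)) (λ v → S v ⊙ b2n (incident? G e v))))
             (trans (cong (b2n (X e) *_) (incidence S e)) (sym (⊙-* (X e) _)))) ⟩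
      sum (λ e → X e ⊙ (b2n (S (p e)) + b2n (S (q e)))) ∎
      where
      open ≡-Reasoning
      shuffle : ∀ s x i → b2n s * b2n (x ∧ i) ≡ b2n x * (s ⊙ b2n i)
      shuffle true  true  i = refl
      shuffle true  false i = refl
      shuffle false true  i = refl
      shuffle false false i = refl

    handshake-inside : ∀ (S : V → Bool) (X : E → Bool) → (∀ e → X e ≡ true → Inside S e ≡ true) →
                       sum (λ v → S v ⊙ degIn X v) ≡ 2 * count X
    handshake-inside S X X⊆ = trans (handshake S X) (trans (sum-cong-≗ λ e → term e)
      (sym (*-distribˡ-sum 2 (λ e → b2n (X e)))))
      where
      term : ∀ e → X e ⊙ (b2n (S (p e)) + b2n (S (q e))) ≡ 2 * b2n (X e)
      term e with X e in eq
      ... | false = refl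
      ... | true  = let (a , b) = ∧-elim (S (p e)) (X⊆ e eq) in cong₂ (λ x y → b2n x + b2n y) a b

    inside-degree : ∀ S d → (∀ v → S v ≡ true → degree G v ≤ d) → 2 * count (Inside S) ≤ count S * d
    inside-degree S d deg≤ = begin
      2 * count (Inside S)                      ≡⟨ handshake-inside S (Inside S) (λ _ t → t) ⟨
      sum (λ v → S v ⊙ degIn (Inside S) v)      ≤⟨ sum-mono bound ⟩
      sum (λ v → d * b2n (S v))                 ≡⟨ *-distribˡ-sum d (λ v → b2n (S v)) ⟨
      d * count S                               ≡⟨ *-comm d (count S) ⟩
      count S * d                               ∎
      where
      open ≤-Reasoning
      bound : ∀ v → S v ⊙ degIn (Inside S) v ≤ d * b2n (S v)
      bound v with S v in eq
      ... | false = z≤n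
      ... | true  = ≤-trans (count-mono {f = λ e → Inside S e ∧ incident? G e v} {g = λ e → incident? G e v} λ e t → proj₂ (∧-elim (Inside S e) t))
        (≤-trans (≤-reflexive (sym (degree≡count G v))) (≤-trans (deg≤ v eq) (≤-reflexive (sym (*-identityʳ d)))))

    degIn-matching≤1 : ∀ {X} → IsMatching G X → ∀ v → degIn X v ≤ 1
    degIn-matching≤1 {X} mat v = count≤1 (λ e → X e ∧ incident? G e v) λ e e′ t t′ →
      let (a , b) = ∧-elim (X e) t ; (c , d) = ∧-elim (X e′) t′ in partner mat a c (incident⇒∋ b) (incident⇒∋ d)

    _∩E_ : (E → Bool) → (V → Bool) → E → Bool
    (M ∩E S) e = M e ∧ Inside S e

    matching-bound : ∀ S {M} → IsMatching G M → 2 * count (M ∩E S) ≤ count S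
    matching-bound S {M} mat = ≤-trans (≤-reflexive (sym (handshake-inside S (M ∩E S) λ e t → proj₂ (∧-elim (M e) t))))
      (sum-mono λ v → ⊙-mono {S v} id (degIn-matching≤1 (matching-⊆ (λ e t → proj₁ (∧-elim (M e) t)) mat) v))

    -- In the sum of the inner degrees every vertex of `S` other than `x` contributes at least one,
    -- and every edge contributes two. This supplies the size condition of the odd sets in Edmonds'
    -- theorem.
    matching-near : ∀ S {M} x → (∀ v → S v ≡ true → v ≢ x → ∃ λ e → M e ≡ true × Inside S e ≡ true × e ∋ v) →
                    count S ≤ 1 + 2 * count (M ∩E S)
    matching-near S {M} x covered = begin
      sum (λ v → b2n (S v))                                          ≤⟨ sum-mono bound ⟩
      sum (λ v → b2n ⌊ x Fin.≟ v ⌋ + (S v ⊙ degIn (M ∩E S) v))        ≡⟨ ∑-distrib-+ (λ v → b2n ⌊ x Fin.≟ v ⌋) (λ v → S v ⊙ degIn (M ∩E S) v) ⟩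
      count (λ v → ⌊ x Fin.≟ v ⌋) + sum (λ v → S v ⊙ degIn (M ∩E S) v) ≡⟨ cong₂ _+_ (sum-δ (const 1) x) (handshake-inside S (M ∩E S) λ e t → proj₂ (∧-elim (M e) t)) ⟩
      1 + 2 * count (M ∩E S)                                         ∎
      where
      open ≤-Reasoning
      bound : ∀ v → b2n (S v) ≤ b2n ⌊ x Fin.≟ v ⌋ + (S v ⊙ degIn (M ∩E S) v)
      bound v with S v in eq | x Fin.≟ v
      ... | false | _     = z≤n
      ... | true  | yes _ = s≤s z≤n
      ... | true  | no x≢v with covered v eq (x≢v ∘ sym)
      ... | e , Me , ins , e∋v = count≥1 (λ e → (M ∩E S) e ∧ incident? G e v) e
        (∧-intro (∧-intro Me ins) (∋⇒incident e∋v))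

  -- Exchange along an alternating path

  module Swapping where
    open Matchings

    Unit : (V → Bool) → (E → ℕ) → Set
    Unit C g = ∀ e → Inside C e ≡ true → g e ≡ 1

    -- The path from `t` starts with an edge of `M`. Of even length, it ends in a vertex `x` missed
    -- by `M`, and `M′` has as many edges in `C` as `M`. Of odd length, it ends with an edge of `M`,
    -- and `M′` has one less. In the even case, the clauses that `x` is `t` or covered by `N`, and
    -- that `x` is `t` if `M` misses `t`, carry the recursion.
    EvenSwap OddSwap : (V → Bool) → (M N M′ : E → Bool) → V → Set
    EvenSwap C M N M′ t = ∃ λ x → Misses M x × C x ≡ true × (x ≡ t ⊎ ∃ λ e → N e ≡ true × e ∋ x) ×
      (Misses M t → x ≡ t) × (∀ g → Unit C g → wt g M′ ≡ wt g M) × (∀ z → z ≢ x → Misses M z → Misses M′ z)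
    OddSwap C M N M′ t = ¬ Misses M t × (∀ g → Unit C g → wt g M ≡ 1 + wt g M′) × (∀ z → Misses M z → Misses M′ z)

    -- The outcome of exchanging M and N along their alternating path starting at t.
    record Swapped (C : V → Bool) (M N : E → Bool) (t : V) : Set where
      field
        M′ N′    : E → Bool
        matchM   : IsMatching G M′
        matchN   : IsMatching G N′
        total    : ∀ g → wt g M′ + wt g N′ ≡ wt g M + wt g N
        subM     : ∀ e → M′ e ≡ true → M e ≡ true ⊎ N e ≡ true
        subN     : ∀ e → N′ e ≡ true → M e ≡ true ⊎ N e ≡ true
        missed   : Misses M′ t
        ending   : EvenSwap C M N M′ t ⊎ OddSwap C M N M′ t

    not-in : ∀ {M e u} → Misses M u → e ∋ u → M e ≡ false
    not-in miss e∋u = ¬-not λ Me → miss _ Me e∋u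

    -- Two edges of the path are treated at a time: an edge of `M` and the following edge of `N` are
    -- removed, the rest is exchanged from the new end, and the two are put back on opposite sides.
    -- Each round takes an edge from `M`, so `k` bounds the rounds; the closure of `C` keeps the
    -- path inside.
    swap : ∀ k C {M N t} → count M ≤ k → IsMatching G M → IsMatching G N → Misses N t →
           (∀ e → M e ≡ true ⊎ N e ≡ true → ∀ {u v} → e ∋ u → e ∋ v → C u ≡ true → C v ≡ true) → C t ≡ true →
           Swapped C M N t
    swap k C {M} {N} {t} cM≤k matM matN missN closed Ct with cover? M t
    ... | inj₂ missM = record { M′ = M ; N′ = N ; matchM = matM ; matchN = matN ; total = λ _ → refl
      ; subM = λ _ → inj₁ ; subN = λ _ → inj₂ ; missed = missM
      ; ending = inj₁ (t , missM , Ct , inj₁ refl , (λ _ → refl) , (λ _ _ → refl) , λ _ _ z → z) }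
    swap zero C {M} cM≤k _ _ _ _ _ | inj₁ (e , Me , _) = contradiction (count≥1 M e Me) (<⇒≱ (s≤s cM≤k))
    swap (suc k) C {M} {N} {t} cM≤k matM matN missN closed Ct | inj₁ (e₁ , Me₁ , e₁∋t)
      with other e₁∋t
    ... | t₁ , e₁∋t₁ , t≢t₁ , only₁ = result (cover? N t₁)
      where
      M₁ : E → Bool
      M₁ = unset M e₁
      M₁⊆M : ∀ e → M₁ e ≡ true → M e ≡ true
      M₁⊆M e te = proj₁ (unset-⊆ M e₁ te)
      wtM : ∀ g → wt g M ≡ g e₁ + wt g M₁
      wtM g = wt-unset g M e₁ Me₁
      M₁t : Misses M₁ t
      M₁t = misses-unset matM Me₁ e₁∋t
      M₁t₁ : Misses M₁ t₁
      M₁t₁ = misses-unset matM Me₁ e₁∋t₁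
      Ct₁ : C t₁ ≡ true
      Ct₁ = closed e₁ (inj₁ Me₁) e₁∋t e₁∋t₁ Ct
      unit₁ : ∀ g → Unit C g → g e₁ ≡ 1
      unit₁ g ug = ug e₁ (⇒inside C λ e∋u → closed e₁ (inj₁ Me₁) e₁∋t e∋u Ct)
      M≁t : ¬ Misses M t
      M≁t miss = miss e₁ Me₁ e₁∋t

      result : (∃ λ e → N e ≡ true × e ∋ t₁) ⊎ Misses N t₁ → Swapped C M N t
      result (inj₂ missN₁) = record { M′ = M₁ ; N′ = set N e₁ ; matchM = matching-unset e₁ matM
        ; matchN = matching-set matN λ e∋u → case only₁ e∋u of λ { (inj₁ refl) → missN ; (inj₂ refl) → missN₁ }
        ; total = λ g → begin
            wt g M₁ + wt g (set N e₁)   ≡⟨ cong (wt g M₁ +_) (wt-set g N e₁ (not-in missN e₁∋t)) ⟩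
            wt g M₁ + (g e₁ + wt g N)   ≡⟨ +-assoc (wt g M₁) (g e₁) (wt g N) ⟨
            wt g M₁ + g e₁ + wt g N     ≡⟨ cong (_+ wt g N) (trans (+-comm (wt g M₁) (g e₁)) (sym (wtM g))) ⟩
            wt g M + wt g N             ∎
        ; subM = λ e te → inj₁ (M₁⊆M e te)
        ; subN = λ e te → case set-⊆ N e₁ te of λ { (inj₁ refl) → inj₁ Me₁ ; (inj₂ Ne) → inj₂ Ne }
        ; missed = M₁t
        ; ending = inj₂ (M≁t , (λ g ug → trans (wtM g) (cong (_+ wt g M₁) (unit₁ g ug)))
                            , λ z → misses-⊆ M₁⊆M) }
        where open ≡-Reasoning
      result (inj₁ (e₂ , Ne₂ , e₂∋t₁)) with other e₂∋t₁
      ... | t₂ , e₂∋t₂ , t₁≢t₂ , only₂ = assemble (swap k C {M₁} {N₁} {t₂} cM₁≤k (matching-unset e₁ matM)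
            (matching-unset e₂ matN) N₁t₂
            (λ e → closed e ∘ Sum.map (M₁⊆M e) (N₁⊆N e)) (closed e₂ (inj₂ Ne₂) e₂∋t₁ e₂∋t₂ Ct₁))
        where
        N₁ : E → Bool
        N₁ = unset N e₂
        N₁⊆N : ∀ e → N₁ e ≡ true → N e ≡ true
        N₁⊆N e te = proj₁ (unset-⊆ N e₂ te)
        N₁t₁ : Misses N₁ t₁
        N₁t₁ = misses-unset matN Ne₂ e₂∋t₁
        N₁t₂ : Misses N₁ t₂
        N₁t₂ = misses-unset matN Ne₂ e₂∋t₂
        cM₁≤k : count M₁ ≤ k
        cM₁≤k = ≤-pred (subst (_≤ suc k) (wtM (const 1)) cM≤k)
        wtN : ∀ g → wt g N ≡ g e₂ + wt g N₁
        wtN g = wt-unset g N e₂ Ne₂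
        unit₂ : ∀ g → Unit C g → g e₂ ≡ 1
        unit₂ g ug = ug e₂ (⇒inside C λ e∋u → closed e₂ (inj₂ Ne₂) e₂∋t₁ e∋u Ct₁)
        t≢t₂ : t ≢ t₂
        t≢t₂ refl = missN e₂ Ne₂ e₂∋t₂
        e₂∌t : ¬ e₂ ∋ t
        e₂∌t = missN e₂ Ne₂

        assemble : Swapped C M₁ N₁ t₂ → Swapped C M N t
        assemble s = record { M′ = set S.M′ e₂ ; N′ = set S.N′ e₁
          ; matchM = matching-set S.matchM λ e∋u → case only₂ e∋u of λ { (inj₁ refl) → M′t₁ ; (inj₂ refl) → S.missed }
          ; matchN = matching-set S.matchN λ e∋u → case only₁ e∋u of λ { (inj₁ refl) → N′t ; (inj₂ refl) → N′t₁ }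
          ; total = λ g → begin
              wt g (set S.M′ e₂) + wt g (set S.N′ e₁)
                ≡⟨ cong₂ _+_ (wtM′ g) (wt-set g S.N′ e₁ (not-in N′t e₁∋t)) ⟩
              (g e₂ + wt g S.M′) + (g e₁ + wt g S.N′)
                ≡⟨ exchange (g e₂) (wt g S.M′) (g e₁) (wt g S.N′) ⟩
              (g e₁ + g e₂) + (wt g S.M′ + wt g S.N′)
                ≡⟨ cong (g e₁ + g e₂ +_) (S.total g) ⟩
              (g e₁ + g e₂) + (wt g M₁ + wt g N₁)
                ≡⟨ exchange′ (g e₁) (g e₂) (wt g M₁) (wt g N₁) ⟩
              (g e₁ + wt g M₁) + (g e₂ + wt g N₁)
                ≡⟨ cong₂ _+_ (wtM g) (wtN g) ⟨
              wt g M + wt g N ∎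
          ; subM = λ e te → case set-⊆ S.M′ e₂ te of λ { (inj₁ refl) → inj₂ Ne₂ ; (inj₂ t′) → Sum.map (M₁⊆M e) (N₁⊆N e) (S.subM e t′) }
          ; subN = λ e te → case set-⊆ S.N′ e₁ te of λ { (inj₁ refl) → inj₁ Me₁ ; (inj₂ t′) → Sum.map (M₁⊆M e) (N₁⊆N e) (S.subN e t′) }
          ; missed = misses-set M′t e₂∌t
          ; ending = Sum.map even odd S.ending }
          where
          module S = Swapped s
          open ≡-Reasoning
          exchange : ∀ a b c d → (a + b) + (c + d) ≡ (c + a) + (b + d)
          exchange = ℕRing.solve-∀
          exchange′ : ∀ a b c d → (a + b) + (c + d) ≡ (a + c) + (b + d)
          exchange′ = ℕRing.solve-∀
          neither : ∀ {u} → Misses M₁ u → Misses N₁ u → ∀ e → M₁ e ≡ true ⊎ N₁ e ≡ true → ¬ e ∋ u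
          neither a b e = [ a e , b e ]′
          M′t : Misses S.M′ t
          M′t e te = neither M₁t (misses-⊆ N₁⊆N missN) e (S.subM e te)
          N′t : Misses S.N′ t
          N′t e te = neither M₁t (misses-⊆ N₁⊆N missN) e (S.subN e te)
          M′t₁ : Misses S.M′ t₁
          M′t₁ e te = neither M₁t₁ N₁t₁ e (S.subM e te)
          N′t₁ : Misses S.N′ t₁
          N′t₁ e te = neither M₁t₁ N₁t₁ e (S.subN e te)
          wtM′ : ∀ g → wt g (set S.M′ e₂) ≡ g e₂ + wt g S.M′
          wtM′ g = wt-set g S.M′ e₂ (not-in M′t₁ e₂∋t₁)
          keep : ∀ {z} → Misses M z → z ≢ t₂ → Misses S.M′ z → Misses (set S.M′ e₂) z
          keep missz z≢t₂ miss′ = misses-set miss′ λ e₂∋z → case only₂ e₂∋z of λ where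
            (inj₁ refl) → missz e₁ Me₁ e₁∋t₁
            (inj₂ z≡t₂) → z≢t₂ z≡t₂
          even : EvenSwap C M₁ N₁ S.M′ t₂ → EvenSwap C M N (set S.M′ e₂) t
          even (x , missx , Cx , end , fixed , same , kept) =
            x , missMx end , Cx , inj₂ (end-covered end) , (λ miss → ⊥-elim (M≁t miss))
            , (λ g ug → trans (wtM′ g) (trans (cong₂ _+_ (trans (unit₂ g ug) (sym (unit₁ g ug))) (same g ug)) (sym (wtM g))))
            -- If `M` misses `t₂`, then the rest of the path is empty and `t₂` is its end `x`.
            , λ z z≢x missz → keep missz (λ { refl → z≢x (sym (fixed (misses-⊆ M₁⊆M missz))) })
                                     (kept z z≢x (misses-⊆ M₁⊆M missz))
            where
            end-covered : (x ≡ t₂ ⊎ ∃ λ e → N₁ e ≡ true × e ∋ x) → ∃ λ e → N e ≡ true × e ∋ x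
            end-covered (inj₁ refl)           = e₂ , Ne₂ , e₂∋t₂
            end-covered (inj₂ (e , Ne , e∋x)) = e , N₁⊆N e Ne , e∋x
            missMx : (x ≡ t₂ ⊎ ∃ λ e → N₁ e ≡ true × e ∋ x) → Misses M x
            missMx end e Me e∋x with e Fin.≟ e₁
            ... | no e≢e₁ = missx e (unset-⊇ M e₁ Me e≢e₁) e∋x
            ... | yes refl with only₁ e∋x | end
            ... | inj₁ refl | inj₁ x≡t₂          = t≢t₂ x≡t₂
            ... | inj₁ refl | inj₂ (e , Ne , i)  = missN e (N₁⊆N e Ne) i
            ... | inj₂ refl | inj₁ x≡t₂          = t₁≢t₂ x≡t₂
            ... | inj₂ refl | inj₂ (e , Ne , i)  = N₁t₁ e Ne i
          odd : OddSwap C M₁ N₁ S.M′ t₂ → OddSwap C M N (set S.M′ e₂) t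
          odd (M₁≁t₂ , drop , kept) = M≁t
            , (λ g ug → trans (wtM g) (cong₂ _+_ (unit₁ g ug) (trans (drop g ug) (trans (cong (_+ wt g S.M′) (sym (unit₂ g ug))) (sym (wtM′ g))))))
            , λ z missz → keep missz (λ { refl → M₁≁t₂ (misses-⊆ M₁⊆M missz) }) (kept z (misses-⊆ M₁⊆M missz))

  -- Edmonds' theorem with integral dual solutions

  module Edmonds where
    open Matchings
    open Swapping

    star⟦_⟧ : V → E → ℕ
    star⟦ v ⟧ e = b2n (incident? G e v)

    inside⟦_⟧ : (V → Bool) → E → ℕ
    inside⟦ S ⟧ e = b2n (Inside S e)

    data EdmondsFacet : (E → ℕ) → ℕ → Set where
      star : ∀ v → EdmondsFacet star⟦ v ⟧ 1
      odd  : ∀ S b → count S ≤ 1 + 2 * b → EdmondsFacet inside⟦ S ⟧ b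

    -- Edges of weight zero are excluded so that truncated subtraction of a 0/1 vector is exact on
    -- the edges of the matching, and so that negative parts of integer weights are exact there.
    Good : (E → ℕ) → (E → Bool) → Set
    Good w M = IsMatching G M × (∀ e → M e ≡ true → 1 ≤ w e)

    good? : ∀ w M → Dec (Good w M)
    good? w M = matching? M ×-dec Finₚ.all? λ e → true? (M e) →-dec (1 ≤? w e)

    good-resp : ∀ {w M N} → M ≗ N → Good w M → Good w N
    good-resp M≗N (mat , pos) = matching-⊆ (λ e Ne → trans (M≗N e) Ne) mat , λ e Ne → pos e (trans (M≗N e) Ne)

    good-∅ : ∀ {w} → Good w ∅
    good-∅ = ∅-matching , λ _ ()

    good-≤ : ∀ {w w′ M} → (∀ e → w′ e ≤ w e) → Good w′ M → Good w M
    good-≤ w′≤w (mat , pos) = mat , λ e Me → ≤-trans (pos e Me) (w′≤w e)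

    Dual : ((E → ℕ) → ℕ → Set) → (E → ℕ) → Set
    Dual F w = ∃ λ M → Good w M × ∃ λ b → Cov F w b × b ≤ wt w M

    abstract
      maximum : ∀ w → ∃ λ M → Good w M × (∀ N → Good w N → wt w N ≤ wt w M)
      maximum w = argmax (Good w) (good? w) (wt w) (sum w) good-resp (wt-cong w) (wt≤sum w) (∅ , good-∅)

    abstract
      maximumMissing : ∀ w v → ∃ λ M → (Good w M × Misses M v) × (∀ N → Good w N × Misses N v → wt w N ≤ wt w M)
      maximumMissing w v = argmax (λ M → Good w M × Misses M v) (λ M → good? w M ×-dec misses? M v) (wt w) (sum w)
        (λ M≗N (g , miss) → good-resp M≗N g , misses-resp M≗N miss) (wt-cong w) (wt≤sum w) (∅ , good-∅ , λ _ ())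

    -- Here every maximum matching covers `v`. The star is added to a dual solution of the weights
    -- lowered on it. Its cost is met by the lowered optimum `M′` itself if that covers `v`, and
    -- otherwise by the gap between `M` and the best matching missing `v`.
    step-star : ∀ w v → (∀ w′ → sum w′ < sum w → Dual EdmondsFacet w′) →
                wt w (proj₁ (maximumMissing w v)) < wt w (proj₁ (maximum w)) → Dual EdmondsFacet w
    step-star w v rec lt with maximumMissing w v | maximum w
    ... | Nᵥ , _ , Nᵥ-max | M , (matM , posM) , M-max = conclude (rec w′ smaller)
      where
      w′ : E → ℕ
      w′ e = w e ∸ star⟦ v ⟧ e
      w′≤w : ∀ e → w′ e ≤ w e
      w′≤w e = m∸n≤m (w e) (star⟦ v ⟧ e)
      w≤ : ∀ e → w e ≤ star⟦ v ⟧ e + w′ e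
      w≤ e = m≤n+m∸n (w e) (star⟦ v ⟧ e)
      lower : ∀ {e} → 1 ≤ w e → e ∋ v → 1 + w′ e ≤ w e
      lower {e} pos e∋v rewrite ∋⇒incident e∋v = ≤-reflexive (m+[n∸m]≡n pos)
      smaller : sum w′ < sum w
      smaller with cover? M v
      ... | inj₁ (e , Me , e∋v) = sum-strict w′≤w e (lower (posM e Me) e∋v)
      ... | inj₂ miss = contradiction (Nᵥ-max M ((matM , posM) , miss)) (<⇒≱ lt)
      conclude : Dual EdmondsFacet w′ → Dual EdmondsFacet w
      conclude (M′ , good′ , b , D , b≤) = finish (cover? M′ v)
        where
        D⁺ : Cov EdmondsFacet w (1 + b)
        D⁺ = cons (star v) D w≤ ≤-refl
        finish : (∃ λ e → M′ e ≡ true × e ∋ v) ⊎ Misses M′ v → Dual EdmondsFacet w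
        finish (inj₁ (e , M′e , e∋v)) = M′ , good-≤ w′≤w good′ , 1 + b , D⁺ , ≤-trans (s≤s b≤)
          (sum-strict (λ e → ⊙-mono {M′ e} id (w′≤w e)) e (subst (λ b → b ⊙ w′ e < b ⊙ w e) (sym M′e)
            (lower (≤-trans (proj₂ good′ e M′e) (w′≤w e)) e∋v)))
        finish (inj₂ miss) = M , (matM , posM) , 1 + b , D⁺ , ≤-trans (s≤s (≤-trans b≤ (wt-mono {M = M′} (λ _ t → t) w′≤w)))
          (≤-trans (s≤s (Nᵥ-max M′ (good-≤ w′≤w good′ , miss))) lt)

    -- No maximum matching is forced to cover a vertex. Gallai's argument: among the maximum matchings for
    -- the lowered weights with most edges in the component C, no one misses two vertices of C.
    module Component (w : E → ℕ) (free : ∀ v → wt w (proj₁ (maximum w)) ≤ wt w (proj₁ (maximumMissing w v)))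
                     (rec : ∀ w′ → sum w′ < sum w → Dual EdmondsFacet w′) (e₀ : E) (pos₀ : 1 ≤ w e₀) where

      avoiding : V → E → Bool
      avoiding v = proj₁ (maximumMissing w v)

      avoiding-good : ∀ v → Good w (avoiding v)
      avoiding-good v = proj₁ (proj₁ (proj₂ (maximumMissing w v)))

      avoiding-misses : ∀ v → Misses (avoiding v) v
      avoiding-misses v = proj₂ (proj₁ (proj₂ (maximumMissing w v)))

      avoiding-max : ∀ v N → Good w N → wt w N ≤ wt w (avoiding v)
      avoiding-max v N g = ≤-trans (proj₂ (proj₂ (maximum w)) N g) (free v)

      Joined : V → V → Set
      Joined u v = ∃ λ e → 1 ≤ w e × SameEnds (ends e) (u , v)

      components : _
      components = Labelling.labelling Fin._≟_ Joined (λ (e , pos , s) → e , pos , same-sym s) p q (λ e → ⌊ 1 ≤? w e ⌋)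
        (λ e act → e , true⇒dec (1 ≤? w e) act , inj₁ (refl , refl)) (List.allFin m)

      label : V → V
      label = proj₁ components

      r : V
      r = p e₀

      C : V → Bool
      C v = ⌊ label v Fin.≟ label r ⌋

      Cr : C r ≡ true
      Cr = dec⇒true (label r Fin.≟ label r) refl

      label-edge : ∀ e → 1 ≤ w e → label (p e) ≡ label (q e)
      label-edge e pos = proj₂ (proj₂ components) e (∈-allFin e) (dec⇒true (1 ≤? w e) pos)

      label-ends : ∀ e → 1 ≤ w e → ∀ {u v} → e ∋ u → e ∋ v → label u ≡ label v
      label-ends e pos (inj₁ refl) (inj₁ refl) = refl
      label-ends e pos (inj₁ refl) (inj₂ refl) = label-edge e pos
      label-ends e pos (inj₂ refl) (inj₁ refl) = sym (label-edge e pos)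
      label-ends e pos (inj₂ refl) (inj₂ refl) = refl

      C-closed : ∀ e → 1 ≤ w e → ∀ {u v} → e ∋ u → e ∋ v → C u ≡ true → C v ≡ true
      C-closed e pos {u} {v} e∋u e∋v Cu = dec⇒true (label v Fin.≟ label r)
        (trans (label-ends e pos e∋v e∋u) (true⇒dec (label u Fin.≟ label r) Cu))

      g : E → ℕ
      g = inside⟦ C ⟧

      g-unit : Unit C g
      g-unit e ins = cong b2n ins

      w′ : E → ℕ
      w′ e = w e ∸ g e

      w′≤w : ∀ e → w′ e ≤ w e
      w′≤w e = m∸n≤m (w e) (g e)

      wt-split : ∀ M → Good w M → wt w M ≡ wt w′ M + wt g M
      wt-split M (_ , pos) = trans (sum-cong-≗ pointwise) (wt-+ w′ g M)
        where
        pointwise : ∀ e → M e ⊙ w e ≡ M e ⊙ (w′ e + g e)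
        pointwise e with M e in eq
        ... | false = refl
        ... | true  = sym (m∸n+n≡m (≤-trans (b2n≤1 (Inside C e)) (pos e eq)))

      -- Lexicographic in base `m + 1`: the lowered weight comes first, the number of edges in `C`
      -- second.
      score : (E → Bool) → ℕ
      score M = wt w′ M * suc m + wt g M

      wt-g≤m : ∀ M → wt g M ≤ m
      wt-g≤m M = ≤-trans (wt-mono {N = M} (λ _ t → t) (λ e → b2n≤1 (Inside C e))) (count≤size M)

      Best : (E → Bool) → Set
      Best M = Good w M × (∀ N → Good w N → score N ≤ score M)

      best : ∃ Best
      best = argmax (Good w) (good? w) score (sum w′ * suc m + m) good-resp
        (λ M≗N → cong₂ (λ x y → x * suc m + y) (wt-cong w′ M≗N) (wt-cong g M≗N))
        (λ M → +-mono-≤ (*-monoˡ-≤ (suc m) (wt≤sum w′ M)) (wt-g≤m M)) (∅ , good-∅)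

      lead : ∀ {M N} → score N ≤ score M → wt w′ N ≤ wt w′ M
      lead {M} le = lex-≤ m le (wt-g≤m M)

      record Moved (M : E → Bool) (t : V) : Set where
        constructor moved
        field
          {M′}    : E → Bool
          {x}     : V
          best′   : Best M′
          misses  : Misses M′ t
          missed  : Misses M x
          inC     : C x ≡ true
          kept    : ∀ z → z ≢ x → Misses M z → Misses M′ z

      -- Exchange with a maximum matching for `w` that avoids `t`. The total weight is preserved and
      -- the partner cannot gain, so `M′` is at least as heavy as `M`. After an even path it has
      -- equally many edges in `C` and is again best. After an odd path it has one edge less there,
      -- hence a larger lowered weight, against the choice of `M`.
      move : ∀ {M t} → Best M → C t ≡ true → Moved M t
      move {M} {t} (goodM , maxM) Ct = conclude (swap (count M) C ≤-refl (proj₁ goodM) (proj₁ goodN) (avoiding-misses t)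
          (λ e → C-closed e ∘ [ proj₂ goodM e , proj₂ goodN e ]′) Ct)
        where
        N : E → Bool
        N = avoiding t
        goodN : Good w N
        goodN = avoiding-good t
        conclude : Swapped C M N t → Moved M t
        conclude s = [ even , ⊥-elim ∘ odd-impossible ]′ S.ending
          where
          module S = Swapped s
          goodM′ : Good w S.M′
          goodM′ = S.matchM , λ e → [ proj₂ goodM e , proj₂ goodN e ]′ ∘ S.subM e
          goodN′ : Good w S.N′
          goodN′ = S.matchN , λ e → [ proj₂ goodM e , proj₂ goodN e ]′ ∘ S.subN e
          heavier : wt w′ M + wt g M ≤ wt w′ S.M′ + wt g S.M′
          heavier = subst₂ _≤_ (wt-split M goodM) (wt-split S.M′ goodM′)
            (+-cancelʳ-≤ (wt w N) _ _ (≤-trans (≤-reflexive (sym (S.total w))) (+-monoʳ-≤ (wt w S.M′) (avoiding-max t S.N′ goodN′))))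
          even : EvenSwap C M N S.M′ t → Moved M t
          even (x , missx , Cx , _ , _ , same , kept) = moved
            (goodM′ , λ N₁ goodN₁ → ≤-trans (maxM N₁ goodN₁) (+-mono-≤
               (*-monoˡ-≤ (suc m) (+-cancelʳ-≤ (wt g M) _ _ (≤-trans heavier (≤-reflexive (cong (wt w′ S.M′ +_) (same g g-unit))))))
               (≤-reflexive (sym (same g g-unit)))))
            S.missed missx Cx kept
          odd-impossible : OddSwap C M N S.M′ t → ⊥
          odd-impossible (_ , drop , _) = <⇒≱ strict (lead {M} {S.M′} (maxM S.M′ goodM′))
            where
            strict : wt w′ M < wt w′ S.M′
            strict = +-cancelʳ-≤ (wt g S.M′) _ _ (≤-trans (≤-reflexive
              (trans (sym (+-suc (wt w′ M) (wt g S.M′))) (cong (wt w′ M +_) (sym (drop g g-unit))))) heavier)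

      NotBoth : V → V → Set
      NotBoth u v = ∀ M → Best M → Misses M u → Misses M v → ⊥

      -- Adding `e` would not reduce the lowered weight and would raise the number of edges in `C`.
      notBoth-edge : ∀ e → 1 ≤ w e → ∀ {u v} → C u ≡ true → SameEnds (ends e) (u , v) → NotBoth u v
      notBoth-edge e pos Cu s M (goodM , maxM) missu missv = <⇒≱ better (maxM (set M e) good⁺)
        where
        Me : M e ≡ false
        Me = not-in missu (proj₁ (same⇒∋ s))
        good⁺ : Good w (set M e)
        good⁺ = matching-set (proj₁ goodM) (λ e∋x → case same⇒only s e∋x of λ { (inj₁ refl) → missu ; (inj₂ refl) → missv })
          , λ e′ t → case set-⊆ M e t of λ { (inj₁ refl) → pos ; (inj₂ t′) → proj₂ goodM e′ t′ }
        better : score M < score (set M e)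
        better = +-mono-≤-< (*-monoˡ-≤ (suc m) (≤-trans (m≤n+m (wt w′ M) (w′ e)) (≤-reflexive (sym (wt-set w′ M e Me)))))
          (≤-reflexive (trans (cong (_+ wt g M) (sym (g-unit e (⇒inside C λ e∋x → C-closed e pos (proj₁ (same⇒∋ s)) e∋x Cu))))
            (sym (wt-set g M e Me))))

      -- Moving the gap to `t` covers at most one vertex `x` that was missed, so `u` or `v` stays
      -- missed together with `t`.
      notBoth-trans : ∀ {u t v} → C t ≡ true → u ≢ v → NotBoth u t → NotBoth t v → NotBoth u v
      notBoth-trans {u} {t} {v} Ct u≢v ut tv M bestM missu missv = clash (move bestM Ct)
        where
        clash : Moved M t → ⊥
        clash (moved {M′} {x} best′ misst _ _ kept) = case u Fin.≟ x of λ where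
          (no u≢x)   → ut M′ best′ (kept u u≢x missu) misst
          (yes refl) → tv M′ best′ misst (kept v (u≢v ∘ sym) missv)

      notBoth-walk : ∀ {u v} → C u ≡ true → Star Joined u v → u ≡ v ⊎ NotBoth u v
      notBoth-walk Cu Star.ε = inj₁ refl
      notBoth-walk {u} {v} Cu (_◅_ {j = t} (e , pos , s) walk) = extend (u Fin.≟ v) (notBoth-walk Ct walk)
        where
        Ct : C t ≡ true
        Ct = C-closed e pos (proj₁ (same⇒∋ s)) (proj₂ (same⇒∋ s)) Cu
        ut : NotBoth u t
        ut = notBoth-edge e pos Cu s
        extend : Dec (u ≡ v) → t ≡ v ⊎ NotBoth t v → u ≡ v ⊎ NotBoth u v
        extend (yes u≡v) _           = inj₁ u≡v
        extend (no _)    (inj₁ refl) = inj₂ ut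
        extend (no u≢v)  (inj₂ tv)   = inj₂ (notBoth-trans Ct u≢v ut tv)

      notBoth : ∀ {u v} → C u ≡ true → C v ≡ true → u ≢ v → NotBoth u v
      notBoth {u} {v} Cu Cv u≢v = [ ⊥-elim ∘ u≢v , id ]′ (notBoth-walk Cu (proj₁ (proj₂ components) u v
        (trans (true⇒dec (label u Fin.≟ label r) Cu) (sym (true⇒dec (label v Fin.≟ label r) Cv)))))

      smaller : sum w′ < sum w
      smaller = sum-strict w′≤w e₀ (subst (λ x → w e₀ ∸ b2n x < w e₀)
        (sym (⇒inside C λ e₀∋u → C-closed e₀ pos₀ (inj₁ refl) e₀∋u Cr)) (≤-reflexive (m+[n∸m]≡n pos₀)))

      dual : Dual EdmondsFacet w
      -- The move to `r` is made for the far end `x` of its path, a vertex of `C` that `M` itself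
      -- misses. All other vertices of `C` are then covered.
      dual = assemble (proj₁ best) (proj₂ best) (rec w′ smaller) (move (proj₂ best) Cr)
        where
        assemble : ∀ M → Best M → Dual EdmondsFacet w′ → Moved M r → Dual EdmondsFacet w
        assemble M bestM@(goodM , maxM) (M₀ , good₀ , b , D , b≤) (moved {x = x} _ _ missx Cx _) =
          M , goodM , count (M ∩E C) + b
            , cons (odd C (count (M ∩E C)) (matching-near C x covered)) D (λ e → m≤n+m∸n (w e) (g e)) ≤-refl
            , (begin
                count (M ∩E C) + b     ≤⟨ +-mono-≤ (≤-reflexive (sum-cong-≗ λ e → sym (⊙-∧ (M e)))) (≤-trans b≤ (lead {M} {M₀} (maxM M₀ (good-≤ w′≤w good₀)))) ⟩
                wt g M + wt w′ M       ≡⟨ +-comm (wt g M) (wt w′ M) ⟩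
                wt w′ M + wt g M       ≡⟨ wt-split M goodM ⟨
                wt w M                 ∎)
          where
          open ≤-Reasoning
          covered : ∀ v → C v ≡ true → v ≢ x → ∃ λ e → M e ≡ true × Inside C e ≡ true × e ∋ v
          covered v Cv v≢x = [ (λ (e , Me , e∋v) → e , Me , ⇒inside C (λ e∋u → C-closed e (proj₂ goodM e Me) e∋v e∋u Cv) , e∋v)
                             , (λ missv → ⊥-elim (notBoth Cv Cx v≢x M bestM missv missx)) ]′ (cover? M v)

    edmonds : ∀ k w → sum w < k → Dual EdmondsFacet w
    edmonds (suc k) w sw<k = by-edge (Finₚ.any? λ e → 1 ≤? w e)
      where
      rec : ∀ w′ → sum w′ < sum w → Dual EdmondsFacet w′
      rec w′ lt = edmonds k w′ (≤-trans lt (≤-pred sw<k))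
      by-vertex : ∀ e₀ → 1 ≤ w e₀ → Dec (∃ λ v → wt w (proj₁ (maximumMissing w v)) < wt w (proj₁ (maximum w))) → Dual EdmondsFacet w
      by-vertex e₀ pos₀ (yes (v , lt)) = step-star w v rec lt
      by-vertex e₀ pos₀ (no none)      = Component.dual w (λ v → ≮⇒≥ λ lt → none (v , lt)) rec e₀ pos₀
      by-edge : Dec (∃ λ e → 1 ≤ w e) → Dual EdmondsFacet w
      by-edge (no none)        = ∅ , good-∅ , 0 , nil (λ e → n<1⇒n≡0 (≰⇒> λ pos → none (e , pos))) , z≤n
      by-edge (yes (e₀ , pos)) = by-vertex e₀ pos (Finₚ.any? λ v → wt w (proj₁ (maximumMissing w v)) <? wt w (proj₁ (maximum w)))

    edmonds-dual : ∀ w → Dual EdmondsFacet w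
    edmonds-dual w = edmonds (suc (sum w)) w ≤-refl

  -- Lattice points of the shifted dilate and of its polar

  module Points (k : ℕ) (α : Fin (Graph.m G) → ℤ) where
    open Matchings

    Q : Vecℚ m → Set
    Q = DilateShift k α (MatchingPolytope G)

    pt : (E → Bool) → E → ℤ
    pt M e = ℤ.+ k ℤ.* b2z (M e) ℤ.- α e

    ι-indicator : ∀ M e → ι (b2z (M e)) ≡ indicator G M e
    ι-indicator M e with M e
    ... | true  = refl
    ... | false = refl

    embed-pt : ∀ M e → embedℤ (pt M) e ≡ ι (ℤ.+ k) ℚ.* indicator G M e ℚ.- ι (α e)
    embed-pt M e = trans (ι-− (ℤ.+ k ℤ.* b2z (M e)) (α e))
      (cong (ℚ._- ι (α e)) (trans (ι-* (ℤ.+ k) (b2z (M e))) (cong (ι (ℤ.+ k) ℚ.*_) (ι-indicator M e))))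

    pt-resp : ∀ {M N} → M ≗ N → pt M ≗ pt N
    pt-resp M≗N e = cong (λ b → ℤ.+ k ℤ.* b2z b ℤ.- α e) (M≗N e)

    conv⇒Q : ∀ {N} (F : Fin N → E → Bool) → (∀ i → IsMatching G (F i)) → ∀ {x} → ConvFam N (λ i → embedℤ (pt (F i))) x → Q x
    conv⇒Q {N} F mat (c , c≥0 , sc , xc) = (λ j → ∑ (λ i → c i ℚ.* indicator G (F i) j))
      , (N , (λ i → indicator G (F i)) , (λ i → F i , mat i , λ _ → refl) , c , c≥0 , sc , λ _ → refl)
      , λ j → trans (xc j) (trans (∑-cong λ i → cong (c i ℚ.*_) (embed-pt (F i) j))
          (sym (conv-affine {V = λ i → indicator G (F i)} {c = c} (ι (ℤ.+ k)) (ι ∘ α) sc (λ _ → refl) j)))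

    Q⇒conv : ∀ {x} → Q x → ∃₂ λ N (F : Fin N → E → Bool) → (∀ i → IsMatching G (F i)) × ConvFam N (λ i → embedℤ (pt (F i))) x
    Q⇒conv (p′ , (N , w , ws , c , c≥0 , sc , pc) , xp) = N , (λ i → proj₁ (ws i)) , (λ i → proj₁ (proj₂ (ws i)))
      , c , c≥0 , sc , λ j → trans (xp j) (trans (conv-affine {V = w} {c = c} (ι (ℤ.+ k)) (ι ∘ α) sc pc j)
          (∑-cong λ i → cong (c i ℚ.*_) (trans (cong (λ v → ι (ℤ.+ k) ℚ.* v ℚ.- ι (α j)) (proj₂ (proj₂ (ws i)) j))
                                               (sym (embed-pt (proj₁ (ws i)) j)))))

    pt∈Q : ∀ {M} → IsMatching G M → Q (embedℤ (pt M))
    pt∈Q {M} mat = conv⇒Q {1} (const M) (const mat) (cone-unit {V = λ _ → embedℤ (pt M)} zero)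

    polar : ∀ y → (∀ M → IsMatching G M → ℚ.- 1ℚ ℚ.≤ embedℤ (pt M) · y) → Polar Q y
    polar y bound x Qx = let (N , F , mat , conv) = Q⇒conv Qx in
      conv-dot-≥ {V = λ i → embedℤ (pt (F i))} {x} y (λ i → bound (F i) (mat i)) conv

    dot-pt : ∀ M z → sumℤ (λ e → pt M e ℤ.* z e) ≡ ℤ.+ k ℤ.* wtℤ z M ℤ.- sumℤ (λ e → α e ℤ.* z e)
    dot-pt M z = begin
      sumℤ (λ e → pt M e ℤ.* z e)
        ≡⟨ sumℤ-cong {f = λ e → pt M e ℤ.* z e} {g = λ e → ℤ.+ k ℤ.* (b2z (M e) ℤ.* z e) ℤ.+ ℤ.- (α e ℤ.* z e)} (λ e → expand (ℤ.+ k) (b2z (M e)) (α e) (z e)) ⟩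
      sumℤ (λ e → ℤ.+ k ℤ.* (b2z (M e) ℤ.* z e) ℤ.+ ℤ.- (α e ℤ.* z e))
        ≡⟨ sumℤ-+ (λ e → ℤ.+ k ℤ.* (b2z (M e) ℤ.* z e)) (λ e → ℤ.- (α e ℤ.* z e)) ⟩
      sumℤ (λ e → ℤ.+ k ℤ.* (b2z (M e) ℤ.* z e)) ℤ.+ sumℤ (λ e → ℤ.- (α e ℤ.* z e))
        ≡⟨ cong₂ ℤ._+_ (trans (sumℤ-*ˡ (ℤ.+ k) (λ e → b2z (M e) ℤ.* z e)) (cong (ℤ._*_ (ℤ.+ k)) (sumℤ-cong {f = λ e → b2z (M e) ℤ.* z e} {g = λ e → M e Wℤ.⊙ z e} λ e → sym (⊙ℤ-* (M e) (z e)))))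
                       (sumℤ-neg (λ e → α e ℤ.* z e)) ⟩
      ℤ.+ k ℤ.* wtℤ z M ℤ.- sumℤ (λ e → α e ℤ.* z e) ∎
      where
      open ≡-Reasoning
      expand : ∀ k b a z → (k ℤ.* b ℤ.- a) ℤ.* z ≡ k ℤ.* (b ℤ.* z) ℤ.+ ℤ.- (a ℤ.* z)
      expand = ℤRing.solve-∀

    -- Membership of an integer vector in the polar, tested only at the points of matchings and
    -- therefore decidable.
    Valid : (E → ℤ) → Set
    Valid z = ∀ M → IsMatching G M → ℤ.-1ℤ ℤ.≤ sumℤ (λ e → pt M e ℤ.* z e)

    valid⇒polar : ∀ {z} → Valid z → Polar Q (embedℤ z)
    valid⇒polar {z} valid = polar (embedℤ z) λ M mat →
      subst (ℚ.- 1ℚ ℚ.≤_) (sym (ι-dot (pt M) z)) (ι-≤ {ℤ.-1ℤ} {sumℤ (λ e → pt M e ℤ.* z e)} (valid M mat))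

    polar⇒valid : ∀ {z} → Polar Q (embedℤ z) → Valid z
    polar⇒valid {z} pol M mat = ι-≤⁻ {ℤ.-1ℤ} {sumℤ (λ e → pt M e ℤ.* z e)} (subst (ℚ.- 1ℚ ℚ.≤_) (ι-dot (pt M) z) (pol (embedℤ (pt M)) (pt∈Q mat)))

    valid-resp : ∀ {z z′} → z′ ≗ z → Valid z → Valid z′
    valid-resp z≗ valid M mat = subst (ℤ.-1ℤ ℤ.≤_) (sumℤ-cong λ e → cong (pt M e ℤ.*_) (sym (z≗ e))) (valid M mat)

    valid? : ∀ z → Dec (Valid z)
    valid? z with anySubset? (λ s → matching? (Vec.lookup s) ×-dec ¬? (ℤ.-1ℤ ℤ.≤? sumℤ (λ e → pt (Vec.lookup s) e ℤ.* z e)))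
    ... | yes (s , mat , bad) = no λ valid → bad (valid _ mat)
    ... | no none = yes λ M mat → decidable-stable (ℤ.-1ℤ ℤ.≤? sumℤ (λ e → pt M e ℤ.* z e)) λ bad → none
      (Vec.tabulate M , matching-⊆ (λ e t → trans (sym (Vecₚ.lookup∘tabulate M e)) t) mat
        , λ ok → bad (subst (ℤ.-1ℤ ℤ.≤_) (sumℤ-cong λ e → cong (ℤ._* z e) (pt-resp (Vecₚ.lookup∘tabulate M) e)) ok))

    latticeQ : LatticePolytope Q
    latticeQ = let (N , F , mat , complete) = family (true ∷ false ∷ []) (IsMatching G) matching?
                     (λ g≗f → matching-⊆ λ e t → trans (sym (g≗f e)) t) (∅ , ∅-matching)
      in N , (λ i → pt (F i)) , λ x → to F complete x , conv⇒Q F mat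
      where
      both : ∀ b → b ∈ true ∷ false ∷ []
      both true  = here refl
      both false = there (here refl)
      to : ∀ {N} (F : Fin N → E → Bool) → (∀ M → (∀ e → M e ∈ true ∷ false ∷ []) → IsMatching G M → ∃ λ i → F i ≗ M) →
           ∀ x → Q x → ConvFam N (λ i → embedℤ (pt (F i))) x
      to F complete x Qx = let (K , H , matH , conv) = Q⇒conv Qx in
        conv-trans {w = λ i → embedℤ (pt (H i))} (λ i → let (j , F≗H) = complete (H i) (λ e → both (H i e)) (matH i)
          in cone-resp (λ e → cong ι (pt-resp (sym ∘ F≗H) e)) refl (cone-unit {V = λ i → embedℤ (pt (F i))} j)) conv

  -- Degrees

  module Degrees where
    open Matchings

    degree-bound : ∀ {v} L → Unique L → All (_∋ v) L → length L ≤ degree G v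
    degree-bound {v} L u all = ≤-trans (length≤count (λ e → incident? G e v) L u (All.map ∋⇒incident all))
      (≤-reflexive (sym (degree≡count G v)))

    full : ∀ {v} L → Unique L → All (_∋ v) L → degree G v ≤ length L → ∀ {e} → e ∋ v → e ∈ L
    full {v} L u all deg≤ {e} e∋v with e ∈? L
    ... | yes e∈L = e∈L
    ... | no e∉L  = contradiction deg≤ (<⇒≱ (degree-bound (e ∷ L)
          (All.tabulate (λ { x∈L refl → e∉L x∈L }) ∷ u) (e∋v ∷ all)))

    edge-at : ∀ v → 1 ≤ degree G v → ∃ λ e → e ∋ v
    edge-at v pos with member (λ e → incident? G e v) (≤-trans pos (≤-reflexive (degree≡count G v)))
    ... | e , t = e , incident⇒∋ t

    two-edges-at : ∀ v → 2 ≤ degree G v → ∃₂ λ e e′ → e ∋ v × e′ ∋ v × e ≢ e′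
    two-edges-at v two with members₂ (λ e → incident? G e v) (≤-trans two (≤-reflexive (degree≡count G v)))
    ... | e , e′ , t , t′ , e≢ = e , e′ , incident⇒∋ t , incident⇒∋ t′ , e≢

    edge⇒deg : ∀ {e v} → e ∋ v → 1 ≤ degree G v
    edge⇒deg {e} e∋v = degree-bound (e ∷ []) ([] ∷ []) (e∋v ∷ [])

    adj-edge : ∀ {e u v} → e ∋ u → e ∋ v → u ≢ v → Adj G u v
    adj-edge {e} e∋u e∋v u≢v = e , sameEnds e∋u e∋v u≢v

    inside-ends : ∀ xs {e} → Inside set⟦ xs ⟧ e ≡ true → ∃₂ λ u v → u ∈ xs × v ∈ xs × SameEnds (ends e) (u , v)
    inside-ends xs {e} ins = p e , q e , set⇒∈ xs (inside⇒ set⟦ xs ⟧ {e} ins (inj₁ refl)) , set⇒∈ xs (inside⇒ set⟦ xs ⟧ {e} ins (inj₂ refl)) , inj₁ (refl , refl)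

  -- Reachability and separations

  module Components where
    open Matchings

    sadj-sym : ∀ {F : E → Bool} {u v} → SAdj G F u v → SAdj G F v u
    sadj-sym (e , Fe , s) = e , Fe , same-sym s

    -- Equal labels yield a walk, and no edge within `S` joins different labels; together this
    -- decides `Reach`.
    reachComponents : ∀ S F → ∃ λ (c : V → V) → (∀ u v → S u ≡ true → c u ≡ c v → Reach G S F u v) ×
                                       (∀ u v → S u ≡ true → S v ≡ true → SAdj G F u v → c u ≡ c v)
    reachComponents S F = c , (λ u v Su eq → walk Su (proj₁ (proj₂ L) u v eq)) , joined
      where
      R : V → V → Set
      R u v = S u ≡ true × S v ≡ true × SAdj G F u v
      act : E → Bool
      act e = F e ∧ Inside S e
      L : _
      L = Labelling.labelling Fin._≟_ R (λ (a , b , s) → b , a , sadj-sym s) p q act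
        (λ e t → let (a , b) = ∧-elim (F e) t in inside⇒ S {e} b (inj₁ refl) , inside⇒ S {e} b (inj₂ refl) , e , a , inj₁ (refl , refl))
        (List.allFin m)
      c : V → V
      c = proj₁ L
      walk : ∀ {u v} → S u ≡ true → Star R u v → Reach G S F u v
      walk Su Star.ε                   = here Su
      walk Su ((_ , Sw , adj) ◅ rest) = step Su Sw adj (walk Sw rest)
      label : ∀ e → F e ≡ true → Inside S e ≡ true → c (p e) ≡ c (q e)
      label e Fe ins = proj₂ (proj₂ L) e (∈-allFin e) (∧-intro Fe ins)
      joined : ∀ u v → S u ≡ true → S v ≡ true → SAdj G F u v → c u ≡ c v
      joined u v Su Sv (e , Fe , inj₁ (refl , refl)) = label e Fe (∧-intro Su Sv)
      joined u v Su Sv (e , Fe , inj₂ (refl , refl)) = sym (label e Fe (∧-intro Sv Su))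

    reach-closed : ∀ {S F} {X : V → Set} → (∀ {u v} → X u → S v ≡ true → SAdj G F u v → X v) →
                   ∀ {u v} → Reach G S F u v → X u → X v
    reach-closed closed (here _)                   Xu = Xu
    reach-closed closed (step Su Sw adj rest) Xu = reach-closed closed rest (closed Xu Sw adj)

    reach? : ∀ S F {u} v → S u ≡ true → Reach G S F u v ⊎ ¬ Reach G S F u v
    reach? S F {u} v Su with reachComponents S F
    ... | c , sound , joined with c u Fin.≟ c v
    ... | yes eq = inj₁ (sound u v Su eq)
    ... | no neq = inj₂ λ r → neq (sym (proj₂ (reach-closed {X = λ w → S w ≡ true × c w ≡ c u}
                     (λ {w} {z} (Sw , cw) Sz adj → Sz , trans (sym (joined w z Sw Sz adj)) cw) r (Su , refl))))

    induced : (V → Bool) → Subgraph G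
    induced S = record { S = S ; F = Inside S ; closed = λ e t → ∧-elim (S (p e)) t }

    deleteS-elim : ∀ {S x u} → deleteS G S x u ≡ true → S u ≡ true × u ≢ x
    deleteS-elim {S} {x} {u} t with ∧-elim (S u) t
    ... | Su , t′ with u Fin.≟ x
    ... | no u≢x = Su , u≢x

    deleteS-intro : ∀ {S x u} → S u ≡ true → u ≢ x → deleteS G S x u ≡ true
    deleteS-intro {S} {x} {u} Su u≢x = ∧-intro Su (cong not (dec⇒false (u Fin.≟ x) u≢x))

    deleteF-intro : ∀ {F x e} → F e ≡ true → ¬ e ∋ x → deleteF G F x e ≡ true
    deleteF-intro {F} {x} {e} Fe e∌x = ∧-intro Fe (cong not (¬-not λ t → e∌x (incident⇒∋ t)))

    deleteF-elim : ∀ {F x e} → deleteF G F x e ≡ true → F e ≡ true × ¬ e ∋ x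
    deleteF-elim {F} {x} {e} t with ∧-elim (F e) t
    ... | Fe , t′ = Fe , λ e∋x → case trans (sym t′) (cong not (∋⇒incident e∋x)) of λ ()

    -- One notion for a disconnected `S`, whose parts share nothing, and for a cut vertex `x`. The
    -- strict inequalities drive the induction over pieces.
    Separation : (S S₁ S₂ : V → Bool) → V → Set
    Separation S S₁ S₂ x = (∀ e → Inside S e ≡ true → Inside S₁ e ≡ true ⊎ Inside S₂ e ≡ true) ×
      (∀ v → S₁ v ≡ true → S₂ v ≡ true → v ≡ x) × count S₁ < count S × count S₂ < count S

    separation? : ∀ S S₁ S₂ x → Dec (Separation S S₁ S₂ x)
    separation? S S₁ S₂ x =
      (Finₚ.all? λ e → true? (Inside S e) →-dec (true? (Inside S₁ e) ⊎-dec true? (Inside S₂ e))) ×-dec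
      (Finₚ.all? λ v → true? (S₁ v) →-dec (true? (S₂ v) →-dec (v Fin.≟ x))) ×-dec
      (count S₁ <? count S) ×-dec (count S₂ <? count S)

    separable? : ∀ S → (∃ λ S₁ → ∃₂ λ S₂ x → Separation S S₁ S₂ x) ⊎ (∀ S₁ S₂ x → ¬ Separation S S₁ S₂ x)
    separable? S with Finₚ.any? (λ x → anySubset? λ s₁ → anySubset? λ s₂ → separation? S (Vec.lookup s₁) (Vec.lookup s₂) x)
    ... | yes (x , s₁ , s₂ , sep) = inj₁ (Vec.lookup s₁ , Vec.lookup s₂ , x , sep)
    ... | no none = inj₂ λ S₁ S₂ x (edges , common , lt₁ , lt₂) → none (x , Vec.tabulate S₁ , Vec.tabulate S₂
        , (λ e ins → Sum.map (to S₁ e) (to S₂ e) (edges e ins))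
        , (λ v a b → common v (trans (sym (look S₁ v)) a) (trans (sym (look S₂ v)) b))
        , subst (_< count S) (sym (wt-cong (const 1) (look S₁))) lt₁
        , subst (_< count S) (sym (wt-cong (const 1) (look S₂))) lt₂)
      where
      look : ∀ (T : V → Bool) → Vec.lookup (Vec.tabulate T) ≗ T
      look = Vecₚ.lookup∘tabulate
      to : ∀ T e → Inside T e ≡ true → Inside (Vec.lookup (Vec.tabulate T)) e ≡ true
      to T e t = trans (cong₂ _∧_ (look T (p e)) (look T (q e))) t

    module Unseparated (S : V → Bool) (nosep : ∀ S₁ S₂ x → ¬ Separation S S₁ S₂ x) where

      -- Otherwise the vertices labelled like `u` and the remaining ones, both enlarged by `X`, form
      -- a separation. The empty `X` gives connectedness, and `X = {x}` shows that `x` is not a cut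
      -- vertex.
      one-side : ∀ {A : Set} (_≟A_ : DecidableEquality A) (c : V → A) (X : V → Bool) x → (∀ v → X v ≡ true → v ≡ x) →
                 (∀ e → Inside S e ≡ true → X (p e) ≡ false → X (q e) ≡ false → c (p e) ≡ c (q e)) →
                 ∀ {u v} → S u ≡ true → S v ≡ true → X u ≡ false → X v ≡ false → c u ≡ c v
      one-side _≟A_ c X x X⇒x same {u} {v} Su Sv Xu Xv with c u ≟A c v
      ... | yes eq = eq
      ... | no neq = ⊥-elim (nosep S₁ S₂ x (edges , common , count-strict (sub S₁?) v v∉ Sv , count-strict (sub S₂?) u u∉ Su))
        where
        S₁? S₂? : V → Bool
        S₁? z = X z ∨ ⌊ c z ≟A c u ⌋
        S₂? z = X z ∨ not ⌊ c z ≟A c u ⌋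
        S₁ S₂ : V → Bool
        S₁ z = S z ∧ S₁? z
        S₂ z = S z ∧ S₂? z
        sub : ∀ T z → S z ∧ T z ≡ true → S z ≡ true
        sub T z t = proj₁ (∧-elim (S z) t)
        v∉ : S₁ v ≡ false
        v∉ rewrite Sv | Xv = dec⇒false (c v ≟A c u) (neq ∘ sym)
        u∉ : S₂ u ≡ false
        u∉ rewrite Su | Xu = cong not (dec⇒true (c u ≟A c u) refl)
        common : ∀ z → S₁ z ≡ true → S₂ z ≡ true → z ≡ x
        common z a b with X z in Xz | ⌊ c z ≟A c u ⌋
        ... | true  | _     = X⇒x z Xz
        ... | false | true  = case proj₂ (∧-elim (S z) b) of λ ()
        ... | false | false = case proj₂ (∧-elim (S z) a) of λ ()
        either : ∀ z → (S₁? z ≡ true × S₂? z ≡ true) ⊎ (X z ≡ false)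
        either z with X z
        ... | true  = inj₁ (refl , refl)
        ... | false = inj₂ refl
        some : ∀ z → S₁? z ≡ true ⊎ S₂? z ≡ true
        some z with X z | ⌊ c z ≟A c u ⌋
        ... | true  | _     = inj₁ refl
        ... | false | true  = inj₁ refl
        ... | false | false = inj₂ refl
        edges : ∀ e → Inside S e ≡ true → Inside S₁ e ≡ true ⊎ Inside S₂ e ≡ true
        edges e ins with ∧-elim (S (p e)) ins | either (p e) | either (q e)
        ... | Sp , Sq | inj₁ (a , b) | _ =
              Sum.map (λ t → ∧-intro (∧-intro Sp a) (∧-intro Sq t)) (λ t → ∧-intro (∧-intro Sp b) (∧-intro Sq t)) (some (q e))
        ... | Sp , Sq | inj₂ _ | inj₁ (a , b) =
              Sum.map (λ t → ∧-intro (∧-intro Sp t) (∧-intro Sq a)) (λ t → ∧-intro (∧-intro Sp t) (∧-intro Sq b)) (some (p e))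
        ... | Sp , Sq | inj₂ Xp | inj₂ Xq = Sum.map
              (λ t → ∧-intro (∧-intro Sp t) (∧-intro Sq (trans (sym (cong₂ _∨_ sameX sameC)) t)))
              (λ t → ∧-intro (∧-intro Sp t) (∧-intro Sq (trans (sym (cong₂ (λ a b → a ∨ not b) sameX sameC)) t))) (some (p e))
          where
          sameX : X (p e) ≡ X (q e)
          sameX = trans Xp (sym Xq)
          sameC : ⌊ c (p e) ≟A c u ⌋ ≡ ⌊ c (q e) ≟A c u ⌋
          sameC = cong (λ z → ⌊ z ≟A c u ⌋) (same e ins Xp Xq)

      biconnected : (∃ λ v → S v ≡ true) → Biconn G (induced S)
      biconnected nonempty = (nonempty , connected) , uncut
        where
        connected : ∀ u v → S u ≡ true → S v ≡ true → Reach G S (Inside S) u v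
        connected u v Su Sv = let (c , sound , joined) = reachComponents S (Inside S) in
          sound u v Su (one-side Fin._≟_ c (const false) u (λ _ ())
            (λ e ins _ _ → let (a , b) = ∧-elim (S (p e)) ins in joined (p e) (q e) a b (e , ins , inj₁ (refl , refl))) Su Sv refl refl)
        uncut : ∀ x → ¬ CutVertex G (induced S) x
        uncut x (Sx , u , v , Su , Sv , unreachable) = unreachable (sound u v Su (one-side Fin._≟_ c (λ z → ⌊ z Fin.≟ x ⌋) x
            (λ z → true⇒dec (z Fin.≟ x)) same (proj₁ (∧-elim (S u) Su)) (proj₁ (∧-elim (S v) Sv)) (out u Su) (out v Sv)))
          where
          c = proj₁ (reachComponents (deleteS G S x) (deleteF G (Inside S) x))
          sound = proj₁ (proj₂ (reachComponents (deleteS G S x) (deleteF G (Inside S) x)))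
          joined = proj₂ (proj₂ (reachComponents (deleteS G S x) (deleteF G (Inside S) x)))
          out : ∀ z → deleteS G S x z ≡ true → ⌊ z Fin.≟ x ⌋ ≡ false
          out z t = dec⇒false (z Fin.≟ x) (proj₂ (deleteS-elim {S} {x} t))
          same : ∀ e → Inside S e ≡ true → ⌊ p e Fin.≟ x ⌋ ≡ false → ⌊ q e Fin.≟ x ⌋ ≡ false → c (p e) ≡ c (q e)
          same e ins np nq = joined (p e) (q e) (deleteS-intro {S} (proj₁ (∧-elim (S (p e)) ins)) p≢x) (deleteS-intro {S} (proj₂ (∧-elim (S (p e)) ins)) q≢x)
            (e , deleteF-intro {Inside S} {x} {e} ins (λ { (inj₁ eq) → p≢x eq ; (inj₂ eq) → q≢x eq }) , inj₁ (refl , refl))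
            where
            no-eq : ∀ z → ⌊ z Fin.≟ x ⌋ ≡ false → z ≢ x
            no-eq z f eq = case trans (sym f) (dec⇒true (z Fin.≟ x) eq) of λ ()
            p≢x : p e ≢ x
            p≢x = no-eq (p e) np
            q≢x : q e ≢ x
            q≢x = no-eq (q e) nq

  -- Reflexivity from dual solutions

  module Reflexivity (k : ℕ) where
    open Matchings
    open Edmonds
    open Points k (const ℤ.1ℤ)

    -- A valid inequality χ x ≤ b with 0/1 coefficients at lattice distance one from the all-ones point of k P.
    record LatticeFacet (χ : E → ℕ) (b : ℕ) : Set where
      constructor latticeFacet
      field
        support  : E → Bool
        binary   : ∀ e → χ e ≡ b2n (support e)
        valid    : ∀ M → IsMatching G M → wt χ M ≤ b
        distance : sum χ + 1 ≡ k * b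

    dot-pt₁ : ∀ M z → sumℤ (λ e → pt M e ℤ.* z e) ≡ ℤ.+ k ℤ.* wtℤ z M ℤ.- sumℤ z
    dot-pt₁ M z = trans (dot-pt M z) (cong (λ s → ℤ.+ k ℤ.* wtℤ z M ℤ.- s) (sumℤ-cong λ e → ℤₚ.*-identityˡ (z e)))

    minus : (E → ℕ) → E → ℤ
    minus χ e = ℤ.- (ℤ.+ χ e)

    dot-minus : ∀ M χ → sumℤ (λ e → pt M e ℤ.* minus χ e) ≡ ℤ.+ sum χ ℤ.- ℤ.+ (k * wt χ M)
    dot-minus M χ = begin
      sumℤ (λ e → pt M e ℤ.* minus χ e)                       ≡⟨ dot-pt₁ M (minus χ) ⟩
      ℤ.+ k ℤ.* wtℤ (minus χ) M ℤ.- sumℤ (minus χ)            ≡⟨ cong₂ (λ a b → ℤ.+ k ℤ.* a ℤ.- b)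
        (trans (wtℤ-neg (λ e → ℤ.+ χ e) M) (cong ℤ.-_ (wtℤ-pos χ M))) (trans (sumℤ-neg (λ e → ℤ.+ χ e)) (cong ℤ.-_ (sumℤ-pos χ))) ⟩
      ℤ.+ k ℤ.* (ℤ.- (ℤ.+ wt χ M)) ℤ.- (ℤ.- (ℤ.+ sum χ))      ≡⟨ rearrange (ℤ.+ k) (ℤ.+ wt χ M) (ℤ.+ sum χ) ⟩
      ℤ.+ sum χ ℤ.- ℤ.+ k ℤ.* ℤ.+ wt χ M                      ≡⟨ cong (λ x → ℤ.+ sum χ ℤ.- x) (ℤₚ.pos-* k (wt χ M)) ⟨
      ℤ.+ sum χ ℤ.- ℤ.+ (k * wt χ M)                          ∎
      where
      open ≡-Reasoning
      rearrange : ∀ k a b → k ℤ.* (ℤ.- a) ℤ.- (ℤ.- b) ≡ b ℤ.- k ℤ.* a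
      rearrange = ℤRing.solve-∀

    -- The value at `pt M` is `sum χ - k * wt χ M`, hence at least `sum χ - k * b`, which is -1 by
    -- the distance.
    facet-valid : ∀ {χ b} → LatticeFacet χ b → Valid (minus χ)
    facet-valid {χ} {b} (latticeFacet _ _ bound eq) M mat = begin
      ℤ.-1ℤ                                     ≡⟨ cancel (ℤ.+ sum χ) ⟨
      ℤ.+ sum χ ℤ.- (ℤ.+ sum χ ℤ.+ ℤ.1ℤ)        ≡⟨ cong (λ x → ℤ.+ sum χ ℤ.- ℤ.+ x) eq ⟩
      ℤ.+ sum χ ℤ.- ℤ.+ (k * b)                 ≤⟨ ℤₚ.+-monoʳ-≤ (ℤ.+ sum χ) (ℤₚ.neg-mono-≤ (ℤ.+≤+ (*-monoʳ-≤ k (bound M mat)))) ⟩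
      ℤ.+ sum χ ℤ.- ℤ.+ (k * wt χ M)            ≡⟨ dot-minus M χ ⟨
      sumℤ (λ e → pt M e ℤ.* minus χ e)         ∎
      where
      open ℤₚ.≤-Reasoning
      cancel : ∀ s → s ℤ.- (s ℤ.+ ℤ.1ℤ) ≡ ℤ.-1ℤ
      cancel = ℤRing.solve-∀

    zero-valid : Valid (const ℤ.0ℤ)
    zero-valid M mat = ℤₚ.≤-trans ℤ.-≤+ (ℤₚ.≤-reflexive (sym (trans (sumℤ-cong λ e → ℤₚ.*-zeroʳ (pt M e)) (ℤΣ.sum-replicate-zero m))))

    unit : E → E → ℤ
    unit e e′ = b2z ⌊ e Fin.≟ e′ ⌋

    -- This is the polar point of the facet `x_e ≥ 0`, at distance one from the origin after the
    -- shift by the all-ones vector.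
    unit-valid : ∀ e → Valid (unit e)
    unit-valid e M mat = begin
      ℤ.-1ℤ                                          ≡⟨ cong ℤ.-_ (cong ℤ.+_ (sum-δ (const 1) e)) ⟨
      ℤ.- ℤ.+ sum (λ e′ → b2n ⌊ e Fin.≟ e′ ⌋)        ≡⟨ cong ℤ.-_ (sumℤ-pos (λ e′ → b2n ⌊ e Fin.≟ e′ ⌋)) ⟨
      ℤ.- sumℤ (unit e)                              ≡⟨ ℤₚ.+-identityˡ (ℤ.- sumℤ (unit e)) ⟨
      ℤ.0ℤ ℤ.- sumℤ (unit e)                         ≤⟨ ℤₚ.+-monoˡ-≤ (ℤ.- sumℤ (unit e)) nonneg ⟩
      ℤ.+ k ℤ.* wtℤ (unit e) M ℤ.- sumℤ (unit e)     ≡⟨ dot-pt₁ M (unit e) ⟨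
      sumℤ (λ e′ → pt M e′ ℤ.* unit e e′)            ∎
      where
      open ℤₚ.≤-Reasoning
      nonneg : ℤ.0ℤ ℤ.≤ ℤ.+ k ℤ.* wtℤ (unit e) M
      nonneg rewrite wtℤ-pos (λ e′ → b2n ⌊ e Fin.≟ e′ ⌋) M | sym (ℤₚ.pos-* k (wt (λ e′ → b2n ⌊ e Fin.≟ e′ ⌋) M)) = ℤ.+≤+ z≤n

    -- The origin, the unit vectors and the negated 0/1 facets all have their entries here, so the
    -- valid vectors over this list generate the polar.
    signs : List ℤ
    signs = ℤ.0ℤ ∷ ℤ.1ℤ ∷ ℤ.-1ℤ ∷ []

    ∑-unit : ∀ (f : E → ℚ) j → ∑ (λ e → f e ℚ.* embedℤ (unit e) j) ≡ f j
    ∑-unit f j = trans (∑-cong λ e → trans (ℚₚ.*-comm (f e) _) (cong (ℚ._* f e) (turn e))) (∑-δ j f)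
      where
      turn : ∀ e → embedℤ (unit e) j ≡ (if ⌊ j Fin.≟ e ⌋ then 1ℚ else 0ℚ)
      turn e = trans (cong (ι ∘ b2z) (bool-ext (λ t → dec⇒true (j Fin.≟ e) (sym (true⇒dec (e Fin.≟ j) t)))
          (λ t → dec⇒true (e Fin.≟ j) (sym (true⇒dec (j Fin.≟ e) t))))) (as-if ⌊ j Fin.≟ e ⌋)
        where
        as-if : ∀ b → ι (b2z b) ≡ (if b then 1ℚ else 0ℚ)
        as-if true  = refl
        as-if false = refl

    negPart : ℤ → ℕ
    negPart (ℤ.+ _)    = 0
    negPart (ℤ.-[1+ a ]) = suc a

    negPart-≤ : ∀ a → ℤ.- ℤ.+ negPart a ℤ.≤ a
    negPart-≤ (ℤ.+ _)      = ℤ.+≤+ z≤n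
    negPart-≤ (ℤ.-[1+ a ]) = ℤₚ.≤-refl

    negPart-pos : ∀ a → 1 ≤ negPart a → a ≡ ℤ.- ℤ.+ negPart a
    negPart-pos (ℤ.-[1+ a ]) _ = refl

    module _ {N} (F : Fin N → E → ℤ) (complete : ∀ z → (∀ e → z e ∈ signs) → Valid z → ∃ λ i → F i ≗ z) where

      V̂ : Fin N → Vecℚ m
      V̂ i = embedℤ (F i)

      in-family : ∀ z → (∀ e → z e ∈ signs) → Valid z → Cone V̂ (embedℤ z) 1ℚ
      in-family z z∈ valid = let (i , F≗z) = complete z z∈ valid in cone-resp (λ e → cong ι (sym (F≗z e))) refl (cone-unit i)

      cone-unit-edge : ∀ e → Cone V̂ (embedℤ (unit e)) 1ℚ
      cone-unit-edge e = in-family (unit e) (λ e′ → sgn ⌊ e Fin.≟ e′ ⌋) (unit-valid e)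
        where
        sgn : ∀ b → b2z b ∈ signs
        sgn true  = there (here refl)
        sgn false = here refl

      cone-zero : Cone V̂ (const 0ℚ) 1ℚ
      cone-zero = in-family (const ℤ.0ℤ) (λ _ → here refl) zero-valid

      cone-facet : ∀ {χ b} → LatticeFacet χ b → Cone V̂ (embedℤ (minus χ)) 1ℚ
      cone-facet {χ} facet@(latticeFacet X χ≡ _ _) = in-family (minus χ) (λ e → subst (λ x → ℤ.- (ℤ.+ x) ∈ signs) (sym (χ≡ e)) (sgn (X e))) (facet-valid facet)
        where
        sgn : ∀ b → ℤ.- (ℤ.+ b2n b) ∈ signs
        sgn true  = there (there (here refl))
        sgn false = here refl

      -- Here `z` is the sum of the facets in the solution and `s` their number. Adding up
      -- `sum χ + 1 = k * b` over them gives the budget.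
      cover-cone : ∀ {w b} → Cov LatticeFacet w b →
                   ∃₂ λ (z : E → ℕ) s → (∀ e → w e ≤ z e) × sum z + s ≤ k * b × Cone V̂ (embedℤ (minus z)) (ι (ℤ.+ s))
      cover-cone (nil w≡0) = const 0 , 0 , (λ e → ≤-reflexive (w≡0 e))
        , ≤-trans (≤-reflexive (trans (+-identityʳ _) (sum-replicate-zero m))) z≤n , cone-0
      cover-cone (cons {χ} {b₁} {w} {w′} {b₂} {c} facet D w≤ b≤) with cover-cone D
      ... | z , s , w′≤z , le , cone = (λ e → χ e + z e) , suc s , (λ e → ≤-trans (w≤ e) (+-monoʳ-≤ (χ e) (w′≤z e)))
        , (begin
            sum (λ e → χ e + z e) + suc s     ≡⟨ cong (_+ suc s) (∑-distrib-+ χ z) ⟩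
            sum χ + sum z + suc s             ≡⟨ shuffle (sum χ) (sum z) s ⟩
            (sum χ + 1) + (sum z + s)         ≤⟨ +-mono-≤ (≤-reflexive (LatticeFacet.distance facet)) le ⟩
            k * b₁ + k * b₂                   ≡⟨ *-distribˡ-+ k b₁ b₂ ⟨
            k * (b₁ + b₂)                     ≤⟨ *-monoʳ-≤ k b≤ ⟩
            k * c                             ∎)
        , cone-resp (λ e → trans (cong ι (split (χ e) (z e))) (ι-+ (minus χ e) (minus z e))) (sym (ι-+ ℤ.1ℤ (ℤ.+ s)))
            (cone-+ (cone-facet facet) cone)
        where
        open ≤-Reasoning
        shuffle : ∀ a b s → a + b + suc s ≡ (a + 1) + (b + s)
        shuffle = ℕRing.solve-∀
        split : ∀ a b → ℤ.- ℤ.+ (a + b) ≡ ℤ.- ℤ.+ a ℤ.+ ℤ.- ℤ.+ b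
        split a b = ℤₚ.neg-distrib-+ (ℤ.+ a) (ℤ.+ b)

      -- Write `Y = -z + t` with `t ≥ 0`. The part `-z` has mass `s`, the part `t` is a sum of unit
      -- vectors of mass `sum t`, and the origin takes up what is left of `D`. That something
      -- nonnegative is left follows from the polar inequality at `pt M` and the budget of `z`.
      rescale : ∀ y → Polar Q y → ∀ D (Y : E → ℤ) → 1 ≤ D → (∀ e → ι (ℤ.+ D) ℚ.* y e ≡ ι (Y e)) →
                ∀ M → Good (negPart ∘ Y) M → ∀ z s → (∀ e → negPart (Y e) ≤ z e) → sum z + s ≤ k * wt (negPart ∘ Y) M →
                Cone V̂ (embedℤ (minus z)) (ι (ℤ.+ s)) → ConvFam N V̂ y
      rescale y pol D Y D≥1 Dy M (mat , supp) z s w≤z z≤ cone = cone-resp y≡ one (cone-scale 1/D 1/D≥0 coneY)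
        where
        w : E → ℕ
        w = negPart ∘ Y
        instance
          D≢0 : ℚ.NonZero (ι (ℤ.+ D))
          D≢0 = ℚ.≢-nonZero λ eq → <⇒≢ D≥1 (sym (ℤₚ.+-injective (ι-injective {ℤ.+ D} {ℤ.+ 0} eq)))
        D≥0 : 0ℚ ℚ.≤ ι (ℤ.+ D)
        D≥0 = ι-≤ {ℤ.0ℤ} {ℤ.+ D} (ℤ.+≤+ z≤n)
        1/D : ℚ
        1/D = ℚ.1/ ι (ℤ.+ D)
        1/D≥0 : 0ℚ ℚ.≤ 1/D
        1/D≥0 = ℚₚ.<⇒≤ (ℚₚ.positive⁻¹ 1/D {{ℚₚ.1/pos⇒pos (ι (ℤ.+ D)) {{ℚₚ.nonNeg∧nonZero⇒pos (ι (ℤ.+ D)) {{ℚ.nonNegative D≥0}}}}}})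
        y≡ : ∀ e → y e ≡ 1/D ℚ.* ι (Y e)
        y≡ e = sym (trans (cong (1/D ℚ.*_) (sym (Dy e))) (trans (sym (ℚₚ.*-assoc 1/D (ι (ℤ.+ D)) (y e)))
          (trans (cong (ℚ._* y e) (ℚₚ.*-inverseˡ (ι (ℤ.+ D)))) (ℚₚ.*-identityˡ (y e)))))
        one : 1/D ℚ.* ι (ℤ.+ D) ≡ 1ℚ
        one = ℚₚ.*-inverseˡ (ι (ℤ.+ D))
        t : E → ℤ
        t e = ℤ.+ z e ℤ.+ Y e
        t≥0 : ∀ e → ℤ.0ℤ ℤ.≤ t e
        t≥0 e = ℤₚ.≤-trans (ℤₚ.≤-reflexive (sym (ℤₚ.+-inverseʳ (ℤ.+ z e)))) (ℤₚ.+-monoʳ-≤ (ℤ.+ z e)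
          (ℤₚ.≤-trans (ℤₚ.neg-mono-≤ (ℤ.+≤+ (w≤z e))) (negPart-≤ (Y e))))
        wtY : wtℤ Y M ≡ ℤ.- ℤ.+ wt w M
        wtY = trans (sumℤ-cong pointwise) (trans (wtℤ-neg (λ e → ℤ.+ w e) M) (cong ℤ.-_ (wtℤ-pos w M)))
          where
          pointwise : ∀ e → M e Wℤ.⊙ Y e ≡ M e Wℤ.⊙ (ℤ.- ℤ.+ w e)
          pointwise e with M e in eq
          -- Goodness of `M` makes `Y` negative on its edges.
          ... | true  = negPart-pos (Y e) (supp e eq)
          ... | false = refl
        polarY : ℤ.- ℤ.+ D ℤ.≤ ℤ.+ k ℤ.* wtℤ Y M ℤ.- sumℤ Y
        polarY = ι-≤⁻ (subst₂ ℚ._≤_ left right (*-monoˡ D≥0 (pol (embedℤ (pt M)) (pt∈Q mat))))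
          where
          left : ι (ℤ.+ D) ℚ.* (ℚ.- 1ℚ) ≡ ι (ℤ.- ℤ.+ D)
          left = trans (sym (ι-* (ℤ.+ D) ℤ.-1ℤ)) (cong ι (trans (ℤₚ.*-comm (ℤ.+ D) ℤ.-1ℤ) (ℤₚ.-1*i≡-i (ℤ.+ D))))
          right : ι (ℤ.+ D) ℚ.* (embedℤ (pt M) · y) ≡ ι (ℤ.+ k ℤ.* wtℤ Y M ℤ.- sumℤ Y)
          right = begin
            ι (ℤ.+ D) ℚ.* (embedℤ (pt M) · y)                       ≡⟨ ∑-*ˡ (ι (ℤ.+ D)) (λ e → embedℤ (pt M) e ℚ.* y e) ⟨
            ∑ (λ e → ι (ℤ.+ D) ℚ.* (embedℤ (pt M) e ℚ.* y e))       ≡⟨ ∑-cong (λ e → trans (ℚ-swap (ι (ℤ.+ D)) (embedℤ (pt M) e) (y e)) (cong (embedℤ (pt M) e ℚ.*_) (Dy e))) ⟩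
            embedℤ (pt M) · embedℤ Y                                ≡⟨ ι-dot (pt M) Y ⟩
            ι (sumℤ (λ e → pt M e ℤ.* Y e))                         ≡⟨ cong ι (dot-pt₁ M Y) ⟩
            ι (ℤ.+ k ℤ.* wtℤ Y M ℤ.- sumℤ Y)                        ∎
            where
            open ≡-Reasoning
        T : ℤ
        T = ℤ.+ s ℤ.+ sumℤ t
        slack : ℤ.0ℤ ℤ.≤ ℤ.+ D ℤ.- T
        slack = begin
          ℤ.0ℤ                                                       ≡⟨ ℤₚ.+-inverseʳ (ℤ.+ D) ⟨
          ℤ.+ D ℤ.- ℤ.+ D                                            ≤⟨ ℤₚ.+-monoʳ-≤ (ℤ.+ D) polarY ⟩
          ℤ.+ D ℤ.+ (ℤ.+ k ℤ.* wtℤ Y M ℤ.- sumℤ Y)                   ≡⟨ cong (λ x → ℤ.+ D ℤ.+ (ℤ.+ k ℤ.* x ℤ.- sumℤ Y)) wtY ⟩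
          ℤ.+ D ℤ.+ (ℤ.+ k ℤ.* (ℤ.- ℤ.+ wt w M) ℤ.- sumℤ Y)          ≡⟨ pairing-regroup (ℤ.+ D) (ℤ.+ k) (ℤ.+ wt w M) (sumℤ Y) ⟩
          (ℤ.+ D ℤ.- sumℤ Y) ℤ.- ℤ.+ k ℤ.* ℤ.+ wt w M                ≡⟨ cong (ℤ._-_ (ℤ.+ D ℤ.- sumℤ Y)) (ℤₚ.pos-* k (wt w M)) ⟨
          (ℤ.+ D ℤ.- sumℤ Y) ℤ.- ℤ.+ (k * wt w M)                    ≤⟨ ℤₚ.+-monoʳ-≤ (ℤ.+ D ℤ.- sumℤ Y) (ℤₚ.neg-mono-≤ (ℤ.+≤+ z≤)) ⟩
          (ℤ.+ D ℤ.- sumℤ Y) ℤ.- (ℤ.+ sum z ℤ.+ ℤ.+ s)               ≡⟨ slack-regroup (ℤ.+ D) (sumℤ Y) (ℤ.+ sum z) (ℤ.+ s) ⟩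
          ℤ.+ D ℤ.- (ℤ.+ s ℤ.+ (ℤ.+ sum z ℤ.+ sumℤ Y))               ≡⟨ cong (λ x → ℤ.+ D ℤ.- (ℤ.+ s ℤ.+ x))
                                                                          (trans (sumℤ-+ (λ e → ℤ.+ z e) Y) (cong (ℤ._+ sumℤ Y) (sumℤ-pos z))) ⟨
          ℤ.+ D ℤ.- T                                                ∎
          where
          open ℤₚ.≤-Reasoning
        cone-t : Cone V̂ (embedℤ t) (ι (sumℤ t))
        cone-t = cone-resp (λ j → sym (∑-unit (ι ∘ t) j)) (trans (∑-cong λ e → ℚₚ.*-identityʳ (ι (t e))) (sym (ι-sum t)))
          (cone-∑ λ e → cone-scale (ι (t e)) (ι-≤ {ℤ.0ℤ} {t e} (t≥0 e)) (cone-unit-edge e))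
        cone-slack : Cone V̂ (const 0ℚ) (ι (ℤ.+ D ℤ.- T))
        cone-slack = cone-resp (λ _ → sym (ℚₚ.*-zeroʳ (ι (ℤ.+ D ℤ.- T)))) (ℚₚ.*-identityʳ _)
          (cone-scale (ι (ℤ.+ D ℤ.- T)) (ι-≤ {ℤ.0ℤ} {ℤ.+ D ℤ.- T} slack) cone-zero)
        coneY : Cone V̂ (embedℤ Y) (ι (ℤ.+ D))
        coneY = cone-resp
          (λ e → trans (cong ι (neg-cancel (Y e) (ℤ.+ z e))) (trans (ι-+ (minus z e) (t e)) (sym (ℚₚ.+-identityʳ _))))
          (sym (trans (cong ι (add-difference (ℤ.+ D) (ℤ.+ s) (sumℤ t))) (trans (ι-+ T (ℤ.+ D ℤ.- T)) (cong (ℚ._+ ι (ℤ.+ D ℤ.- T)) (ι-+ (ℤ.+ s) (sumℤ t))))))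
          (cone-+ (cone-+ cone cone-t) cone-slack)

      polar⇒conv : (∀ w → Dual LatticeFacet w) → ∀ y → Polar Q y → ConvFam N V̂ y
      polar⇒conv duals y pol =
        let (D , Y , D≥1 , Dy)             = clear-denominators y
            (M , good , b , cov , b≤)      = duals (negPart ∘ Y)
            (z , s , w≤z , z≤ , cone)      = cover-cone cov
        in rescale y pol D Y D≥1 Dy M good z s w≤z (≤-trans z≤ (*-monoʳ-≤ k b≤)) cone

    gorenstein : 1 ≤ k → (∀ w → Dual LatticeFacet w) → Gorenstein (MatchingPolytope G)
    gorenstein k≥1 duals = k , const ℤ.1ℤ , k≥1 , latticeQ , latticePolar
      where
      latticePolar : LatticePolytope (Polar Q)
      latticePolar with family signs Valid valid? valid-resp (const ℤ.0ℤ , zero-valid)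
      ... | N , F , valid , complete = N , F , λ y → polar⇒conv F complete duals y
        , λ conv x Qx → subst (ℚ.- 1ℚ ℚ.≤_) (·-comm y x)
            (conv-dot-≥ x (λ i → subst (ℚ.- 1ℚ ℚ.≤_) (·-comm x (embedℤ (F i))) (valid⇒polar (valid i) x Qx)) conv)

    open Degrees

    star-facet : ∀ v → degree G v + 1 ≡ k → LatticeFacet star⟦ v ⟧ 1
    star-facet v deg = latticeFacet (λ e → incident? G e v) (λ _ → refl)
      (λ M mat → ≤-trans (≤-reflexive (sum-cong-≗ λ e → ⊙-∧ (M e))) (degIn-matching≤1 mat v))
      (trans (cong (_+ 1) (sym (degree≡count G v))) (trans deg (sym (*-identityʳ k))))

    odd-facet : ∀ S b → count S ≤ 1 + 2 * b → count (Inside S) + 1 ≡ k * b → LatticeFacet inside⟦ S ⟧ b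
    odd-facet S b size edges = latticeFacet (Inside S) (λ _ → refl) bound edges
      where
      bound : ∀ M → IsMatching G M → wt inside⟦ S ⟧ M ≤ b
      bound M mat = ≤-trans (≤-reflexive (sum-cong-≗ λ e → ⊙-∧ (M e))) (≮⇒≥ λ b<c → <⇒≱ (s≤s size) (begin
        2 + 2 * b               ≡⟨ *-distribˡ-+ 2 1 b ⟨
        2 * suc b               ≤⟨ *-monoʳ-≤ 2 b<c ⟩
        2 * count (M ∩E S)      ≤⟨ matching-bound S mat ⟩
        count S                 ∎))
        where open ≤-Reasoning

    -- Covers of stars and odd sets by facets at distance one

    module _ (essential : ∀ v → Essential G v → degree G v + 1 ≡ k)
             (triangle : ∀ {a b c} → Adj G a b → Adj G b c → Adj G a c → Cov LatticeFacet inside⟦ set⟦ a ∷ b ∷ c ∷ [] ⟧ ⟧ 1) where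

      star-essential : ∀ v → Essential G v → Cov LatticeFacet star⟦ v ⟧ 1
      star-essential v ess = cov-facet (star-facet v (essential v ess))

      star-≤ : ∀ v {χ : E → ℕ} → (∀ e → e ∋ v → 1 ≤ χ e) → ∀ e → star⟦ v ⟧ e ≤ χ e
      star-≤ v h e with incident? G e v in eq
      ... | true  = h e (incident⇒∋ eq)
      ... | false = z≤n

      -- If the neighbour `u` has further edges, the only edge of `v` is absorbed by the star of
      -- `u`. This `u` is essential: with degree two, one of its neighbours is the leaf `v`, which
      -- is not adjacent to the other.
      star-leaf : ∀ v → degree G v ≡ 1 → Cov LatticeFacet star⟦ v ⟧ 1
      star-leaf v deg with edge-at v (≤-reflexive (sym deg))
      ... | e , e∋v with other e∋v
      ... | u , e∋u , v≢u , only = case degree G u ≟ 1 of λ where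
            (yes deg-u) → star-essential v (inj₁ (deg , λ w (f , s) → subst (λ w → degree G w ≡ 1) (sym (w≡u s)) deg-u))
            (no deg-u)  → cov-mono (star-≤ v λ f f∋v → ≤-reflexive (sym (cong b2n (∋⇒incident (subst (_∋ u) (sym (only-e f∋v)) e∋u))))) ≤-refl
                            (star-essential u (essential-u deg-u))
        where
        only-e : ∀ {f} → f ∋ v → f ≡ e
        only-e f∋v with full (e ∷ []) ([] ∷ []) (e∋v ∷ []) (≤-reflexive deg) f∋v
        ... | here eq = eq
        w≡u : ∀ {f w} → SameEnds (ends f) (v , w) → w ≡ u
        w≡u {f} {w} s with only (subst (_∋ w) (only-e (proj₁ (same⇒∋ s))) (proj₂ (same⇒∋ s)))
        ... | inj₁ w≡v = ⊥-elim (same⇒≢ s (sym w≡v))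
        ... | inj₂ w≡u = w≡u
        essential-u : degree G u ≢ 1 → Essential G u
        essential-u deg-u with 3 ≤? degree G u
        ... | yes three = inj₂ (inj₂ three)
        ... | no ¬three = inj₂ (inj₁ (two , open-nbhd))
          where
          two : degree G u ≡ 2
          two = ≤-antisym (≤-pred (≰⇒> ¬three)) (≤∧≢⇒< (edge⇒deg e∋u) (deg-u ∘ sym))
          meets-v : ∀ {x y} → Adj G v x → Adj G u y → x ≡ y → ⊥
          meets-v (f , s) uy refl = adj⇒≢ uy (sym (w≡u s))
          open-nbhd : ∀ x y → Adj G u x → Adj G u y → x ≢ y → ¬ Adj G x y
          open-nbhd x y (f , s) (g , t) x≢y xy with f Fin.≟ e | g Fin.≟ e
          ... | yes refl | _ = case only (proj₂ (same⇒∋ s)) of λ where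
                (inj₁ refl) → meets-v xy (g , t) refl
                (inj₂ refl) → same⇒≢ s refl
          ... | no _ | yes refl = case only (proj₂ (same⇒∋ t)) of λ where
                (inj₁ refl) → meets-v (adj-sym xy) (f , s) refl
                (inj₂ refl) → same⇒≢ t refl
          ... | no f≢e | no g≢e = ¬three (degree-bound (e ∷ f ∷ g ∷ [])
                (((f≢e ∘ sym) ∷ (g≢e ∘ sym) ∷ []) ∷ ((λ { refl → [ (λ y≡u → same⇒≢ t (sym y≡u)) , x≢y ∘ sym ]′ (same⇒only s (proj₂ (same⇒∋ t))) }) ∷ []) ∷ [] ∷ [])
                (e∋u ∷ proj₁ (same⇒∋ s) ∷ proj₁ (same⇒∋ t) ∷ []))

      -- Either the neighbours are nonadjacent and `v` is essential, or both edges lie in a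
      -- triangle, which is covered at the same cost.
      star-two : ∀ v → degree G v ≡ 2 → Cov LatticeFacet star⟦ v ⟧ 1
      star-two v deg with two-edges-at v (≤-reflexive (sym deg))
      ... | e , f , e∋v , f∋v , e≢f with other e∋v | other f∋v
      ... | a , e∋a , v≢a , only-a | b , f∋b , v≢b , only-b = case adj? a b of λ where
            (yes ab) → cov-mono (star-≤ v λ g g∋v → ≤-reflexive (sym (cong b2n (inside g g∋v)))) ≤-refl
                         (triangle (adj-edge e∋v e∋a v≢a) ab (adj-edge f∋v f∋b v≢b))
            (no ¬ab) → star-essential v (inj₂ (inj₁ (deg , open-nbhd ¬ab)))
        where
        two : ∀ {g} → g ∋ v → g ≡ e ⊎ g ≡ f
        two g∋v with full (e ∷ f ∷ []) ((e≢f ∷ []) ∷ [] ∷ []) (e∋v ∷ f∋v ∷ []) (≤-reflexive deg) g∋v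
        ... | here eq         = inj₁ eq
        ... | there (here eq) = inj₂ eq
        nbr : ∀ {x} → Adj G v x → x ≡ a ⊎ x ≡ b
        nbr {x} (g , s) with two (proj₁ (same⇒∋ s))
        ... | inj₁ refl = inj₁ ([ ⊥-elim ∘ same⇒≢ s ∘ sym , id ]′ (only-a (proj₂ (same⇒∋ s))))
        ... | inj₂ refl = inj₂ ([ ⊥-elim ∘ same⇒≢ s ∘ sym , id ]′ (only-b (proj₂ (same⇒∋ s))))
        inside : ∀ g → g ∋ v → Inside set⟦ v ∷ a ∷ b ∷ [] ⟧ g ≡ true
        inside g g∋v with two g∋v
        ... | inj₁ refl = ⇒inside set⟦ v ∷ a ∷ b ∷ [] ⟧ λ g∋x → ∈⇒set (v ∷ a ∷ b ∷ []) (case only-a g∋x of λ { (inj₁ refl) → here refl ; (inj₂ refl) → there (here refl) })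
        ... | inj₂ refl = ⇒inside set⟦ v ∷ a ∷ b ∷ [] ⟧ λ g∋x → ∈⇒set (v ∷ a ∷ b ∷ []) (case only-b g∋x of λ { (inj₁ refl) → here refl ; (inj₂ refl) → there (there (here refl)) })
        open-nbhd : ¬ Adj G a b → ∀ x y → Adj G v x → Adj G v y → x ≢ y → ¬ Adj G x y
        open-nbhd ¬ab x y vx vy x≢y xy with nbr vx | nbr vy
        ... | inj₁ refl | inj₁ refl = x≢y refl
        ... | inj₁ refl | inj₂ refl = ¬ab xy
        ... | inj₂ refl | inj₁ refl = ¬ab (adj-sym xy)
        ... | inj₂ refl | inj₂ refl = x≢y refl

      star-cov : ∀ v → Cov LatticeFacet star⟦ v ⟧ 1
      star-cov v with degree G v in deg
      ... | 0 = nil λ e → n≤0⇒n≡0 (≤-trans (term≤sum star⟦ v ⟧ e) (≤-reflexive (trans (sym (degree≡count G v)) deg)))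
      ... | 1 = star-leaf v deg
      ... | 2 = star-two v deg
      ... | suc (suc (suc d)) = star-essential v (inj₂ (inj₂ (subst (3 ≤_) (sym deg) (s≤s (s≤s (s≤s z≤n))))))

      inside-≤ : ∀ S {χ : E → ℕ} → (∀ e → Inside S e ≡ true → 1 ≤ χ e) → ∀ e → inside⟦ S ⟧ e ≤ χ e
      inside-≤ S h e with Inside S e in eq
      ... | true  = h e eq
      ... | false = z≤n

      star≥1 : ∀ {e v} → e ∋ v → 1 ≤ star⟦ v ⟧ e
      star≥1 e∋v = ≤-reflexive (sym (cong b2n (∋⇒incident e∋v)))

      no-edge : ∀ S {b} → (∀ e → Inside S e ≡ true → ⊥) → Cov LatticeFacet inside⟦ S ⟧ b
      no-edge S h = nil λ e → n≤0⇒n≡0 (inside-≤ S (λ e ins → ⊥-elim (h e ins)) e)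

      all-at : ∀ S v → (∀ e → Inside S e ≡ true → e ∋ v) → Cov LatticeFacet inside⟦ S ⟧ 1
      all-at S v h = cov-mono (inside-≤ S λ e ins → star≥1 (h e ins)) ≤-refl (star-cov v)

      third : ∀ {a b c e} → ¬ Adj G a b → (∀ {u} → e ∋ u → u ∈ a ∷ b ∷ c ∷ []) → e ∋ c
      third {a} {b} {c} {e} ¬ab within = at (within (inj₁ refl)) (within (inj₂ refl))
        where
        at : p e ∈ a ∷ b ∷ c ∷ [] → q e ∈ a ∷ b ∷ c ∷ [] → e ∋ c
        at (there (there (here eq))) _                          = inj₁ eq
        at _                         (there (there (here eq)))  = inj₂ eq
        at (here x)                  (here y)                   = ⊥-elim (loopless e (trans x (sym y)))
        at (here x)                  (there (here y))           = ⊥-elim (¬ab (e , inj₁ (x , y)))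
        at (there (here x))          (here y)                   = ⊥-elim (¬ab (e , inj₂ (x , y)))
        at (there (here x))          (there (here y))           = ⊥-elim (loopless e (trans x (sym y)))

      inside-∈ : ∀ xs {e u} → Inside set⟦ xs ⟧ e ≡ true → e ∋ u → u ∈ xs
      inside-∈ xs {e} ins e∋u = set⇒∈ xs (inside⇒ set⟦ xs ⟧ {e} ins e∋u)

      -- Unless the three vertices form a triangle, two of them are nonadjacent and every inner edge
      -- passes through the remaining one.
      cov-triple : ∀ a b c → Dec (Adj G a b) → Dec (Adj G b c) → Dec (Adj G a c) → Cov LatticeFacet inside⟦ set⟦ a ∷ b ∷ c ∷ [] ⟧ ⟧ 1
      cov-triple a b c (yes ab) (yes bc) (yes ac) = triangle ab bc ac
      cov-triple a b c (no ¬ab) _ _ = all-at set⟦ a ∷ b ∷ c ∷ [] ⟧ c λ e ins → third {a} {b} {c} ¬ab (λ e∋u → inside-∈ (a ∷ b ∷ c ∷ []) {e} ins e∋u)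
      cov-triple a b c _ (no ¬bc) _ = all-at set⟦ a ∷ b ∷ c ∷ [] ⟧ a λ e ins → third {b} {c} {a} ¬bc (λ e∋u → ∈-swap (a ∷ []) (b ∷ c ∷ []) (inside-∈ (a ∷ b ∷ c ∷ []) {e} ins e∋u))
      cov-triple a b c _ _ (no ¬ac) = all-at set⟦ a ∷ b ∷ c ∷ [] ⟧ b λ e ins → third {c} {a} {b} (λ ca → ¬ac (adj-sym ca)) (λ e∋u → ∈-swap (a ∷ b ∷ []) (c ∷ []) (inside-∈ (a ∷ b ∷ c ∷ []) {e} ins e∋u))

      cov-list₃ : ∀ xs → length xs ≤ 3 → Cov LatticeFacet inside⟦ set⟦ xs ⟧ ⟧ 1
      cov-list₃ [] _ = no-edge set⟦ [] ⟧ λ e ins → case inside-∈ [] {e} ins (inj₁ refl) of λ ()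
      -- A repeated vertex pads the triple: no vertex is adjacent to itself.
      cov-list₃ (a ∷ []) _ = all-at set⟦ a ∷ [] ⟧ a λ e ins → third {a} {a} (λ aa → adj⇒≢ aa refl) (λ e∋u → there (there (inside-∈ (a ∷ []) {e} ins e∋u)))
      cov-list₃ (a ∷ b ∷ []) _ = all-at set⟦ a ∷ b ∷ [] ⟧ b λ e ins → third {a} {a} (λ aa → adj⇒≢ aa refl) (λ e∋u → there (inside-∈ (a ∷ b ∷ []) {e} ins e∋u))
      cov-list₃ (a ∷ b ∷ c ∷ []) _ = cov-triple a b c (adj? a b) (adj? b c) (adj? a c)
      cov-list₃ (a ∷ b ∷ c ∷ d ∷ xs) (s≤s (s≤s (s≤s ())))

      -- The star of one vertex takes its edges at cost one, and the three remaining vertices cost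
      -- one more.
      cov-list₄ : ∀ xs → length xs ≤ 4 → Cov LatticeFacet inside⟦ set⟦ xs ⟧ ⟧ 2
      cov-list₄ []       _  = cov-mono (λ _ → ≤-refl) (s≤s z≤n) (cov-list₃ [] z≤n)
      cov-list₄ (x ∷ xs) le = cov-+ (star-cov x) (cov-list₃ xs (≤-pred le)) split ≤-refl
        where
        split : ∀ e → inside⟦ set⟦ x ∷ xs ⟧ ⟧ e ≤ star⟦ x ⟧ e + inside⟦ set⟦ xs ⟧ ⟧ e
        split e with e ∋? x
        ... | yes e∋x = ≤-trans (b2n≤1 (Inside set⟦ x ∷ xs ⟧ e)) (≤-trans (star≥1 e∋x) (m≤m+n _ _))
        ... | no ¬e∋x = ≤-trans (⊙-mono {Inside set⟦ x ∷ xs ⟧ e} {Inside set⟦ xs ⟧ e} (λ ins → ⇒inside set⟦ xs ⟧ λ e∋u → ∈⇒set xs (drop e∋u (set⇒∈ (x ∷ xs) (inside⇒ set⟦ x ∷ xs ⟧ {e} ins e∋u)))) ≤-refl)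
                                  (m≤n+m _ (star⟦ x ⟧ e))
          where
          drop : ∀ {u} → e ∋ u → u ∈ x ∷ xs → u ∈ xs
          drop e∋u (here refl)  = ⊥-elim (¬e∋x e∋u)
          drop e∋u (there u∈xs) = u∈xs

      inside-elements : ∀ S e → inside⟦ S ⟧ e ≤ inside⟦ set⟦ proj₁ (elements S) ⟧ ⟧ e
      inside-elements S e with elements S
      ... | xs , _ , all , _ = ⊙-mono {Inside S e} {Inside set⟦ xs ⟧ e} (λ ins → ⇒inside set⟦ xs ⟧ λ {u} e∋u → ∈⇒set xs (all u (inside⇒ S {e} ins e∋u))) ≤-refl

      small₃ : ∀ S → count S ≤ 3 → Cov LatticeFacet inside⟦ S ⟧ 1
      small₃ S size = cov-mono (inside-elements S) ≤-refl
        (cov-list₃ (proj₁ (elements S)) (≤-trans (≤-reflexive (proj₁ (proj₂ (elements S)))) size))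

      small₄ : ∀ S → count S ≤ 4 → Cov LatticeFacet inside⟦ S ⟧ 2
      small₄ S size = cov-mono (inside-elements S) ≤-refl
        (cov-list₄ (proj₁ (elements S)) (≤-trans (≤-reflexive (proj₁ (proj₂ (elements S)))) size))

      small₁ : ∀ S b → count S ≤ 1 → Cov LatticeFacet inside⟦ S ⟧ b
      small₁ S b size = no-edge S λ e ins → <⇒≱ (length≤count S (p e ∷ q e ∷ []) ((loopless e ∷ []) ∷ [] ∷ [])
        (inside⇒ S {e} ins (inj₁ refl) ∷ inside⇒ S {e} ins (inj₂ refl) ∷ [])) size

      cov-stars : ∀ xs → Cov LatticeFacet (λ e → ListAction.sum (List.map (λ v → star⟦ v ⟧ e) xs)) (length xs)
      cov-stars []       = nil λ _ → refl
      cov-stars (x ∷ xs) = cov-+ (star-cov x) (cov-stars xs) (λ _ → ≤-refl) ≤-refl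

      cov-transversal : ∀ S X → (∀ e → Inside S e ≡ true → ∃ λ v → e ∋ v × X v ≡ true) → Cov LatticeFacet inside⟦ S ⟧ (count X)
      cov-transversal S X hit with elements X
      ... | xs , len , all , _ = cov-mono (inside-≤ S λ e ins → let (v , e∋v , Xv) = hit e ins in found (all v Xv) e∋v) (≤-reflexive len) (cov-stars xs)
        where
        found : ∀ {xs v e} → v ∈ xs → e ∋ v → 1 ≤ ListAction.sum (List.map (λ v → star⟦ v ⟧ e) xs)
        found (here refl) e∋v = ≤-trans (star≥1 e∋v) (m≤m+n _ _)
        found {x ∷ _} {e = e} (there v∈) e∋v = ≤-trans (found v∈ e∋v) (m≤n+m _ (star⟦ x ⟧ e))

      -- One of the two colour classes of an odd set is small enough to carry stars only.
      bipartite-odd : ∀ S b (c : V → Bool) → (∀ e → Inside S e ≡ true → c (p e) ≢ c (q e)) → count S ≤ 1 + 2 * b →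
                      Cov LatticeFacet inside⟦ S ⟧ b
      bipartite-odd S b c proper size with count black ≤? b
        where
        black : V → Bool
        black v = S v ∧ c v
      ... | yes le = cov-mono (λ _ → ≤-refl) le (cov-transversal S (λ v → S v ∧ c v) hit)
        where
        hit : ∀ e → Inside S e ≡ true → ∃ λ v → e ∋ v × S v ∧ c v ≡ true
        hit e ins with c (p e) in cp | c (q e) in cq
        ... | true  | _     = p e , inj₁ refl , ∧-intro (inside⇒ S {e} ins (inj₁ refl)) cp
        ... | false | true  = q e , inj₂ refl , ∧-intro (inside⇒ S {e} ins (inj₂ refl)) cq
        ... | false | false = ⊥-elim (proper e ins (trans cp (sym cq)))
      ... | no gt = cov-mono (λ _ → ≤-refl) white≤ (cov-transversal S (λ v → S v ∧ not (c v)) hit)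
        where
        split : count S ≡ count (λ v → S v ∧ c v) + count (λ v → S v ∧ not (c v))
        split = trans (sum-cong-≗ λ v → pointwise (S v) (c v)) (∑-distrib-+ (λ v → b2n (S v ∧ c v)) (λ v → b2n (S v ∧ not (c v))))
          where
          pointwise : ∀ s c → b2n s ≡ b2n (s ∧ c) + b2n (s ∧ not c)
          pointwise true  true  = refl
          pointwise true  false = refl
          pointwise false _     = refl
        white≤ : count (λ v → S v ∧ not (c v)) ≤ b
        white≤ = +-cancelˡ-≤ (suc b) _ _ (begin
          suc b + count (λ v → S v ∧ not (c v))                      ≤⟨ +-monoˡ-≤ _ (≰⇒> gt) ⟩
          count (λ v → S v ∧ c v) + count (λ v → S v ∧ not (c v))    ≡⟨ split ⟨
          count S                                                    ≤⟨ size ⟩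
          1 + 2 * b                                                  ≡⟨ cong (λ x → suc (b + x)) (+-identityʳ b) ⟩
          suc b + b                                                  ∎)
          where open ≤-Reasoning
        hit : ∀ e → Inside S e ≡ true → ∃ λ v → e ∋ v × S v ∧ not (c v) ≡ true
        hit e ins with c (p e) in cp | c (q e) in cq
        ... | false | _     = p e , inj₁ refl , ∧-intro (inside⇒ S {e} ins (inj₁ refl)) (cong not cp)
        ... | true  | false = q e , inj₂ refl , ∧-intro (inside⇒ S {e} ins (inj₂ refl)) (cong not cq)
        ... | true  | true  = ⊥-elim (proper e ins (trans cp (sym cq)))


    -- Gluing dual solutions at a vertex

    DualOn : (V → Bool) → Set
    DualOn S = ∀ w → (∀ e → Inside S e ≡ false → w e ≡ 0) → Dual LatticeFacet w

    module Piece (w : E → ℕ) (x : V) where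
      top topMissing : ℕ
      top        = wt w (proj₁ (maximum w))
      topMissing = wt w (proj₁ (maximumMissing w x))

      topMissing≤top : topMissing ≤ top
      topMissing≤top = proj₂ (proj₂ (maximum w)) _ (proj₁ (proj₁ (proj₂ (maximumMissing w x))))

      lowered : ℕ → E → ℕ
      lowered d e = w e ∸ d * star⟦ x ⟧ e

      lowered≤ : ∀ d e → lowered d e ≤ w e
      lowered≤ d e = m∸n≤m (w e) (d * star⟦ x ⟧ e)

      -- A good matching for the lowered weights that covers `x` does so by an edge of original
      -- weight above `d`. The truncation is exact there, and giving `d` back stays within the
      -- optimum.
      lowered-bound : ∀ d M → Good (lowered d) M → wt (lowered d) M ≤ topMissing ⊎ wt (lowered d) M + d ≤ top
      lowered-bound d M good with cover? M x
      ... | inj₂ miss = inj₁ (≤-trans (wt-mono {M = M} (λ _ t → t) (lowered≤ d))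
                         (proj₂ (proj₂ (maximumMissing w x)) M (good-≤ (lowered≤ d) good , miss)))
      ... | inj₁ (e , Me , e∋x) = inj₂ (begin
        wt (lowered d) M + d                                  ≡⟨ cong (_+ d) (wt-unset (lowered d) M e Me) ⟩
        lowered d e + wt (lowered d) (unset M e) + d          ≡⟨ shuffle (lowered d e) (wt (lowered d) (unset M e)) d ⟩
        (lowered d e + d) + wt (lowered d) (unset M e)        ≤⟨ +-mono-≤ (≤-reflexive refund) (wt-mono {M = unset M e} (λ _ t → t) (lowered≤ d)) ⟩
        w e + wt w (unset M e)                                ≡⟨ wt-unset w M e Me ⟨
        wt w M                                                ≤⟨ proj₂ (proj₂ (maximum w)) M (good-≤ (lowered≤ d) good) ⟩
        top                                                   ∎)
        where
        open ≤-Reasoning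
        shuffle : ∀ a b c → a + b + c ≡ (a + c) + b
        shuffle = ℕRing.solve-∀
        lowered≡ : lowered d e ≡ w e ∸ d
        lowered≡ = cong (w e ∸_) (trans (cong (d *_) (cong b2n (∋⇒incident e∋x))) (*-identityʳ d))
        refund : lowered d e + d ≡ w e
        refund = trans (cong (_+ d) lowered≡) (m∸n+n≡m {w e} {d} (<⇒≤ (m<n⇒0<n∸m′ (subst (1 ≤_) lowered≡ (proj₂ good e Me)))))
          where
          m<n⇒0<n∸m′ : 1 ≤ w e ∸ d → d < w e
          m<n⇒0<n∸m′ pos = ≰⇒> λ w≤d → <⇒≢ pos (sym (m≤n⇒m∸n≡0 w≤d))

    cov-multiple : ∀ {F : (E → ℕ) → ℕ → Set} {χ b} d → Cov F χ b → Cov F (λ e → d * χ e) (d * b)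
    cov-multiple zero    D = nil λ _ → refl
    cov-multiple (suc d) D = cov-+ D (cov-multiple d D) (λ _ → ≤-refl) ≤-refl

    restrict : (V → Bool) → (E → ℕ) → E → ℕ
    restrict S w e = Inside S e ⊙ w e

    restrict≤ : ∀ S w e → restrict S w e ≤ w e
    restrict≤ S w e with Inside S e
    ... | true  = ≤-refl
    ... | false = z≤n

    restrict-inside : ∀ S w e → 1 ≤ restrict S w e → Inside S e ≡ true
    restrict-inside S w e pos with Inside S e
    ... | true = refl

    restrict-outside : ∀ S w e → Inside S e ≡ false → restrict S w e ≡ 0
    restrict-outside S w e eq rewrite eq = refl

    restrict-≡ : ∀ S w e → Inside S e ≡ true → w e ≤ restrict S w e
    restrict-≡ S w e eq rewrite eq = ≤-refl

    module Glue (S₁ S₂ : V → Bool) (x : V) (only-x : ∀ v → S₁ v ≡ true → S₂ v ≡ true → v ≡ x)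
                (star-x : Cov LatticeFacet star⟦ x ⟧ 1) (w : E → ℕ)
                (split : ∀ e → 1 ≤ w e → Inside S₁ e ≡ true ⊎ Inside S₂ e ≡ true)
                (dual₁ : DualOn S₁) (dual₂ : DualOn S₂) where
      w₁ w₂ : E → ℕ
      w₁ = restrict S₁ w
      w₂ = restrict S₂ w
      module P₁ = Piece w₁ x
      module P₂ = Piece w₂ x

      disjoint : ∀ e → Inside S₁ e ≡ true → Inside S₂ e ≡ true → ⊥
      disjoint e i j = loopless e (trans (at (inj₁ refl)) (sym (at (inj₂ refl))))
        where
        at : ∀ {u} → e ∋ u → u ≡ x
        at e∋u = only-x _ (inside⇒ S₁ {e} i e∋u) (inside⇒ S₂ {e} j e∋u)

      -- The star of x takes the smaller of the two gains from x, which is that of the second side here.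
      glue : P₁.topMissing + (P₂.top ∸ P₂.topMissing) ≤ P₁.top → Dual LatticeFacet w
      glue gain = union , (union-matching , union-pos) , b₁ + b₂ + d , cov , ≤-trans value (≤-reflexive (sym union-wt))
        where
        d : ℕ
        d = P₂.top ∸ P₂.topMissing
        sol₁ = dual₁ (P₁.lowered d) λ e out → n≤0⇒n≡0 (≤-trans (P₁.lowered≤ d e) (≤-reflexive (restrict-outside S₁ w e out)))
        sol₂ = dual₂ (P₂.lowered d) λ e out → n≤0⇒n≡0 (≤-trans (P₂.lowered≤ d e) (≤-reflexive (restrict-outside S₂ w e out)))
        b₁ b₂ : ℕ
        b₁ = proj₁ (proj₂ (proj₂ sol₁))
        b₂ = proj₁ (proj₂ (proj₂ sol₂))
        N₁ N₂ : E → Bool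
        N₁ = proj₁ (maximum w₁)
        N₂ = proj₁ (maximumMissing w₂ x)
        good₁ : Good w₁ N₁
        good₁ = proj₁ (proj₂ (maximum w₁))
        good₂ : Good w₂ N₂
        good₂ = proj₁ (proj₁ (proj₂ (maximumMissing w₂ x)))
        miss₂ : Misses N₂ x
        miss₂ = proj₂ (proj₁ (proj₂ (maximumMissing w₂ x)))
        in₁ : ∀ e → N₁ e ≡ true → Inside S₁ e ≡ true
        in₁ e t = restrict-inside S₁ w e (proj₂ good₁ e t)
        in₂ : ∀ e → N₂ e ≡ true → Inside S₂ e ≡ true
        in₂ e t = restrict-inside S₂ w e (proj₂ good₂ e t)
        union : E → Bool
        union e = N₁ e ∨ N₂ e
        ∨-elim : ∀ {a b} → a ∨ b ≡ true → a ≡ true ⊎ b ≡ true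
        ∨-elim {true}  _ = inj₁ refl
        ∨-elim {false} t = inj₂ t
        clash : ∀ {e e′ u} → N₁ e ≡ true → N₂ e′ ≡ true → e ∋ u → ¬ e′ ∋ u
        clash {e} {e′} {u} t t′ e∋u e′∋u with only-x u (inside⇒ S₁ {e} (in₁ e t) e∋u) (inside⇒ S₂ {e′} (in₂ e′ t′) e′∋u)
        ... | refl = miss₂ e′ t′ e′∋u
        union-matching : IsMatching G union
        union-matching e e′ t t′ e≢ u e∋u e′∋u with ∨-elim {N₁ e} t | ∨-elim {N₁ e′} t′
        ... | inj₁ a | inj₁ b = proj₁ good₁ e e′ a b e≢ u e∋u e′∋u
        ... | inj₂ a | inj₂ b = proj₁ good₂ e e′ a b e≢ u e∋u e′∋u
        ... | inj₁ a | inj₂ b = clash a b e∋u e′∋u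
        ... | inj₂ a | inj₁ b = clash b a e′∋u e∋u
        union-pos : ∀ e → union e ≡ true → 1 ≤ w e
        union-pos e t with ∨-elim {N₁ e} t
        ... | inj₁ a = ≤-trans (proj₂ good₁ e a) (restrict≤ S₁ w e)
        ... | inj₂ b = ≤-trans (proj₂ good₂ e b) (restrict≤ S₂ w e)
        union-wt : wt w union ≡ P₁.top + P₂.topMissing
        union-wt = trans (sum-cong-≗ pointwise) (∑-distrib-+ (λ e → N₁ e ⊙ w₁ e) (λ e → N₂ e ⊙ w₂ e))
          where
          pointwise : ∀ e → (N₁ e ∨ N₂ e) ⊙ w e ≡ (N₁ e ⊙ w₁ e) + (N₂ e ⊙ w₂ e)
          pointwise e with N₁ e in a | N₂ e in b
          ... | true  | true  = ⊥-elim (disjoint e (in₁ e a) (in₂ e b))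
          ... | true  | false = trans (≤-antisym (restrict-≡ S₁ w e (in₁ e a)) (restrict≤ S₁ w e)) (sym (+-identityʳ _))
          ... | false | true  = ≤-antisym (restrict-≡ S₂ w e (in₂ e b)) (restrict≤ S₂ w e)
          ... | false | false = refl
        value : b₁ + b₂ + d ≤ P₁.top + P₂.topMissing
        value = begin
          b₁ + b₂ + d         ≡⟨ shuffle b₁ b₂ d ⟩
          (b₁ + d) + b₂       ≤⟨ +-mono-≤ first second ⟩
          P₁.top + P₂.topMissing ∎
          where
          open ≤-Reasoning
          shuffle : ∀ a b c → a + b + c ≡ (a + c) + b
          shuffle = ℕRing.solve-∀
          b₁≤ : b₁ ≤ wt (P₁.lowered d) (proj₁ sol₁)
          b₁≤ = proj₂ (proj₂ (proj₂ (proj₂ sol₁)))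
          b₂≤ : b₂ ≤ wt (P₂.lowered d) (proj₁ sol₂)
          b₂≤ = proj₂ (proj₂ (proj₂ (proj₂ sol₂)))
          -- If the matching of the first solution misses `x`, then `gain` leaves room for `d`; if
          -- it covers `x`, the lowering has already set `d` aside.
          first : b₁ + d ≤ P₁.top
          first = [ (λ le → ≤-trans (+-monoˡ-≤ d (≤-trans b₁≤ le)) gain) , (λ le → ≤-trans (+-monoˡ-≤ d b₁≤) le) ]′
            (P₁.lowered-bound d (proj₁ sol₁) (proj₁ (proj₂ sol₁)))
          second : b₂ ≤ P₂.topMissing
          second = [ ≤-trans b₂≤ , (λ le → +-cancelʳ-≤ d b₂ P₂.topMissing (≤-trans (+-monoˡ-≤ d b₂≤)
                       (≤-trans le (≤-reflexive (sym (m+[n∸m]≡n P₂.topMissing≤top)))))) ]′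
            (P₂.lowered-bound d (proj₁ sol₂) (proj₁ (proj₂ sol₂)))
        cov : Cov LatticeFacet w (b₁ + b₂ + d)
        cov = cov-+ (cov-+ (proj₁ (proj₂ (proj₂ (proj₂ sol₁)))) (proj₁ (proj₂ (proj₂ (proj₂ sol₂)))) (λ _ → ≤-refl) ≤-refl)
          (cov-multiple d star-x) covers (≤-reflexive (cong (b₁ + b₂ +_) (*-identityʳ d)))
          where
          back : ∀ a c → a ≤ (a ∸ c) + c
          back a c = ≤-trans (m≤n+m∸n a c) (≤-reflexive (+-comm c (a ∸ c)))
          covers : ∀ e → w e ≤ P₁.lowered d e + P₂.lowered d e + d * star⟦ x ⟧ e
          covers e with 1 ≤? w e
          ... | no ¬pos = ≤-trans (≤-pred (≰⇒> ¬pos)) z≤n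
          ... | yes pos with split e pos
          ... | inj₁ ins = ≤-trans (≤-trans (restrict-≡ S₁ w e ins) (back (w₁ e) (d * star⟦ x ⟧ e)))
                             (+-monoˡ-≤ (d * star⟦ x ⟧ e) (m≤m+n _ (P₂.lowered d e)))
          ... | inj₂ ins = ≤-trans (≤-trans (restrict-≡ S₂ w e ins) (back (w₂ e) (d * star⟦ x ⟧ e)))
                             (+-monoˡ-≤ (d * star⟦ x ⟧ e) (m≤n+m _ (P₁.lowered d e)))

    glue-dual : ∀ S₁ S₂ x → (∀ v → S₁ v ≡ true → S₂ v ≡ true → v ≡ x) → Cov LatticeFacet star⟦ x ⟧ 1 →
                ∀ w → (∀ e → 1 ≤ w e → Inside S₁ e ≡ true ⊎ Inside S₂ e ≡ true) →
                DualOn S₁ → DualOn S₂ → Dual LatticeFacet w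
    glue-dual S₁ S₂ x only-x star-x w split dual₁ dual₂ =
      [ Glue.glue S₁ S₂ x only-x star-x w split dual₁ dual₂
      , Glue.glue S₂ S₁ x (λ v a b → only-x v b a) star-x w (λ e pos → Sum.swap (split e pos)) dual₂ dual₁
      ]′ (balance (Piece.topMissing≤top (restrict S₁ w) x) (Piece.topMissing≤top (restrict S₂ w) x))
      where
      balance : ∀ {t₁ m₁ t₂ m₂} → m₁ ≤ t₁ → m₂ ≤ t₂ → m₁ + (t₂ ∸ m₂) ≤ t₁ ⊎ m₂ + (t₁ ∸ m₁) ≤ t₂
      balance {t₁} {m₁} {t₂} {m₂} le₁ le₂ with ≤-total (t₂ ∸ m₂) (t₁ ∸ m₁)
      ... | inj₁ le = inj₁ (≤-trans (+-monoʳ-≤ m₁ le) (≤-reflexive (m+[n∸m]≡n le₁)))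
      ... | inj₂ le = inj₂ (≤-trans (+-monoʳ-≤ m₂ le) (≤-reflexive (m+[n∸m]≡n le₂)))

    cov-restrict : ∀ S {F : (E → ℕ) → ℕ → Set} {w b} → (∀ {χ c} → F χ c → Cov LatticeFacet (restrict S χ) c) → Cov F w b →
                   Cov LatticeFacet (restrict S w) b
    cov-restrict S {w = w} h (nil z) = nil λ e → n≤0⇒n≡0 (≤-trans (restrict≤ S w e) (≤-reflexive (z e)))
    cov-restrict S h (cons {χ} {w′ = w′} f D c b) = cov-+ (h f) (cov-restrict S h D)
      (λ e → ≤-trans (⊙-mono {Inside S e} id (c e)) (≤-reflexive (distrib (Inside S e)))) b
      where
      distrib : ∀ b {x y} → b ⊙ (x + y) ≡ (b ⊙ x) + (b ⊙ y)
      distrib true  = refl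
      distrib false = refl

  -- Sufficiency for bipartite graphs and the pentagon

  module BipartiteAndPentagon where
    open Matchings
    open Degrees

    caseA : CaseA G → Gorenstein (MatchingPolytope G)
    caseA ((c , proper) , r , degree≡r) = gorenstein (s≤s z≤n) λ w → let (M , good , b , D , b≤) = edmonds-dual w in
      M , good , b , cov-bind convert D , b≤
      where
      open Edmonds
      open Reflexivity (suc r)
      essential : ∀ v → Essential G v → degree G v + 1 ≡ suc r
      essential v ess = trans (+-comm _ 1) (cong suc (degree≡r v ess))
      colour : ∀ {u v} → Adj G u v → c u ≢ c v
      colour (e , inj₁ (refl , refl)) = proper e refl
      colour (e , inj₂ (refl , refl)) = proper e refl ∘ sym
      pigeon : ∀ {a b c : Bool} → a ≢ b → b ≢ c → a ≢ c → ⊥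
      pigeon {a} {b} {c} ab bc ac = ac (trans (¬-not ab) (sym (¬-not (bc ∘ sym))))
      triangle : ∀ {a b c} → Adj G a b → Adj G b c → Adj G a c → Cov LatticeFacet inside⟦ set⟦ a ∷ b ∷ c ∷ [] ⟧ ⟧ 1
      triangle ab bc ac = ⊥-elim (pigeon (colour ab) (colour bc) (colour ac))
      convert : ∀ {χ b} → EdmondsFacet χ b → Cov LatticeFacet χ b
      convert (star v)       = star-cov essential triangle v
      convert (odd S b size) = bipartite-odd essential triangle S b c (λ e _ → proper e refl) size

    caseB : CaseB G → Gorenstein (MatchingPolytope G)
    caseB (f , g , _ , fg , gf , iso) = gorenstein (s≤s z≤n) λ w → let (M , good , b , D , b≤) = edmonds-dual w in
      M , good , b , cov-bind convert D , b≤
      where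
      open Edmonds
      open Reflexivity 3
      g-inj : ∀ {i j} → g i ≡ g j → i ≡ j
      g-inj {i} {j} eq = trans (sym (fg i)) (trans (cong f eq) (fg j))
      adj⇒ : ∀ {u v} → Adj G u v → C5-adj (f u) (f v) ≡ true
      adj⇒ {u} {v} (e , s) = proj₁ (iso u v refl refl) (e , refl , s)
      ⇒adj : ∀ {u v} → C5-adj (f u) (f v) ≡ true → Adj G u v
      ⇒adj {u} {v} t = let (e , _ , s) = proj₂ (iso u v refl refl) t in e , s
      hop : (h : Fin 5 → Fin 5) → (∀ i → C5-adj i (h i) ≡ true) → ∀ u → Adj G u (g (h (f u)))
      hop h h-adj u = ⇒adj (subst (λ j → C5-adj (f u) j ≡ true) (sym (fg (h (f u)))) (h-adj (f u)))
      degree≡2 : ∀ u → degree G u ≡ 2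
      degree≡2 u with hop next₅ C5-next u | hop prev₅ C5-prev u
      ... | e , s | e′ , s′ = trans (degree≡count G u) (count-list (λ e → incident? G e u) (e ∷ e′ ∷ [])
        ((distinct ∷ []) ∷ [] ∷ []) (∋⇒incident (proj₁ (same⇒∋ s)) ∷ ∋⇒incident (proj₁ (same⇒∋ s′)) ∷ []) cover)
        where
        distinct : e ≢ e′
        distinct refl with same⇒only s (proj₂ (same⇒∋ s′))
        ... | inj₁ eq = same⇒≢ s′ (sym eq)
        ... | inj₂ eq = next≢prev (f u) (sym (g-inj eq))
        cover : ∀ d → incident? G d u ≡ true → d ∈ e ∷ e′ ∷ []
        cover d t with other (incident⇒∋ t)
        ... | v , d∋v , u≢v , _ with C5-only (f u) (f v) (adj⇒ (adj-edge (incident⇒∋ t) d∋v u≢v))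
        ... | inj₁ eq = here (same-unique (sameEnds (incident⇒∋ t) d∋v u≢v) (subst (λ w → SameEnds (ends e) (u , w)) (trans (cong g (sym eq)) (gf v refl)) s))
        ... | inj₂ eq = there (here (same-unique (sameEnds (incident⇒∋ t) d∋v u≢v) (subst (λ w → SameEnds (ends e′) (u , w)) (trans (cong g (sym eq)) (gf v refl)) s′)))
      essential : ∀ v → Essential G v → degree G v + 1 ≡ 3
      essential v _ = cong (_+ 1) (degree≡2 v)
      triangle : ∀ {a b c} → Adj G a b → Adj G b c → Adj G a c → Cov LatticeFacet inside⟦ set⟦ a ∷ b ∷ c ∷ [] ⟧ ⟧ 1
      triangle {a} {b} {c} ab bc ac = ⊥-elim (C5-no-triangle (f a) (f b) (f c) (adj⇒ ab) (adj⇒ bc) (adj⇒ ac))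
      every : V → Bool
      every = const true
      gs : List V
      gs = List.tabulate g
      size≡5 : count every ≡ 5
      size≡5 = count-list every gs (Uniqueₚ.tabulate⁺ g-inj) (All.tabulate λ _ → refl)
        λ v _ → subst (_∈ gs) (gf v refl) (∈-tabulate⁺ {f = g} (f v))
      edges≡5 : count (Inside every) ≡ 5
      edges≡5 = *-cancelˡ-≡ (count (Inside every)) 5 2 (begin
        2 * count (Inside every)                        ≡⟨ handshake-inside every (Inside every) (λ _ t → t) ⟨
        sum (λ v → degIn (Inside every) v)              ≡⟨ sum-cong-≗ (λ v → trans (sym (degree≡count G v)) (degree≡2 v)) ⟩
        sum {n} (λ v → 2 * b2n (every v))               ≡⟨ *-distribˡ-sum 2 (λ v → b2n (every v)) ⟨
        2 * count every                                 ≡⟨ cong (2 *_) size≡5 ⟩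
        10                                              ∎)
        where open ≡-Reasoning
      convert : ∀ {χ b} → EdmondsFacet χ b → Cov LatticeFacet χ b
      convert (star v)                   = star-cov essential triangle v
      convert (odd S zero size)          = small₁ essential triangle S 0 size
      convert (odd S (suc zero) size)    = small₃ essential triangle S size
      -- All remaining odd sets are absorbed by the facet of the whole vertex set, for which 5 + 1 =
      -- 3 * 2.
      convert (odd S (suc (suc b)) size) = cov-mono (λ e → b2n≤1 (Inside S e)) (s≤s (s≤s z≤n))
        (cov-facet (odd-facet every 2 (≤-reflexive size≡5) (cong (_+ 1) edges≡5)))

  -- Sufficiency when essential vertices have degree three

  module CubicBlocks where
    open Matchings
    open Degrees
    open Edmonds
    open Reflexivity 4
    open Components

    triangle-edges : ∀ {a b c} → Adj G a b → Adj G b c → Adj G a c → count (Inside set⟦ a ∷ b ∷ c ∷ [] ⟧) ≡ 3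
    triangle-edges {a} {b} {c} (e , s) (f , t) (g , u) = count-list (Inside set⟦ xs ⟧) (e ∷ f ∷ g ∷ [])
      ((e≢f ∷ e≢g ∷ []) ∷ (f≢g ∷ []) ∷ [] ∷ [])
      (ins s (here refl) (there (here refl)) ∷ ins t (there (here refl)) (there (there (here refl)))
        ∷ ins u (here refl) (there (there (here refl))) ∷ []) cover
      where
      xs : List V
      xs = a ∷ b ∷ c ∷ []
      ins : ∀ {d u v} → SameEnds (ends d) (u , v) → u ∈ xs → v ∈ xs → Inside set⟦ xs ⟧ d ≡ true
      ins s u∈ v∈ = ⇒inside set⟦ xs ⟧ λ d∋z → ∈⇒set xs (case same⇒only s d∋z of λ { (inj₁ refl) → u∈ ; (inj₂ refl) → v∈ })
      e≢f : e ≢ f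
      e≢f refl = [ same⇒≢ u ∘ sym , same⇒≢ t ∘ sym ]′ (same⇒only s (proj₂ (same⇒∋ t)))
      e≢g : e ≢ g
      e≢g refl = [ same⇒≢ u ∘ sym , same⇒≢ t ∘ sym ]′ (same⇒only s (proj₂ (same⇒∋ u)))
      f≢g : f ≢ g
      f≢g refl = [ same⇒≢ s , same⇒≢ u ]′ (same⇒only t (proj₁ (same⇒∋ u)))
      cover : ∀ d → Inside set⟦ xs ⟧ d ≡ true → d ∈ e ∷ f ∷ g ∷ []
      cover d insd with inside-ends xs {d} insd
      ... | _ , _ , here refl , here refl , r                                 = ⊥-elim (same⇒≢ r refl)
      ... | _ , _ , here refl , there (here refl) , r                         = here (same-unique r s)
      ... | _ , _ , here refl , there (there (here refl)) , r                 = there (there (here (same-unique r u)))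
      ... | _ , _ , there (here refl) , here refl , r                         = here (same-unique (same-sym r) s)
      ... | _ , _ , there (here refl) , there (here refl) , r                 = ⊥-elim (same⇒≢ r refl)
      ... | _ , _ , there (here refl) , there (there (here refl)) , r         = there (here (same-unique r t))
      ... | _ , _ , there (there (here refl)) , here refl , r                 = there (there (here (same-unique (same-sym r) u)))
      ... | _ , _ , there (there (here refl)) , there (here refl) , r         = there (here (same-unique (same-sym r) t))
      ... | _ , _ , there (there (here refl)) , there (there (here refl)) , r = ⊥-elim (same⇒≢ r refl)

    triangle : ∀ {a b c} → Adj G a b → Adj G b c → Adj G a c → Cov LatticeFacet inside⟦ set⟦ a ∷ b ∷ c ∷ [] ⟧ ⟧ 1
    triangle {a} {b} {c} ab bc ac = cov-facet (odd-facet set⟦ a ∷ b ∷ c ∷ [] ⟧ 1 (count-set≤ (a ∷ b ∷ c ∷ []))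
      (cong (_+ 1) (triangle-edges ab bc ac)))

    -- The shapes whose odd subsets can be covered without further splitting; seven edges on five
    -- vertices fit 7 + 1 = 4 * 2. The colouring is a vector, which makes the property decidable.
    Manageable : (V → Bool) → Set
    Manageable S = (∃ λ (c : Subset n) → ∀ e → Inside S e ≡ true → Vec.lookup c (p e) ≢ Vec.lookup c (q e)) ⊎
                   count S ≤ 4 ⊎ (count S ≤ 5 × count (Inside S) ≡ 7)

    manageable? : ∀ S → Dec (Manageable S)
    manageable? S = anySubset? (λ c → Finₚ.all? λ e → true? (Inside S e) →-dec ¬? (Vec.lookup c (p e) Bool.≟ Vec.lookup c (q e)))
      ⊎-dec (count S ≤? 4) ⊎-dec ((count S ≤? 5) ×-dec (count (Inside S) ≟ 7))

    C5′-pairs : Fin 7 → Fin 5 × Fin 5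
    C5′-pairs zero                                           = # 0 , # 1
    C5′-pairs (suc zero)                                     = # 1 , # 2
    C5′-pairs (suc (suc zero))                               = # 2 , # 3
    C5′-pairs (suc (suc (suc zero)))                         = # 3 , # 4
    C5′-pairs (suc (suc (suc (suc zero))))                   = # 4 , # 0
    C5′-pairs (suc (suc (suc (suc (suc zero)))))             = # 1 , # 3
    C5′-pairs (suc (suc (suc (suc (suc (suc zero))))))       = # 2 , # 4

    C5′-pairs-adj : ∀ i → C5′-adj (proj₁ (C5′-pairs i)) (proj₂ (C5′-pairs i)) ≡ true
    C5′-pairs-adj = from-yes (Finₚ.all? λ i → true? (C5′-adj (proj₁ (C5′-pairs i)) (proj₂ (C5′-pairs i))))

    C5′-pairs-distinct : ∀ i j → SameEnds (C5′-pairs i) (C5′-pairs j) → i ≡ j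
    C5′-pairs-distinct = from-yes (Finₚ.all? λ i → Finₚ.all? λ j → same? (C5′-pairs i) (C5′-pairs j) →-dec (i Fin.≟ j))

    seven-edges : ∀ S F (g : Fin 5 → V) → (∀ {i j} → g i ≡ g j → i ≡ j) → (∀ i → S (g i) ≡ true) →
                  (∀ i → SAdj G F (g (proj₁ (C5′-pairs i))) (g (proj₂ (C5′-pairs i)))) → 7 ≤ count (Inside S)
    seven-edges S F g g-inj S-g sadj = ≤-trans (≤-reflexive (sym (Listₚ.length-tabulate edge)))
        (length≤count (Inside S) (List.tabulate edge) (Uniqueₚ.tabulate⁺ {f = edge} distinct) (Allₚ.tabulate⁺ {f = edge} inside))
      where
      edge : Fin 7 → E
      edge i = proj₁ (sadj i)
      at : ∀ i → SameEnds (ends (edge i)) (g (proj₁ (C5′-pairs i)) , g (proj₂ (C5′-pairs i)))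
      at i = proj₂ (proj₂ (sadj i))
      inside : ∀ i → Inside S (edge i) ≡ true
      inside i = ⇒inside S λ e∋u → case same⇒only (at i) e∋u of λ where
        (inj₁ refl) → S-g (proj₁ (C5′-pairs i))
        (inj₂ refl) → S-g (proj₂ (C5′-pairs i))
      pull : ∀ {x y a b c d} → SameEnds (x , y) (g a , g b) → SameEnds (x , y) (g c , g d) → SameEnds (a , b) (c , d)
      pull (inj₁ (r , s)) (inj₁ (t , u)) = inj₁ (g-inj (trans (sym r) t) , g-inj (trans (sym s) u))
      pull (inj₁ (r , s)) (inj₂ (t , u)) = inj₂ (g-inj (trans (sym r) t) , g-inj (trans (sym s) u))
      pull (inj₂ (r , s)) (inj₁ (t , u)) = inj₂ (g-inj (trans (sym s) u) , g-inj (trans (sym r) t))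
      pull (inj₂ (r , s)) (inj₂ (t , u)) = inj₁ (g-inj (trans (sym s) u) , g-inj (trans (sym r) t))
      distinct : ∀ {i j} → edge i ≡ edge j → i ≡ j
      distinct {i} {j} eq = C5′-pairs-distinct i j (pull (at i)
        (subst (λ e → SameEnds (ends e) (g (proj₁ (C5′-pairs j)) , g (proj₂ (C5′-pairs j)))) (sym eq) (at j)))

    module _ (caseC : CaseC G) where

      essential : ∀ v → Essential G v → degree G v + 1 ≡ 4
      essential v ess = cong (_+ 1) (proj₁ caseC v ess)

      degree≤3 : ∀ v → degree G v ≤ 3
      degree≤3 v with degree G v ≤? 3
      ... | yes le = le
      ... | no gt  = ≤-reflexive (proj₁ caseC v (inj₂ (inj₂ (<⇒≤ (≰⇒> gt)))))

      -- Eight edges need degree sum 16, but five vertices of degree at most three reach only 15.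
      edges≤7 : ∀ S → count S ≤ 5 → count (Inside S) ≤ 7
      edges≤7 S size = ≮⇒≥ λ gt → <⇒≱ {15} {16} ≤-refl (begin
        16                      ≤⟨ *-monoʳ-≤ 2 gt ⟩
        2 * count (Inside S)    ≤⟨ inside-degree S 3 (λ v _ → degree≤3 v) ⟩
        count S * 3             ≤⟨ *-monoˡ-≤ 3 size ⟩
        15                      ∎)
        where open ≤-Reasoning

      -- Edmonds' solution may use facets that leave `S`. As `w` lives on the edges inside `S`, each
      -- is cut down to them; odd sets of right-hand side at least two are then covered according to
      -- the shape of `S`.
      dual-manageable : ∀ S → Manageable S → DualOn S
      dual-manageable S man w supp = let (M , good , b , D , b≤) = edmonds-dual w in
        M , good , b , cov-mono w≤ ≤-refl (cov-restrict S convert D) , b≤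
        where
        w≤ : ∀ e → w e ≤ restrict S w e
        w≤ e with Inside S e in eq
        ... | true  = ≤-refl
        ... | false = ≤-reflexive (supp e eq)
        _∩_ : (V → Bool) → V → Bool
        (T ∩ v) = S v ∧ T v
        meet : ∀ T e → restrict S inside⟦ T ⟧ e ≤ inside⟦ T ∩_ ⟧ e
        meet T e with S (p e) | S (q e) | T (p e) | T (q e)
        ... | true  | true  | true  | true  = ≤-refl
        ... | true  | true  | true  | false = z≤n
        ... | true  | true  | false | _     = z≤n
        ... | true  | false | _     | _     = z≤n
        ... | false | _     | _     | _     = z≤n
        count-meet : ∀ T → count (T ∩_) ≤ count T
        count-meet T = count-mono {f = T ∩_} {g = T} λ v t → proj₂ (∧-elim (S v) t)
        meet⊆ : ∀ T e → Inside (T ∩_) e ≡ true → Inside S e ≡ true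
        meet⊆ T e t = ⇒inside S λ e∋u → proj₁ (∧-elim (S _) (inside⇒ (T ∩_) {e} t e∋u))
        large : ∀ T b → 2 ≤ b → Manageable S → count T ≤ 1 + 2 * b → Cov LatticeFacet (restrict S inside⟦ T ⟧) b
        large T b 2≤b (inj₁ (c , proper)) size = cov-mono (meet T) ≤-refl
          (bipartite-odd essential triangle (T ∩_) b (Vec.lookup c) (λ e t → proper e (meet⊆ T e t)) (≤-trans (count-meet T) size))
        large T b 2≤b (inj₂ (inj₁ four)) size = cov-mono (λ e → ⊙-mono {Inside S e} id (b2n≤1 (Inside T e))) 2≤b
          (small₄ essential triangle S four)
        large T b 2≤b (inj₂ (inj₂ (five , seven))) size = cov-mono (λ e → ⊙-mono {Inside S e} id (b2n≤1 (Inside T e))) 2≤b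
          (cov-facet (odd-facet S 2 five (cong (_+ 1) seven)))
        convert : ∀ {χ c} → EdmondsFacet χ c → Cov LatticeFacet (restrict S χ) c
        convert (star v)                     = cov-mono (restrict≤ S star⟦ v ⟧) ≤-refl (star-cov essential triangle v)
        convert (odd T 0 size)               = cov-mono (restrict≤ S inside⟦ T ⟧) ≤-refl (small₁ essential triangle T 0 size)
        convert (odd T 1 size)               = cov-mono (restrict≤ S inside⟦ T ⟧) ≤-refl (small₃ essential triangle T size)
        convert (odd T (suc (suc b)) size) = large T (suc (suc b)) (s≤s (s≤s z≤n)) man size

      size : Subgraph G → ℕ
      size H = count (Subgraph.S H) + count (Subgraph.F H)

      -- An H with no room left to grow is a block, and S inherits the shape of the block containing it.
      no-extension : ∀ S → ¬ Manageable S → ∀ d H → Biconn G H → _⊆ₛ_ G (induced S) H → n + m ≤ d + size H → ⊥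
      no-extension S bad d H bi S⊆H bound = bad (classify (proj₂ caseC H (bi , maximal)))
        where
        module H = Subgraph H
        larger : ∀ {H′} → Biconn G H′ → _⊆ₛ_ G H H′ → size H < size H′ → ⊥
        larger {H′} bi′ (v⊆ , e⊆) lt = grow d bound
          where
          grow : ∀ d → n + m ≤ d + size H → ⊥
          grow zero    bound = <⇒≱ lt (≤-trans (+-mono-≤ (count≤size (Subgraph.S H′)) (count≤size (Subgraph.F H′))) bound)
          grow (suc d) bound = no-extension S bad d H′ bi′ ((λ u t → v⊆ u (proj₁ S⊆H u t)) , (λ e t → e⊆ e (proj₂ S⊆H e t)))
                        (≤-trans bound (≤-trans (≤-reflexive (sym (+-suc d (size H)))) (+-monoʳ-≤ d lt)))
        maximal : ∀ H′ → Biconn G H′ → _⊆ₛ_ G H H′ → _⊆ₛ_ G H′ H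
        maximal H′ bi′ (v⊆ , e⊆) = vertex , edge
          where
          vertex : ∀ u → Subgraph.S H′ u ≡ true → H.S u ≡ true
          vertex u t with true? (H.S u)
          ... | yes Su = Su
          ... | no ¬Su = ⊥-elim (larger {H′} bi′ (v⊆ , e⊆) (+-mono-<-≤ (count-strict v⊆ u (¬-not ¬Su) t) (count-mono e⊆)))
          edge : ∀ e → Subgraph.F H′ e ≡ true → H.F e ≡ true
          edge e t with true? (H.F e)
          ... | yes Fe = Fe
          ... | no ¬Fe = ⊥-elim (larger {H′} bi′ (v⊆ , e⊆) (+-mono-≤-< (count-mono v⊆) (count-strict e⊆ e (¬-not ¬Fe) t)))
        bounded : ∀ {k} A → IsoTo G H k A → count H.S ≤ k
        bounded {k} A (f , g , _ , _ , gf , _) = ≤-trans (count≤length H.S (List.tabulate g)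
          λ v t → subst (_∈ List.tabulate g) (gf v t) (∈-tabulate⁺ {f = g} (f v))) (≤-reflexive (Listₚ.length-tabulate g))
        count≤ : count S ≤ count H.S
        count≤ = count-mono (proj₁ S⊆H)
        seven : IsoTo G H 5 C5′-adj → 5 ≤ count S → 7 ≤ count (Inside S)
        seven iso@(f , g , Sg , fg , gf , adj) five = seven-edges S H.F g g-inj S-g sadj
          where
          S-g : ∀ i → S (g i) ≡ true
          -- `S` has at least five vertices and lies in a block of at most five, so it contains all
          -- of them.
          S-g i = decidable-stable (true? (S (g i))) λ ¬t →
            <⇒≱ (count-strict {f = S} {g = H.S} (proj₁ S⊆H) (g i) (¬-not ¬t) (Sg i)) (≤-trans (bounded C5′-adj iso) five)
          sadj : ∀ i → SAdj G H.F (g (proj₁ (C5′-pairs i))) (g (proj₂ (C5′-pairs i)))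
          sadj i = let (x , y) = C5′-pairs i in proj₂ (adj (g x) (g y) (Sg x) (Sg y)) (trans (cong₂ C5′-adj (fg x) (fg y)) (C5′-pairs-adj i))
          g-inj : ∀ {i j} → g i ≡ g j → i ≡ j
          g-inj {i} {j} eq = trans (sym (fg i)) (trans (cong f eq) (fg j))
        classify : _ → Manageable S
        classify (inj₁ (c , proper)) = inj₁ (Vec.tabulate c , λ e ins eq → proper e (proj₂ S⊆H e ins)
          (trans (sym (Vecₚ.lookup∘tabulate c (p e))) (trans eq (Vecₚ.lookup∘tabulate c (q e)))))
        classify (inj₂ (inj₁ iso))                      = inj₂ (inj₁ (≤-trans count≤ (≤-trans (bounded K3-adj iso) (s≤s (s≤s (s≤s z≤n))))))
        classify (inj₂ (inj₂ (inj₁ iso)))               = inj₂ (inj₁ (≤-trans count≤ (bounded K4-adj iso)))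
        classify (inj₂ (inj₂ (inj₂ (inj₁ iso))))        = inj₂ (inj₁ (≤-trans count≤ (bounded K112-adj iso)))
        classify (inj₂ (inj₂ (inj₂ (inj₂ iso)))) with count S ≤? 4
        ... | yes four = inj₂ (inj₁ four)
        ... | no more  = let five = ≤-trans count≤ (bounded C5′-adj iso) in inj₂ (inj₂ (five , ≤-antisym (edges≤7 S five) (seven iso (≰⇒> more))))

      -- Being a block quantifies over all subgraphs, so the block around `S` is not constructed.
      -- Decidability of `Manageable` permits the argument by contradiction.
      unseparated-manageable : ∀ S → (∀ S₁ S₂ x → ¬ Separation S S₁ S₂ x) → Manageable S
      unseparated-manageable S nosep = decidable-stable (manageable? S) λ bad → case Finₚ.any? (λ v → true? (S v)) of λ where
        (yes nonempty) → no-extension S bad (n + m) (induced S) (Unseparated.biconnected S nosep nonempty)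
                           ((λ _ t → t) , (λ _ t → t)) (m≤m+n (n + m) (size (induced S)))
        (no empty)     → bad (inj₂ (inj₁ (≤-trans (≤-reflexive (count≡0 S λ v → ¬-not λ t → empty (v , t))) z≤n)))

      dual-on : ∀ d S → count S < d → DualOn S
      dual-on (suc d) S lt w supp = [ separated , (λ nosep → dual-manageable S (unseparated-manageable S nosep) w supp) ]′ (separable? S)
        where
        separated : (∃ λ S₁ → ∃₂ λ S₂ x → Separation S S₁ S₂ x) → Dual LatticeFacet w
        separated (S₁ , S₂ , x , edges , common , lt₁ , lt₂) = glue-dual S₁ S₂ x common (star-cov essential triangle x) w
          (λ e pos → edges e (inside e pos)) (dual-on d S₁ (≤-trans lt₁ (≤-pred lt))) (dual-on d S₂ (≤-trans lt₂ (≤-pred lt)))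
          where
          inside : ∀ e → 1 ≤ w e → Inside S e ≡ true
          inside e pos with Inside S e in eq
          ... | true  = refl
          ... | false = contradiction pos (<⇒≱ (s≤s (≤-reflexive (supp e eq))))

      gorensteinC : Gorenstein (MatchingPolytope G)
      gorensteinC = gorenstein (s≤s z≤n) λ w → dual-on (suc (count {n} (const true))) (const true) ≤-refl w λ _ ()

  -- Neighbour counts and isomorphisms

  module Neighbours where
    open Matchings
    open Degrees

    edges-to : ∀ {v} L → Unique L → All (Adj G v) L →
               ∃ λ es → length es ≡ length L × Unique es × All (_∋ v) es × (∀ {e u} → e ∈ es → e ∋ u → u ≡ v ⊎ u ∈ L)
    edges-to []      _         _              = [] , refl , [] , [] , λ ()
    edges-to (x ∷ L) (x∉ ∷ u) ((e , s) ∷ as) with edges-to L u as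
    ... | es , len , ues , at , only = e ∷ es , cong suc len , unique-∷ e∉ ues , proj₁ (same⇒∋ s) ∷ at , λ where
          (here refl) e∋u → Sum.map₂ here (same⇒only s e∋u)
          (there e∈) e∋u  → Sum.map₂ there (only e∈ e∋u)
      where
      e∉ : e ∉ es
      e∉ e∈ with only e∈ (proj₂ (same⇒∋ s))
      ... | inj₁ x≡v = same⇒≢ s (sym x≡v)
      ... | inj₂ x∈L = All.lookup x∉ x∈L refl

    neighbours≤degree : ∀ {v} L → Unique L → All (Adj G v) L → length L ≤ degree G v
    neighbours≤degree L u as = let (es , len , ues , at , _) = edges-to L u as in
      ≤-trans (≤-reflexive (sym len)) (degree-bound es ues at)

    no-more-neighbours : ∀ {v u} L → Unique L → All (Adj G v) L → degree G v ≤ length L → Adj G v u → u ∈ L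
    no-more-neighbours {v} {u} L uL as deg≤ vu with u ∈? L
    ... | yes u∈ = u∈
    ... | no u∉  = contradiction (neighbours≤degree (u ∷ L) (unique-∷ u∉ uL) (vu ∷ as)) (<⇒≱ (s≤s deg≤))

    index-neighbours : ∀ {k} (g : Fin k → V) → (∀ {i j} → g i ≡ g j → i ≡ j) → ∀ i nb → Unique nb → All (λ j → Adj G (g i) (g j)) nb →
                       degree G (g i) ≤ length nb → ∀ {u} → Adj G (g i) u → ∃ λ j → j ∈ nb × u ≡ g j
    index-neighbours g g-inj i nb unb as deg≤ iu = ∈-map⁻ g
      (no-more-neighbours (List.map g nb) (Uniqueₚ.map⁺ g-inj unb) (Allₚ.map⁺ as) (≤-trans deg≤ (≤-reflexive (sym (Listₚ.length-map g nb)))) iu)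

    module _ (H : Subgraph G) where
      open Subgraph H

      sadj⇒adj : ∀ {u v} → SAdj G F u v → Adj G u v
      sadj⇒adj (e , _ , s) = e , s

      isomorphism : ∀ {k} (A : Fin (suc k) → Fin (suc k) → Bool) (g : Fin (suc k) → V) → (∀ {i j} → g i ≡ g j → i ≡ j) →
                    (∀ i → S (g i) ≡ true) → (∀ u → S u ≡ true → ∃ λ i → g i ≡ u) →
                    (∀ i j → A i j ≡ true → SAdj G F (g i) (g j)) → (∀ i j → i ≢ j → Adj G (g i) (g j) → A i j ≡ true) →
                    IsoTo G H (suc k) A
      isomorphism A g g-inj Sg cover edges nonedges = f , g , Sg , fg , gf , λ u v Su Sv →
          (λ uv → nonedges (f u) (f v) (λ eq → adj⇒≢ (sadj⇒adj uv) (trans (sym (gf u Su)) (trans (cong g eq) (gf v Sv))))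
                    (subst₂ (Adj G) (sym (gf u Su)) (sym (gf v Sv)) (sadj⇒adj uv)))
        , λ a → subst₂ (SAdj G F) (gf u Su) (gf v Sv) (edges (f u) (f v) a)
        where
        find : ∀ u → Dec (∃ λ i → g i ≡ u)
        find u = Finₚ.any? λ i → g i Fin.≟ u
        f : V → _
        f u with find u
        ... | yes (i , _) = i
        -- A default value: `IsoTo` wants `f` on all vertices but constrains it only on `S`.
        ... | no _        = zero
        gf : ∀ u → S u ≡ true → g (f u) ≡ u
        gf u Su with find u
        ... | yes (_ , eq) = eq
        ... | no none      = ⊥-elim (none (cover u Su))
        fg : ∀ i → f (g i) ≡ i
        fg i = g-inj (gf (g i) (Sg i))

  -- Pentagons in a subgraph

  module PentagonBlocks (H : Subgraph G) where
    open Matchings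
    open Degrees
    open Neighbours
    open Components using (reach?; reach-closed; sadj-sym; deleteS-elim; deleteS-intro; deleteF-elim)
    open Subgraph H

    record Pentagon (g : Fin 5 → V) : Set where
      field
        injective : ∀ {i j} → g i ≡ g j → i ≡ j
        inS       : ∀ i → S (g i) ≡ true
        cycle     : ∀ i → SAdj G F (g i) (g (next₅ i))

    sadj-ends : ∀ {u v} → SAdj G F u v → S u ≡ true × S v ≡ true
    sadj-ends (e , Fe , inj₁ (refl , refl)) = closed e Fe
    sadj-ends (e , Fe , inj₂ (refl , refl)) = let (a , b) = closed e Fe in b , a

    pentagon-from : ∀ {c} → OddCycle (SAdj G F) 2 c → ∃ λ g → Pentagon g × (∀ v → v ∈ c → ∃ λ i → g i ≡ v) × (∀ i → g i ∈ c)
    pentagon-from {a ∷ b ∷ c ∷ d ∷ e ∷ []} (oddCycle u (ab , bc , cd , de , ea) refl) = g , record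
      { injective = λ {i} {j} → lookup-injective u i j
      ; inS = λ i → proj₁ (sadj-ends (cycle i))
      ; cycle = cycle } , (λ v v∈ → Any.index v∈ , sym (Anyₚ.lookup-index v∈)) , λ i → ∈-lookup i
      where
      g : Fin 5 → V
      g = List.lookup (a ∷ b ∷ c ∷ d ∷ e ∷ [])
      cycle : ∀ i → SAdj G F (g i) (g (next₅ i))
      cycle zero                         = ab
      cycle (suc zero)                   = bc
      cycle (suc (suc zero))             = cd
      cycle (suc (suc (suc zero)))       = de
      cycle (suc (suc (suc (suc zero)))) = ea

    rotated : ∀ {g} r → Pentagon g → Pentagon (g ∘ rot r)
    rotated {g} r pent = record
      { injective = λ eq → rot-injective r (P.injective eq)
      ; inS = λ i → P.inS (rot r i)
      ; cycle = λ i → subst (λ j → SAdj G F (g (rot r i)) (g j)) (sym (rot-next r i)) (P.cycle (rot r i)) }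
      where module P = Pentagon pent

    cycle⁻ : ∀ {g} → Pentagon g → ∀ i → Adj G (g (next₅ i)) (g i)
    cycle⁻ pent i = adj-sym (sadj⇒adj H (Pentagon.cycle pent i))

    -- The cycle already uses up both edges at each of its vertices, so nothing leaves it and
    -- connectedness makes it the whole graph.
    pentagon-C5 : (∀ v → degree G v ≤ 2) → Connected G → (∀ u → S u ≡ true) → (∀ e → F e ≡ true) → ∀ {g} → Pentagon g → IsoTo G H 5 C5-adj
    pentagon-C5 deg≤2 conn allS allF {g} pent = isomorphism H C5-adj g P.injective P.inS cover edges nonedges
      where
      module P = Pentagon pent
      neighbours : ∀ i {u} → Adj G (g i) u → ∃ λ j → j ∈ next₅ i ∷ prev₅ i ∷ [] × u ≡ g j
      neighbours i = index-neighbours g P.injective i (next₅ i ∷ prev₅ i ∷ []) ((next≢prev i ∷ []) ∷ [] ∷ [])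
        (sadj⇒adj H (P.cycle i) ∷ subst (λ j → Adj G (g j) (g (prev₅ i))) (next-prev i) (cycle⁻ pent (prev₅ i)) ∷ []) (deg≤2 (g i))
      cover : ∀ u → S u ≡ true → ∃ λ i → g i ≡ u
      cover u _ = reach-closed {X = λ w → ∃ λ i → g i ≡ w} (λ { (i , refl) _ (e , _ , s) → let (j , _ , eq) = neighbours i (e , s) in j , sym eq })
        (proj₂ conn (g zero) u refl refl) (zero , refl)
      edges : ∀ i j → C5-adj i j ≡ true → SAdj G F (g i) (g j)
      edges i j t with C5-only i j t
      ... | inj₁ refl = P.cycle i
      ... | inj₂ refl = sadj-sym (subst (λ l → SAdj G F (g (prev₅ i)) (g l)) (next-prev i) (P.cycle (prev₅ i)))
      nonedges : ∀ i j → i ≢ j → Adj G (g i) (g j) → C5-adj i j ≡ true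
      nonedges i j _ ij with neighbours i ij
      ... | l , here refl         , eq = subst (λ j → C5-adj i j ≡ true) (sym (P.injective eq)) (C5-next i)
      ... | l , there (here refl) , eq = subst (λ j → C5-adj i j ≡ true) (sym (P.injective eq)) (C5-prev i)

  -- Paths up to their first hit of a set

  module Paths where
    open Matchings

    reach-mono : ∀ {S S′ F F′} → (∀ u → S u ≡ true → S′ u ≡ true) → (∀ e → F e ≡ true → F′ e ≡ true) →
                 ∀ {u v} → Reach G S F u v → Reach G S′ F′ u v
    reach-mono S⊆ F⊆ (here Su) = here (S⊆ _ Su)
    reach-mono S⊆ F⊆ (step Su Sw (e , Fe , s) r) = step (S⊆ _ Su) (S⊆ _ Sw) (e , F⊆ e Fe , s) (reach-mono S⊆ F⊆ r)

    crossing : ∀ {S F} L {u v} → Reach G S F u v → u ∉ L → v ∈ L → ∃₂ λ x y → x ∉ L × y ∈ L × SAdj G F x y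
    crossing L (here _) u∉ v∈ = ⊥-elim (u∉ v∈)
    crossing L {u} (step {w = w} Su Sw uw r) u∉ v∈ with w ∈? L
    ... | yes w∈ = u , w , u∉ , w∈ , uw
    ... | no w∉  = crossing L r w∉ v∈

    record FirstHit (S : V → Bool) (F : E → Bool) (L : List V) (u : V) : Set where
      constructor firstHit
      field
        {xs}   : List V
        {y}    : V
        y∈     : y ∈ L
        uniq   : Unique (u ∷ xs)
        out    : ∀ {z} → z ∈ u ∷ xs → z ∉ L × S z ≡ true
        chain  : Chain (SAdj G F) u xs y

    -- Turns reachability into an ear: the walk stops on entering `L`, and whenever its start recurs
    -- the loop in between is cut out.
    first-hit : ∀ {S F} L {u v} → Reach G S F u v → u ∉ L → v ∈ L → FirstHit S F L u
    first-hit L (here _) u∉ v∈ = ⊥-elim (u∉ v∈)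
    first-hit {S} {F} L {u} (step {w = w} Su Sw uw r) u∉ v∈ = [ inside , outside ]′ (toSum (w ∈? L))
      where
      inside : w ∈ L → FirstHit S F L u
      inside w∈ = firstHit w∈ ([] ∷ []) (λ { (here refl) → u∉ , Su }) uw
      outside : w ∉ L → FirstHit S F L u
      outside w∉ = prepend (first-hit L r w∉ v∈)
        where
        prepend : FirstHit S F L w → FirstHit S F L u
        prepend (firstHit {xs} y∈ uniq out chain) with u ∈? w ∷ xs
        ... | no u∉′ = firstHit {xs = w ∷ xs} y∈ (unique-∷ u∉′ uniq) (λ { (here refl) → u∉ , Su ; (there z∈) → out z∈ }) (uw , chain)
        ... | yes u∈ with ∈-split u∈
        ... | [] , Q , refl = firstHit y∈ uniq out chain
        ... | p ∷ P , Q , refl = firstHit y∈ (proj₁ (proj₂ (unique-++⁻ (p ∷ P) uniq))) (λ z∈ → out (∈-++⁺ʳ (p ∷ P) z∈)) (proj₂ (chain-split P chain))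

  -- Two-colourings and odd cycles

  module Colouring where
    open Matchings
    open Components using (sadj-sym; reach-closed)

    flips : Bool → ℕ → Bool
    flips β zero    = β
    flips β (suc l) = flips (not β) l

    flips-even : ∀ β s → flips β (2 * s) ≡ β
    flips-even β zero    = refl
    flips-even β (suc s) = trans (cong (flips β) (*-suc 2 s)) (trans (flips-even (not (not β)) s) (not-not β))
      where
      not-not : ∀ b → not (not b) ≡ b
      not-not true  = refl
      not-not false = refl

    module _ (H : Subgraph G) where
      open Subgraph H

      -- In the bipartite double cover, an odd closed walk through v joins the two lifts of v.
      Cover : V × Bool → V × Bool → Set
      Cover (u , β) (v , γ) = SAdj G F u v × γ ≡ not β

      cover-sym : ∀ {x y} → Cover x y → Cover y x
      cover-sym {u , true}  (adj , refl) = sadj-sym adj , refl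
      cover-sym {u , false} (adj , refl) = sadj-sym adj , refl

      items : List (E × Bool)
      items = List.cartesianProduct (List.allFin m) (true ∷ false ∷ [])

      labels : _
      labels = Labelling.labelling (≡-dec Fin._≟_ Bool._≟_) Cover cover-sym (λ (e , β) → p e , β) (λ (e , β) → q e , not β)
        (λ (e , β) → F e) (λ (e , β) Fe → (e , Fe , inj₁ (refl , refl)) , refl) items

      label : V × Bool → V × Bool
      label = proj₁ labels

      label-edge : ∀ {u v} β → SAdj G F u v → label (u , β) ≡ label (v , not β)
      label-edge {u} {v} β (e , Fe , s) = go β s
        where
        both : ∀ β → β ∈ true ∷ false ∷ []
        both true  = here refl
        both false = there (here refl)
        base : ∀ β → label (p e , β) ≡ label (q e , not β)
        base β = proj₂ (proj₂ labels) (e , β) (∈-cartesianProduct⁺ (∈-allFin e) (both β)) Fe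
        go : ∀ β → SameEnds (ends e) (u , v) → label (u , β) ≡ label (v , not β)
        go β     (inj₁ (refl , refl)) = base β
        go true  (inj₂ (refl , refl)) = sym (base false)
        go false (inj₂ (refl , refl)) = sym (base true)

      walk-chain : ∀ {u β w γ} → Star Cover (u , β) (w , γ) →
                   (u ≡ w × β ≡ γ) ⊎ ∃ λ xs → Chain (SAdj G F) u xs w × flips β (suc (length xs)) ≡ γ
      walk-chain Star.ε = inj₁ (refl , refl)
      walk-chain {u} {β} ((adj , refl) ◅ rest) with walk-chain rest
      ... | inj₁ (refl , refl)  = inj₂ ([] , adj , refl)
      ... | inj₂ (xs , c , eq) = inj₂ (_ ∷ xs , (adj , c) , eq)

      -- A walk between the two lifts of `v` changes sheet an odd number of times, so its projection
      -- is a closed walk of odd length.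
      odd-closed : ∀ v → label (v , false) ≡ label (v , true) → ∃₂ (OddCycle (SAdj G F))
      odd-closed v eq with walk-chain (proj₁ (proj₂ labels) (v , false) (v , true) eq)
      ... | inj₂ (xs , c , flip) with halve (length xs)
      ... | s , inj₁ even = odd-cycle-in (suc (length xs)) (closedWalk {a = v} {A = xs} c) s (cong suc even) ≤-refl
      ... | s , inj₂ odd with () ← trans (sym (flips-even false (suc s)))
                                    (trans (cong (flips false) (trans (*-suc 2 s) (cong suc (sym odd)))) flip)

      -- Suppose the two lifts of every vertex lie in different components. By connectedness one
      -- lift of each vertex of `H` lies in the component of `(r , false)`, and the sheet of that
      -- lift is the colour. An edge with equally coloured ends would link both lifts of one end.
      bipartite-or-cycle : ConnectedSub G H → BipartiteSub G H ⊎ ∃₂ (OddCycle (SAdj G F))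
      bipartite-or-cycle ((r , Sr) , conn) with Finₚ.any? (λ v → ≡-dec Fin._≟_ Bool._≟_ (label (v , false)) (label (v , true)))
      ... | yes (v , eq) = inj₂ (odd-closed v eq)
      ... | no none = inj₁ (colour , proper)
        where
        _≟X_ : DecidableEquality (V × Bool)
        _≟X_ = ≡-dec Fin._≟_ Bool._≟_
        colour : V → Bool
        colour v = ⌊ label (v , false) ≟X label (r , false) ⌋
        linked : ∀ v → S v ≡ true → ∃ λ β → label (v , β) ≡ label (r , false)
        linked v Sv = reach-closed {X = λ z → ∃ λ β → label (z , β) ≡ label (r , false)}
          (λ { (β , eq) _ adj → not β , trans (sym (label-edge β adj)) eq }) (conn r v Sr Sv) (false , refl)
        other-side : ∀ v → S v ≡ true → colour v ≡ false → label (v , true) ≡ label (r , false)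
        other-side v Sv black with linked v Sv
        ... | true  , eq = eq
        ... | false , eq = case trans (sym black) (dec⇒true (label (v , false) ≟X label (r , false)) eq) of λ ()
        proper : ∀ e → F e ≡ true → colour (p e) ≢ colour (q e)
        proper e Fe same with colour (q e) in cq
        ... | true  = none (q e , trans (true⇒dec (label (q e , false) ≟X label (r , false)) cq)
              (trans (sym (true⇒dec (label (p e , false) ≟X label (r , false)) same)) (label-edge false (e , Fe , inj₁ (refl , refl)))))
        ... | false = none (q e , trans (sym (label-edge true (e , Fe , inj₁ (refl , refl))))
              (trans (other-side (p e) (proj₁ (closed e Fe)) same) (sym (other-side (q e) (proj₂ (closed e Fe)) cq))))

  -- Nonbipartite blocks when degrees are at most three

  module BlockAnalysis (degree≤3 : ∀ v → degree G v ≤ 3)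
                     (cycle-edges : ∀ {t} c → OddCycle (Adj G) t c → suc (count (Matchings.Inside set⟦ c ⟧)) ≡ 4 * t)
                     (H : Subgraph G) (block : Block G H) where
    open Matchings
    open Degrees
    open Neighbours
    open Components
    open Paths
    open PentagonBlocks H
    open Subgraph H

    record Result : Set where
      constructor result
      field
        shape : BipartiteSub G H ⊎ IsoTo G H 3 K3-adj ⊎ IsoTo G H 4 K4-adj ⊎ IsoTo G H 4 K112-adj ⊎ IsoTo G H 5 C5′-adj

    connected : ∀ u v → S u ≡ true → S v ≡ true → Reach G S F u v
    connected = proj₂ (proj₁ (proj₁ block))

    uncut : ∀ x → ¬ CutVertex G H x
    uncut = proj₂ (proj₁ block)

    F⇒inside : ∀ e → F e ≡ true → Inside S e ≡ true
    F⇒inside e Fe = let (a , b) = closed e Fe in ∧-intro a b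

    -- Adding all edges between the vertices of a biconnected subgraph keeps it biconnected, so by
    -- maximality a block is induced.
    inside⇒F : ∀ e → Inside S e ≡ true → F e ≡ true
    inside⇒F = proj₂ (proj₂ block (induced S) (conn⁺ , uncut⁺) ((λ _ t → t) , F⇒inside))
      where
      conn⁺ : ConnectedSub G (induced S)
      conn⁺ = proj₁ (proj₁ (proj₁ block)) , λ u v Su Sv → reach-mono (λ _ t → t) F⇒inside (connected u v Su Sv)
      uncut⁺ : ∀ x → ¬ CutVertex G (induced S) x
      uncut⁺ x (Sx , u , v , du , dv , ¬r) = uncut x (Sx , u , v , du , dv , λ r → ¬r (reach-mono (λ _ t → t)
        (λ e t → let (a , b) = deleteF-elim {F} {x} {e} t in deleteF-intro {Inside S} {x} {e} (F⇒inside e a) b) r))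

    adj⇒sadj : ∀ {u v} → S u ≡ true → S v ≡ true → Adj G u v → SAdj G F u v
    adj⇒sadj Su Sv (e , s) = e , inside⇒F e (⇒inside S λ e∋z → case same⇒only s e∋z of λ { (inj₁ refl) → Su ; (inj₂ refl) → Sv }) , s

    S-left : ∀ {u v} → SAdj G F u v → S u ≡ true
    S-left uv = proj₁ (sadj-ends uv)

    toAdj : ∀ {u v} → SAdj G F u v → Adj G u v
    toAdj = sadj⇒adj H

    sadj⇒≢ : ∀ {u v} → SAdj G F u v → u ≢ v
    sadj⇒≢ uv = adj⇒≢ (toAdj uv)

    around : ∀ x {u v} → S x ≡ true → S u ≡ true → S v ≡ true → u ≢ x → v ≢ x → Reach G (deleteS G S x) (deleteF G F x) u v
    around x {u} {v} Sx Su Sv u≢x v≢x with reach? (deleteS G S x) (deleteF G F x) v (deleteS-intro {S} Su u≢x)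
    ... | inj₁ r  = r
    ... | inj₂ ¬r = ⊥-elim (uncut x (Sx , u , v , deleteS-intro {S} Su u≢x , deleteS-intro {S} Sv v≢x , ¬r))

    undelete : ∀ {x u v} → SAdj G (deleteF G F x) u v → SAdj G F u v
    undelete {x} (e , t , s) = e , proj₁ (deleteF-elim {F} {x} {e} t) , s

    module Fives {g : Fin 5 → V} (pent : Pentagon g) where
      private module P = Pentagon pent

      cyc-adj : ∀ i → Adj G (g i) (g (next₅ i))
      cyc-adj i = toAdj (P.cycle i)

      Chord : Fin 5 → Set
      Chord i = Adj G (g i) (g (next₅ (next₅ i)))

      chord? : ∀ i → Dec (Chord i)
      chord? i = adj? (g i) (g (next₅ (next₅ i)))

      clash : ∀ i → Chord i → Chord (next₅ (next₅ i)) → ⊥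
      clash i ch ch′ = <⇒≱ (s≤s (degree≤3 (g (next₅ (next₅ i))))) (neighbours≤degree
        (List.map g (next₅ (next₅ (next₅ i)) ∷ next₅ i ∷ i ∷ next₅ (next₅ (next₅ (next₅ i))) ∷ []))
        (Uniqueₚ.map⁺ P.injective (four-neighbours i))
        (cyc-adj (next₅ (next₅ i)) ∷ cycle⁻ pent (next₅ i) ∷ adj-sym ch ∷ ch′ ∷ []))

      -- Eight is `4 * t` for `t = 2`, so the five vertices carry seven edges. Two indices of chords
      -- differ by one or by two, and a difference of two gives a vertex of degree four. Without
      -- consecutive chords there is thus at most one, and at most six edges.
      consecutive-chords : ∀ {c} → (∀ v → v ∈ c → ∃ λ i → g i ≡ v) → suc (count (Inside set⟦ c ⟧)) ≡ 8 → ∃ λ i → Chord i × Chord (next₅ i)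
      consecutive-chords {c} cover eight with Finₚ.any? (λ i → chord? i ×-dec chord? (next₅ i))
      ... | yes r = r
      ... | no none = ⊥-elim (<⇒≱ (n<1+n 6) (≤-trans (≤-reflexive (sym (suc-injective eight))) (too-few (Finₚ.any? chord?))))
        where
        chord-unique : ∀ {i j} → Chord i → Chord j → i ≡ j
        chord-unique {i} {j} ci cj with i Fin.≟ j
        ... | yes eq = eq
        ... | no i≢j with five-pairs i j i≢j
        ... | inj₁ (inj₁ refl) = ⊥-elim (none (i , ci , cj))
        ... | inj₁ (inj₂ refl) = ⊥-elim (none (j , cj , ci))
        ... | inj₂ (inj₁ refl) = ⊥-elim (clash i ci cj)
        ... | inj₂ (inj₂ refl) = ⊥-elim (clash j cj ci)
        cycle-edge : Fin 5 → E
        cycle-edge i = proj₁ (cyc-adj i)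
        bound : ∀ e* → (∀ {i e} → SameEnds (ends e) (g i , g (next₅ (next₅ i))) → e ≡ e*) → count (Inside set⟦ c ⟧) ≤ 6
        bound e* only = count≤length (Inside set⟦ c ⟧) (e* ∷ List.tabulate cycle-edge) λ e ins →
            locate e (cover (p e) (set⇒∈ c (inside⇒ set⟦ c ⟧ {e} ins (inj₁ refl)))) (cover (q e) (set⇒∈ c (inside⇒ set⟦ c ⟧ {e} ins (inj₂ refl))))
          where
          on-cycle : ∀ {e} i → SameEnds (ends e) (g i , g (next₅ i)) → e ∈ e* ∷ List.tabulate cycle-edge
          on-cycle i s = there (subst (_∈ List.tabulate cycle-edge) (same-unique (proj₂ (cyc-adj i)) s) (∈-tabulate⁺ {f = cycle-edge} i))
          locate : ∀ e → (∃ λ i → g i ≡ p e) → (∃ λ j → g j ≡ q e) → e ∈ e* ∷ List.tabulate cycle-edge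
          locate e (i , gi) (j , gj) with five-pairs i j (λ { refl → loopless e (trans (sym gi) gj) })
          ... | inj₁ (inj₁ refl) = on-cycle i (inj₁ (sym gi , sym gj))
          ... | inj₁ (inj₂ refl) = on-cycle j (inj₂ (sym gi , sym gj))
          ... | inj₂ (inj₁ refl) = here (only (inj₁ (sym gi , sym gj)))
          ... | inj₂ (inj₂ refl) = here (only (inj₂ (sym gi , sym gj)))
        too-few : Dec (∃ Chord) → count (Inside set⟦ c ⟧) ≤ 6
        too-few (yes (i , e , s)) = bound e λ {j} s′ → same-unique (subst (λ j → SameEnds _ (g j , g (next₅ (next₅ j)))) (chord-unique {j} {i} (_ , s′) (e , s)) s′) s
        -- With no chord at all, any cycle edge can fill the place reserved for one.
        too-few (no absent)       = bound (cycle-edge zero) λ {j} {e} s → ⊥-elim (absent (j , e , s))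

      isoC5′ : Adj G (g (# 1)) (g (# 3)) → Adj G (g (# 2)) (g (# 4)) → IsoTo G H 5 C5′-adj
      isoC5′ ch₁₃ ch₂₄ = isomorphism H C5′-adj g P.injective P.inS cover edges nonedges
        where
        around-i : ∀ i nb → Unique nb → All (λ j → Adj G (g i) (g j)) nb → 3 ≤ length nb → All (λ j → C5′-adj i j ≡ true) nb →
                   ∀ {u} → Adj G (g i) u → ∃ λ j → C5′-adj i j ≡ true × u ≡ g j
        around-i i nb unb as len table iu with index-neighbours g P.injective i nb unb as (≤-trans (degree≤3 (g i)) len) iu
        ... | j , j∈ , eq = j , All.lookup table j∈ , eq
        neighbours : ∀ i → i ≢ zero → ∀ {u} → Adj G (g i) u → ∃ λ j → C5′-adj i j ≡ true × u ≡ g j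
        neighbours zero i≢0 = ⊥-elim (i≢0 refl)
        neighbours (suc zero) _ = around-i (# 1) (# 2 ∷ # 0 ∷ # 3 ∷ []) (from-yes (unique? {5} (# 2 ∷ # 0 ∷ # 3 ∷ [])))
          (cyc-adj (# 1) ∷ cycle⁻ pent (# 0) ∷ ch₁₃ ∷ []) ≤-refl (refl ∷ refl ∷ refl ∷ [])
        neighbours (suc (suc zero)) _ = around-i (# 2) (# 3 ∷ # 1 ∷ # 4 ∷ []) (from-yes (unique? {5} (# 3 ∷ # 1 ∷ # 4 ∷ [])))
          (cyc-adj (# 2) ∷ cycle⁻ pent (# 1) ∷ ch₂₄ ∷ []) ≤-refl (refl ∷ refl ∷ refl ∷ [])
        neighbours (suc (suc (suc zero))) _ = around-i (# 3) (# 4 ∷ # 2 ∷ # 1 ∷ []) (from-yes (unique? {5} (# 4 ∷ # 2 ∷ # 1 ∷ [])))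
          (cyc-adj (# 3) ∷ cycle⁻ pent (# 2) ∷ adj-sym ch₁₃ ∷ []) ≤-refl (refl ∷ refl ∷ refl ∷ [])
        neighbours (suc (suc (suc (suc zero)))) _ = around-i (# 4) (# 0 ∷ # 3 ∷ # 2 ∷ []) (from-yes (unique? {5} (# 0 ∷ # 3 ∷ # 2 ∷ [])))
          (cyc-adj (# 4) ∷ cycle⁻ pent (# 3) ∷ adj-sym ch₂₄ ∷ []) ≤-refl (refl ∷ refl ∷ refl ∷ [])
        -- Only g 0 has a neighbour outside the pentagon, so it would be a cut vertex.
        cover : ∀ u → S u ≡ true → ∃ λ i → g i ≡ u
        cover u Su with Finₚ.any? (λ i → g i Fin.≟ u)
        ... | yes r = r
        ... | no outside = let (i , _ , eq) = reach-closed {X = λ w → ∃ λ i → i ≢ zero × g i ≡ w} stay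
                                 (around (g zero) (P.inS zero) (P.inS (# 1)) Su (λ eq → case P.injective {# 1} {zero} eq of λ ()) (λ eq → outside (zero , sym eq)))
                                 (# 1 , (λ ()) , refl) in i , eq
          where
          stay : ∀ {w z} → (∃ λ i → i ≢ zero × g i ≡ w) → deleteS G S (g zero) z ≡ true → SAdj G (deleteF G F (g zero)) w z → ∃ λ i → i ≢ zero × g i ≡ z
          stay (i , i≢0 , refl) dz wz with neighbours i i≢0 (toAdj (undelete wz))
          ... | j , _ , eq = j , (λ { refl → proj₂ (deleteS-elim {S} dz) eq }) , sym eq
        edges : ∀ i j → C5′-adj i j ≡ true → SAdj G F (g i) (g j)
        edges i j t = pairs-adj {R = λ i j → SAdj G F (g i) (g j)} sadj-sym
          (P.cycle (# 0) ∷ P.cycle (# 1) ∷ P.cycle (# 2) ∷ P.cycle (# 3) ∷ P.cycle (# 4)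
            ∷ adj⇒sadj (P.inS (# 1)) (P.inS (# 3)) ch₁₃ ∷ adj⇒sadj (P.inS (# 2)) (P.inS (# 4)) ch₂₄ ∷ []) (C5′-covers i j t)
        from-nonzero : ∀ i j → i ≢ zero → Adj G (g i) (g j) → C5′-adj i j ≡ true
        from-nonzero i j i≢0 ij with neighbours i i≢0 ij
        ... | l , t , eq = subst (λ j → C5′-adj i j ≡ true) (sym (P.injective eq)) t
        nonedges : ∀ i j → i ≢ j → Adj G (g i) (g j) → C5′-adj i j ≡ true
        nonedges i j i≢j ij with i Fin.≟ zero
        ... | no i≢0   = from-nonzero i j i≢0 ij
        ... | yes refl = C5′-symmetric j zero (from-nonzero j zero (i≢j ∘ sym) (adj-sym ij))

    five : ∀ {c} → OddCycle (SAdj G F) 2 c → IsoTo G H 5 C5′-adj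
    five {c} cyc with pentagon-from cyc
    ... | g , pent , cover , _ with Fives.consecutive-chords pent {c} cover (cycle-edges c (cycle-map toAdj cyc))
    ... | i , ch , ch′ = Fives.isoC5′ (rotated i pent) ch ch′

    -- Degrees at most three give `2 * (4 * t - 1) ≤ 3 * (2 * t + 1)`, hence `2 * t ≤ 5`.
    short : ∀ {t c} → OddCycle (SAdj G F) t c → t ≤ 2
    short {t} {c} cyc = ≮⇒≥ λ t≥3 → <⇒≱ (n<1+n 5) (≤-trans (*-monoʳ-≤ 2 t≥3) (+-cancelˡ-≤ (6 * t) _ _ (begin
      6 * t + 2 * t                              ≡⟨ *-distribʳ-+ t 6 2 ⟨
      8 * t                                      ≡⟨ *-assoc 2 4 t ⟩
      2 * (4 * t)                                ≡⟨ cong (2 *_) (cycle-edges c (cycle-map toAdj cyc)) ⟨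
      2 * suc (count (Inside set⟦ c ⟧))          ≡⟨ *-suc 2 _ ⟩
      2 + 2 * count (Inside set⟦ c ⟧)            ≤⟨ +-monoʳ-≤ 2 (inside-degree set⟦ c ⟧ 3 λ v _ → degree≤3 v) ⟩
      2 + count set⟦ c ⟧ * 3                     ≤⟨ +-monoʳ-≤ 2 (*-monoˡ-≤ 3 (≤-trans (count-set≤ c) (≤-reflexive (cycle-length cyc)))) ⟩
      2 + suc (2 * t) * 3                        ≡⟨ lemma t ⟩
      6 * t + 5                                  ∎)))
      where
      open ≤-Reasoning
      lemma : ∀ t → 2 + suc (2 * t) * 3 ≡ 6 * t + 5
      lemma = ℕRing.solve-∀

    long-cycle : ∀ {t c} → OddCycle (SAdj G F) t c → 2 ≤ t → Result
    long-cycle {c = c} cyc t≥2 = result (inj₂ (inj₂ (inj₂ (inj₂ (five (subst (λ t → OddCycle (SAdj G F) t c) (≤-antisym (short cyc) t≥2) cyc))))))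

    -- `x ∷ xs` is an ear from `a` to `b`, and `W` leads back from `b` to `a` through old vertices;
    -- the choice of `W` adjusts the parity.
    make-cycle : ∀ {a x xs b W} t → SAdj G F a x → Chain (SAdj G F) x xs b → Chain (SAdj G F) b W a → Unique (a ∷ b ∷ W) → Unique (x ∷ xs) →
                 (∀ {z} → z ∈ x ∷ xs → z ∉ a ∷ b ∷ W) → suc (length xs + suc (length W)) ≡ 2 * t →
                 OddCycle (SAdj G F) t (a ∷ x ∷ xs ++ b ∷ W)
    make-cycle {a} {x} {xs} {b} {W} t ax c d (a∉ ∷ uW) uP out len = oddCycle
      (unique-∷ a∉′ (unique-++⁺ uP uW λ z∈ → out z∈ ∘ there)) (ax , chain-join xs c d) (trans (cong suc (Listₚ.length-++ xs)) len)
      where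
      a∉′ : a ∉ x ∷ xs ++ b ∷ W
      a∉′ a∈ with ∈-++⁻ (x ∷ xs) a∈
      ... | inj₁ a∈P = out a∈P (here refl)
      ... | inj₂ a∈W = All.lookup a∉ a∈W refl

    full₃ : ∀ {v} L → Unique L → All (Adj G v) L → 3 ≤ length L → ∀ {u} → Adj G v u → u ∈ L
    full₃ {v} L u as len = no-more-neighbours L u as (≤-trans (degree≤3 v) len)

    all-in? : ∀ L → (∃ λ y → S y ≡ true × y ∉ L) ⊎ (∀ u → S u ≡ true → u ∈ L)
    all-in? L with Finₚ.any? (λ y → true? (S y) ×-dec ¬? (y ∈? L))
    ... | yes r   = inj₁ r
    ... | no none = inj₂ λ u Su → decidable-stable (u ∈? L) λ u∉ → none (u , Su , u∉)

    index-of : ∀ {L : List V} {u} → u ∈ L → ∃ λ i → List.lookup L i ≡ u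
    index-of u∈ = Any.index u∈ , sym (Anyₚ.lookup-index u∈)

    -- a and b are the two adjacent vertices of degree 3 of a copy of K_{1,1,2}.
    module Diamond {a b c x : V} (ab : SAdj G F a b) (ac : SAdj G F a c) (bc : SAdj G F b c)
                   (ax : SAdj G F a x) (bx : SAdj G F b x) (c≢x : c ≢ x) where
      L : List V
      L = a ∷ b ∷ c ∷ x ∷ []
      uniqueL : Unique L
      uniqueL = (sadj⇒≢ ab ∷ sadj⇒≢ ac ∷ sadj⇒≢ ax ∷ []) ∷ (sadj⇒≢ bc ∷ sadj⇒≢ bx ∷ []) ∷ (c≢x ∷ []) ∷ [] ∷ []
      full-a : ∀ {u} → Adj G a u → u ∈ b ∷ c ∷ x ∷ []
      full-a = full₃ (b ∷ c ∷ x ∷ []) ((sadj⇒≢ bc ∷ sadj⇒≢ bx ∷ []) ∷ (c≢x ∷ []) ∷ [] ∷ []) (toAdj ab ∷ toAdj ac ∷ toAdj ax ∷ []) ≤-refl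
      full-b : ∀ {u} → Adj G b u → u ∈ a ∷ c ∷ x ∷ []
      full-b = full₃ (a ∷ c ∷ x ∷ []) ((sadj⇒≢ ac ∷ sadj⇒≢ ax ∷ []) ∷ (c≢x ∷ []) ∷ [] ∷ []) (adj-sym (toAdj ab) ∷ toAdj bc ∷ toAdj bx ∷ []) ≤-refl

      insert-b : ∀ {u} → u ∈ a ∷ c ∷ x ∷ [] → u ∈ L
      insert-b (here eq)  = here eq
      insert-b (there u∈) = there (there u∈)

      inL : ∀ i → S (List.lookup L i) ≡ true
      inL zero                   = S-left ab
      inL (suc zero)             = S-left bc
      inL (suc (suc zero))       = proj₂ (sadj-ends ac)
      inL (suc (suc (suc zero))) = proj₂ (sadj-ends ax)

      nonedges : ¬ Adj G c x → ∀ i j → i ≢ j → Adj G (List.lookup L i) (List.lookup L j) → K112-adj i j ≡ true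
      nonedges ¬cx i j i≢j ij = [ id , (λ { (inj₁ (refl , refl)) → ⊥-elim (¬cx ij) ; (inj₂ (refl , refl)) → ⊥-elim (¬cx (adj-sym ij)) }) ]′
        (K112-missing i j i≢j)

      whole-block : (∀ u → S u ≡ true → u ∈ L) → Dec (Adj G c x) → Result
      whole-block cover (yes cx) = result (inj₂ (inj₂ (inj₁ (isomorphism H K4-adj (List.lookup L) (lookup-injective uniqueL _ _) inL (λ u Su → index-of (cover u Su))
        (λ i j t → pairs-adj {R = λ i j → SAdj G F (List.lookup L i) (List.lookup L j)} sadj-sym
          (adj⇒sadj (inL (# 2)) (inL (# 3)) cx ∷ ab ∷ ac ∷ ax ∷ bc ∷ bx ∷ []) (K4-covers i j t)) (λ i j i≢j _ → K4-complete i j i≢j)))))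
      whole-block cover (no ¬cx) = result (inj₂ (inj₂ (inj₂ (inj₁ (isomorphism H K112-adj (List.lookup L) (lookup-injective uniqueL _ _) inL (λ u Su → index-of (cover u Su))
        (λ i j t → pairs-adj {R = λ i j → SAdj G F (List.lookup L i) (List.lookup L j)} sadj-sym
          (ab ∷ ac ∷ ax ∷ bc ∷ bx ∷ []) (K112-covers i j t)) (nonedges ¬cx))))))

      -- An ear at c must end in x and closes up to an odd cycle of length at least 5.
      ear : ∀ z → z ∉ L → SAdj G F c z → Result
      ear z z∉ cz = follow (first-hit (a ∷ b ∷ x ∷ []) (around c (S-left cz) (proj₂ (sadj-ends cz)) (proj₂ (sadj-ends ax))
                       (sadj⇒≢ cz ∘ sym) (c≢x ∘ sym)) z∉abx (there (there (here refl))))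
        where
        z∉abx : z ∉ a ∷ b ∷ x ∷ []
        z∉abx (here eq)                 = z∉ (here eq)
        z∉abx (there (here eq))         = z∉ (there (here eq))
        z∉abx (there (there (here eq))) = z∉ (there (there (there (here eq))))
        last-outside : ∀ {y} zs → (∀ {w} → w ∈ z ∷ zs → w ∉ L) → Chain (SAdj G F) z zs y → ∃ λ w → w ∉ L × SAdj G F w y
        last-outside []       h zy = z , h (here refl) , zy
        last-outside (w ∷ ws) h ch = let (ys , w′ , eq , r) = chain-last w ws ch in
          w′ , h (there (subst (w′ ∈_) (sym eq) (∈-++⁺ʳ ys (here refl)))) , r
        closes : ∀ xs → Unique (z ∷ xs) → (∀ {w} → w ∈ z ∷ xs → w ∉ L) → Chain (SAdj G F) z xs x →
                 (∃ λ s → length xs ≡ 2 * s ⊎ length xs ≡ suc (2 * s)) → Result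
        closes xs uniq outside ch (s , inj₂ odd) = long-cycle (make-cycle (suc (suc s)) cz ch (sadj-sym ax , ac)
            ((c≢x ∷ (sadj⇒≢ ac ∘ sym) ∷ []) ∷ ((sadj⇒≢ ax ∘ sym) ∷ []) ∷ [] ∷ []) uniq
            (λ { w∈ (here eq) → outside w∈ (there (there (here eq))) ; w∈ (there (here eq)) → outside w∈ (there (there (there (here eq))))
               ; w∈ (there (there (here eq))) → outside w∈ (here eq) })
            (trans (cong (λ l → suc (l + 2)) odd) (ear-odd s))) (s≤s (s≤s z≤n))
        closes xs uniq outside ch (s , inj₁ even) = long-cycle (make-cycle (suc (suc s)) cz ch (sadj-sym ax , ab , bc)
            ((c≢x ∷ (sadj⇒≢ ac ∘ sym) ∷ (sadj⇒≢ bc ∘ sym) ∷ []) ∷ ((sadj⇒≢ ax ∘ sym) ∷ (sadj⇒≢ bx ∘ sym) ∷ []) ∷ (sadj⇒≢ ab ∷ []) ∷ [] ∷ []) uniq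
            (λ { w∈ (here eq) → outside w∈ (there (there (here eq))) ; w∈ (there (here eq)) → outside w∈ (there (there (there (here eq))))
               ; w∈ (there (there (here eq))) → outside w∈ (here eq) ; w∈ (there (there (there (here eq)))) → outside w∈ (there (here eq)) })
            (trans (cong (λ l → suc (l + 3)) even) (ear-even s))) (s≤s (s≤s z≤n))
        ends-in : ∀ {y} xs → y ∈ a ∷ b ∷ x ∷ [] → Unique (z ∷ xs) → (∀ {w} → w ∈ z ∷ xs → w ∉ L) → Chain (SAdj G F) z xs y → Result
        ends-in xs (here refl) _ outside ch = let (w , w∉ , wa) = last-outside xs outside ch in
          ⊥-elim (w∉ (there (full-a (adj-sym (toAdj wa)))))
        ends-in xs (there (here refl)) _ outside ch = let (w , w∉ , wb) = last-outside xs outside ch in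
          ⊥-elim (w∉ (insert-b (full-b (adj-sym (toAdj wb)))))
        ends-in xs (there (there (here refl))) uniq outside ch = closes xs uniq outside ch (halve (length xs))
        follow : FirstHit (deleteS G S c) (deleteF G F c) (a ∷ b ∷ x ∷ []) z → Result
        follow (firstHit {xs} y∈ uniq out chain) = ends-in xs y∈ uniq outside (chain-map (undelete {c}) xs chain)
          where
          outside : ∀ {w} → w ∈ z ∷ xs → w ∉ L
          outside w∈ (here eq)                         = proj₁ (out w∈) (here eq)
          outside w∈ (there (here eq))                 = proj₁ (out w∈) (there (here eq))
          outside w∈ (there (there (here eq)))         = proj₂ (deleteS-elim {S} (proj₂ (out w∈))) eq
          outside w∈ (there (there (there (here eq)))) = proj₁ (out w∈) (there (there (here eq)))

    diamond : ∀ {a b c x} → SAdj G F a b → SAdj G F a c → SAdj G F b c → SAdj G F a x → SAdj G F b x → c ≢ x → Result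
    diamond {a} {b} {c} {x} ab ac bc ax bx c≢x = [ (λ (y , Sy , y∉) → grow (crossing L (connected y a Sy (S-left ab)) y∉ (here refl)))
        , (λ cover → whole-block cover (adj? c x)) ]′ (all-in? L)
      where
      open Diamond ab ac bc ax bx c≢x
      grow : (∃₂ λ z y → z ∉ L × y ∈ L × SAdj G F z y) → Result
      grow (z , _ , z∉ , here refl , za)                         = ⊥-elim (z∉ (there (full-a (adj-sym (toAdj za)))))
      grow (z , _ , z∉ , there (here refl) , zb)                 = ⊥-elim (z∉ (insert-b (full-b (adj-sym (toAdj zb)))))
      grow (z , _ , z∉ , there (there (here refl)) , zc)         = ear z z∉ (sadj-sym zc)
      -- The ear leaves from the other tip, so `c` and `x` exchange their roles.
      grow (z , _ , z∉ , there (there (there (here refl))) , zx) = Diamond.ear ab ax bx ac bc (c≢x ∘ sym) z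
        (λ { (here eq) → z∉ (here eq) ; (there (here eq)) → z∉ (there (here eq)) ; (there (there (here eq))) → z∉ (there (there (there (here eq))))
           ; (there (there (there (here eq)))) → z∉ (there (there (here eq))) }) (sadj-sym zx)

    -- The ear from `a` returns at `b` or `c`. If `x` is its only vertex, a diamond arises.
    -- Otherwise the ear is closed either directly or through the third vertex of the triangle,
    -- whichever makes the cycle odd, and that cycle has at least five vertices.
    triangle-ear : ∀ {a b c x} → SAdj G F a b → SAdj G F b c → SAdj G F a c → x ∉ a ∷ b ∷ c ∷ [] → SAdj G F a x → Result
    triangle-ear {a} {b} {c} {x} ab bc ac x∉ ax = follow (first-hit (b ∷ c ∷ []) (around a (S-left ab) (proj₂ (sadj-ends ax)) (S-left bc)
                                                    (sadj⇒≢ ax ∘ sym) (sadj⇒≢ ab ∘ sym)) (x∉ ∘ there) (here refl))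
      where
      close : ∀ {b c} xs → SAdj G F a b → SAdj G F b c → SAdj G F a c → Unique (x ∷ xs) → (∀ {w} → w ∈ x ∷ xs → w ∉ a ∷ b ∷ c ∷ []) →
              Chain (SAdj G F) x xs b → (∃ λ s → length xs ≡ 2 * s ⊎ length xs ≡ suc (2 * s)) → Result
      close [] ab bc ac uniq out xb _ = diamond ab ac bc ax (sadj-sym xb) λ { refl → out (here refl) (there (there (here refl))) }
      close (w ∷ ws) ab bc ac uniq out ch (zero , inj₁ ())
      close (w ∷ ws) ab bc ac uniq out ch (suc s , inj₁ even) = long-cycle (make-cycle (suc (suc s)) ax ch (sadj-sym ab)
        ((sadj⇒≢ ab ∷ []) ∷ [] ∷ []) uniq (λ { w∈ (here eq) → out w∈ (here eq) ; w∈ (there (here eq)) → out w∈ (there (here eq)) })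
        (trans (cong (λ l → suc (l + 1)) even) (ear-chord s))) (s≤s (s≤s z≤n))
      close (w ∷ ws) ab bc ac uniq out ch (s , inj₂ odd) = long-cycle (make-cycle (suc (suc s)) ax ch (bc , sadj-sym ac)
        ((sadj⇒≢ ab ∷ sadj⇒≢ ac ∷ []) ∷ (sadj⇒≢ bc ∷ []) ∷ [] ∷ []) uniq out (trans (cong (λ l → suc (l + 2)) odd) (ear-odd s))) (s≤s (s≤s z≤n))
      hit : ∀ {y} xs → y ∈ b ∷ c ∷ [] → Unique (x ∷ xs) → (∀ {w} → w ∈ x ∷ xs → w ∉ a ∷ b ∷ c ∷ []) → Chain (SAdj G F) x xs y → Result
      hit xs (here refl)         uniq outside ch = close xs ab bc ac uniq outside ch (halve (length xs))
      hit xs (there (here refl)) uniq outside ch = close xs ac (sadj-sym bc) ab uniq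
        (λ { w∈ (here eq) → outside w∈ (here eq) ; w∈ (there (here eq)) → outside w∈ (there (there (here eq))) ; w∈ (there (there (here eq))) → outside w∈ (there (here eq)) })
        ch (halve (length xs))
      follow : FirstHit (deleteS G S a) (deleteF G F a) (b ∷ c ∷ []) x → Result
      follow (firstHit {xs} y∈ uniq out chain) = hit xs y∈ uniq
        (λ { w∈ (here eq) → proj₂ (deleteS-elim {S} (proj₂ (out w∈))) eq ; w∈ (there w∈′) → proj₁ (out w∈) w∈′ }) (chain-map (undelete {a}) xs chain)

    triangle-case : ∀ {a b c} → SAdj G F a b → SAdj G F b c → SAdj G F a c → Result
    triangle-case {a} {b} {c} ab bc ac = [ (λ (y , Sy , y∉) → grow (crossing L (connected y a Sy (S-left ab)) y∉ (here refl)))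
        , (λ cover → result (inj₂ (inj₁ (isomorphism H K3-adj (List.lookup L)
            (lookup-injective ((sadj⇒≢ ab ∷ sadj⇒≢ ac ∷ []) ∷ (sadj⇒≢ bc ∷ []) ∷ [] ∷ []) _ _) inL (λ u Su → index-of (cover u Su))
            (λ i j t → pairs-adj {R = λ i j → SAdj G F (List.lookup L i) (List.lookup L j)} sadj-sym (ab ∷ ac ∷ bc ∷ []) (K3-covers i j t))
            (λ i j i≢j _ → K3-complete i j i≢j))))) ]′ (all-in? L)
      where
      L : List V
      L = a ∷ b ∷ c ∷ []
      inL : ∀ i → S (List.lookup L i) ≡ true
      inL zero             = S-left ab
      inL (suc zero)       = S-left bc
      inL (suc (suc zero)) = proj₂ (sadj-ends bc)
      grow : (∃₂ λ x y → x ∉ L × y ∈ L × SAdj G F x y) → Result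
      grow (x , _ , x∉ , here refl , xa)                 = triangle-ear ab bc ac x∉ (sadj-sym xa)
      grow (x , _ , x∉ , there (here refl) , xb)         = triangle-ear bc (sadj-sym ac) (sadj-sym ab) (x∉ ∘ ∈-swap (b ∷ c ∷ []) (a ∷ [])) (sadj-sym xb)
      grow (x , _ , x∉ , there (there (here refl)) , xc) = triangle-ear (sadj-sym ac) ab (sadj-sym bc) (x∉ ∘ ∈-swap (c ∷ []) (a ∷ b ∷ [])) (sadj-sym xc)

    analyse : Result
    analyse = [ result ∘ inj₁ , from-cycle ]′ (Colouring.bipartite-or-cycle H (proj₁ (proj₁ block)))
      where
      from-cycle : ∃₂ (OddCycle (SAdj G F)) → Result
      from-cycle (0 , _ , oddCycle {A = []} _ aa _)                        = ⊥-elim (sadj⇒≢ aa refl)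
      from-cycle (1 , _ , oddCycle {A = _ ∷ _ ∷ []} _ (ab , bc , ca) _) = triangle-case ab bc (sadj-sym ca)
      from-cycle (suc (suc t) , c , cyc)                                   = long-cycle cyc (s≤s (s≤s z≤n))

  -- Removing chords from odd cycles

  module Chordless where
    open Matchings
    open Degrees

    Shorter : ℕ → Set
    Shorter t = ∃₂ λ t′ c → OddCycle (Adj G) t′ c × t′ < t

    -- From `|A| + 1 + |B| = 2 * t`, exactly one of the arcs has an odd number of inner vertices.
    -- Together with the chord it forms an odd cycle, shorter because the other arc is not empty.
    shorten : ∀ {t a} A {b} B → OddCycle (Adj G) t (a ∷ A ++ b ∷ B) → Adj G a b → 1 ≤ length A → 1 ≤ length B → Shorter t
    shorten {t} {a} A {b} B (oddCycle (a∉ ∷ uniq) chain len) ab A≥1 B≥1 = pick (halve (length A)) (halve (length B))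
      where
      uniqs = unique-++⁻ A uniq
      chains = chain-split A chain
      lens : length A + suc (length B) ≡ 2 * t
      lens = trans (sym (Listₚ.length-++ A)) len
      pick : (∃ λ h → length A ≡ 2 * h ⊎ length A ≡ suc (2 * h)) → (∃ λ h → length B ≡ 2 * h ⊎ length B ≡ suc (2 * h)) → Shorter t
      pick (h , inj₂ odd) _ = suc h , a ∷ A ++ b ∷ [] , oddCycle
          (unique-∷ a∉′ (unique-++⁺ (proj₁ uniqs) ([] ∷ []) λ { u∈ (here refl) → proj₂ (proj₂ uniqs) u∈ (here refl) }))
          (chain-join A (proj₁ chains) (adj-sym ab)) (trans (Listₚ.length-++ A) (trans (cong (_+ 1) odd) (lemma h)))
        , *-cancelˡ-< 2 (suc h) t (≤-trans (≤-reflexive (bound h)) (≤-trans (+-monoʳ-≤ (suc (2 * h)) (s≤s B≥1))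
            (≤-reflexive (trans (cong (_+ suc (length B)) (sym odd)) lens))))
        where
        a∉′ : a ∉ A ++ b ∷ []
        a∉′ a∈ with ∈-++⁻ A a∈
        ... | inj₁ a∈A         = All.lookup a∉ (∈-++⁺ˡ a∈A) refl
        ... | inj₂ (here refl) = All.lookup a∉ (∈-++⁺ʳ A (here refl)) refl
        lemma : ∀ h → suc (2 * h) + 1 ≡ 2 * suc h
        lemma = ℕRing.solve-∀
        bound : ∀ h → suc (2 * suc h) ≡ suc (2 * h) + 2
        bound = ℕRing.solve-∀
      pick (i , inj₁ even) (h , inj₂ odd) = suc h , b ∷ B ++ a ∷ [] , oddCycle
          (unique-∷ b∉′ (unique-++⁺ uniqB ([] ∷ []) λ { u∈ (here refl) → All.lookup a∉ (∈-++⁺ʳ A (there u∈)) refl }))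
          (chain-join B (proj₂ chains) ab) (trans (Listₚ.length-++ B) (trans (cong (_+ 1) odd) (lemma h)))
        , *-cancelˡ-< 2 (suc h) t (≤-trans (≤-reflexive (bound h)) (≤-trans (+-monoˡ-≤ (suc (suc (2 * h))) A≥1)
            (≤-reflexive (trans (cong (λ l → length A + suc l) (sym odd)) lens))))
        where
        uniqB : Unique B
        uniqB with proj₁ (proj₂ uniqs)
        ... | _ ∷ u = u
        b∉′ : b ∉ B ++ a ∷ []
        b∉′ b∈ with ∈-++⁻ B b∈
        ... | inj₁ b∈B         = unique-head (proj₁ (proj₂ uniqs)) b∈B
        ... | inj₂ (here refl) = All.lookup a∉ (∈-++⁺ʳ A (here refl)) refl
        lemma : ∀ h → suc (2 * h) + 1 ≡ 2 * suc h
        lemma = ℕRing.solve-∀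
        bound : ∀ h → suc (2 * suc h) ≡ 1 + suc (suc (2 * h))
        bound = ℕRing.solve-∀
      pick (i , inj₁ even) (h , inj₁ even′) = ⊥-elim (even≢odd t (i + h) (trans (sym lens) (trans (cong₂ (λ x y → x + suc y) even even′) (lemma i h))))
        where
        lemma : ∀ i h → 2 * i + suc (2 * h) ≡ suc (2 * (i + h))
        lemma = ℕRing.solve-∀

    -- A third inner edge at `v` ends neither at the successor nor at the predecessor of `v`, so it
    -- is a chord with two nonempty arcs.
    cycle-degree : ∀ {t} c → OddCycle (Adj G) t c → ∀ v → v ∈ c → degIn (Inside set⟦ c ⟧) v ≡ 2 ⊎ Shorter t
    cycle-degree {t} c cyc v v∈ with ∈-split v∈
    ... | P , D , refl = at-head D P (λ u∈ → ∈-swap (v ∷ D) P u∈) (λ u∈ → ∈-swap P (v ∷ D) u∈) (rotate P cyc)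
      where
      X : E → Bool
      X = Inside set⟦ c ⟧
      at-head : ∀ D P → (∀ {u} → u ∈ v ∷ D ++ P → u ∈ c) → (∀ {u} → u ∈ c → u ∈ v ∷ D ++ P) → OddCycle (Adj G) t (v ∷ D ++ P) →
                degIn X v ≡ 2 ⊎ Shorter t
      at-head D P to from cyc = go (D ++ P) to from cyc
        where
        go : ∀ D → (∀ {u} → u ∈ v ∷ D → u ∈ c) → (∀ {u} → u ∈ c → u ∈ v ∷ D) → OddCycle (Adj G) t (v ∷ D) → degIn X v ≡ 2 ⊎ Shorter t
        go [] to from (oddCycle _ (e , s) _) = ⊥-elim (same⇒≢ s refl)
        go (y ∷ []) to from (oddCycle _ _ len) = ⊥-elim (even≢odd t 0 (sym len))
        go (y ∷ y′ ∷ D) to from cyc@(oddCycle (v∉ ∷ y∉ ∷ _) ((e , s) , chain) len) with chain-last y′ D chain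
        ... | ys , z , eq , (e′ , s′) = decide (Finₚ.any? λ d → (X d Bool.≟ true) ×-dec (d ∋? v) ×-dec ¬? (d ∈? e ∷ e′ ∷ []))
          where
          z∈ : z ∈ y′ ∷ D
          z∈ = subst (z ∈_) (sym eq) (∈-++⁺ʳ ys (here refl))
          inX : ∀ {d x} → SameEnds (ends d) (v , x) → x ∈ v ∷ y ∷ y′ ∷ D → X d ≡ true
          inX s x∈ = ⇒inside set⟦ c ⟧ λ d∋u → ∈⇒set c (case same⇒only s d∋u of λ { (inj₁ refl) → to (here refl) ; (inj₂ refl) → to x∈ })
          e≢e′ : e ≢ e′
          e≢e′ refl with same⇒only s (proj₁ (same⇒∋ s′))
          ... | inj₁ refl = All.lookup v∉ (there z∈) refl
          ... | inj₂ refl = All.lookup y∉ z∈ refl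
          decide : Dec (∃ λ d → X d ≡ true × d ∋ v × d ∉ e ∷ e′ ∷ []) → degIn X v ≡ 2 ⊎ Shorter t
          decide (no none) = inj₁ (count-list (λ d → X d ∧ incident? G d v) (e ∷ e′ ∷ []) ((e≢e′ ∷ []) ∷ [] ∷ [])
            (∧-intro (inX s (there (here refl))) (∋⇒incident (proj₁ (same⇒∋ s)))
              ∷ ∧-intro (inX (same-sym s′) (there (there z∈))) (∋⇒incident (proj₂ (same⇒∋ s′))) ∷ []) cover)
            where
            cover : ∀ d → X d ∧ incident? G d v ≡ true → d ∈ e ∷ e′ ∷ []
            cover d td with d ∈? e ∷ e′ ∷ []
            ... | yes d∈ = d∈
            ... | no d∉  = let (a , b) = ∧-elim (X d) td in ⊥-elim (none (d , a , incident⇒∋ b , d∉))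
          decide (yes (d , Xd , d∋v , d∉)) with other d∋v
          ... | u , d∋u , v≢u , _ with from (set⇒∈ c (inside⇒ set⟦ c ⟧ {d} Xd d∋u))
          ... | here u≡v = ⊥-elim (v≢u (sym u≡v))
          ... | there u∈ with ∈-split u∈
          ... | [] , B , refl = ⊥-elim (d∉ (here (same-unique (sameEnds d∋v d∋u v≢u) s)))
          ... | x ∷ A , [] , eq′ = ⊥-elim (d∉ (there (here (same-unique (sameEnds d∋v d∋u v≢u)
                  (subst (λ z → SameEnds (ends e′) (v , z)) (Listₚ.∷ʳ-injectiveʳ (y ∷ ys) (x ∷ A) (trans (cong (y ∷_) (sym eq)) eq′)) (same-sym s′))))))
          ... | x ∷ A , w ∷ B , eq′ = inj₂ (shorten (x ∷ A) (w ∷ B) (subst (λ L → OddCycle (Adj G) t (v ∷ L)) eq′ cyc)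
                  (adj-edge d∋v d∋u v≢u) (s≤s z≤n) (s≤s z≤n))

    -- Once all inner degrees on the cycle are two, the handshake equates edges and vertices; until
    -- then the cycle can be shortened, and `k` bounds how often.
    chordless : ∀ k {t c} → OddCycle (Adj G) t c → t ≤ k → ∃₂ λ t c → OddCycle (Adj G) t c × count (Inside set⟦ c ⟧) ≡ suc (2 * t)
    chordless k {t} {c} cyc t≤k with Finₚ.any? (λ v → (v ∈? c) ×-dec ¬? (degIn (Inside set⟦ c ⟧) v ≟ 2))
    ... | no none = t , c , cyc , *-cancelˡ-≡ _ _ 2 (begin
        2 * count (Inside set⟦ c ⟧)                               ≡⟨ handshake-inside set⟦ c ⟧ (Inside set⟦ c ⟧) (λ _ x → x) ⟨
        sum (λ v → set⟦ c ⟧ v ⊙ degIn (Inside set⟦ c ⟧) v)        ≡⟨ sum-cong-≗ pointwise ⟩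
        sum (λ v → 2 * b2n (set⟦ c ⟧ v))                          ≡⟨ *-distribˡ-sum 2 (λ v → b2n (set⟦ c ⟧ v)) ⟨
        2 * count set⟦ c ⟧                                        ≡⟨ cong (2 *_) (trans (count-set c (cycle-unique cyc)) (cycle-length cyc)) ⟩
        2 * suc (2 * t)                                           ∎)
      where
      open ≡-Reasoning
      pointwise : ∀ v → set⟦ c ⟧ v ⊙ degIn (Inside set⟦ c ⟧) v ≡ 2 * b2n (set⟦ c ⟧ v)
      pointwise v with set⟦ c ⟧ v in eq
      ... | false = refl
      ... | true  = decidable-stable (degIn (Inside set⟦ c ⟧) v ≟ 2) λ bad → none (v , set⇒∈ c eq , bad)
    chordless k {t} {c} cyc t≤k | yes (v , v∈ , bad) with cycle-degree c cyc v v∈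
    ... | inj₁ two = ⊥-elim (bad two)
    chordless zero    {t} cyc t≤k | yes _ | inj₂ (t′ , c′ , cyc′ , lt) = contradiction (≤-trans lt t≤k) λ ()
    chordless (suc k) {t} cyc t≤k | yes _ | inj₂ (t′ , c′ , cyc′ , lt) = chordless k cyc′ (≤-pred (≤-trans lt t≤k))

  -- Rigidity of stars at essential vertices

  module Stars where
    open Matchings
    open Degrees
    open Swapping using (not-in)
    open Components using (reach-closed)

    Disjoint : E → E → Set
    Disjoint e g = ∀ u → e ∋ u → ¬ g ∋ u

    disjoint? : ∀ e g → Dec (Disjoint e g)
    disjoint? e g = Finₚ.all? λ u → (e ∋? u) →-dec ¬? (g ∋? u)

    meeting : ∀ {e g} → ¬ Disjoint e g → g ∋ p e ⊎ g ∋ q e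
    meeting {e} {g} meet with g ∋? p e | g ∋? q e
    ... | yes a | _     = inj₁ a
    ... | _     | yes b = inj₂ b
    ... | no a  | no b  = ⊥-elim (meet λ { u (inj₁ refl) → a ; u (inj₂ refl) → b })

    -- The three kinds of essential vertices are those that allow this. An isolated edge is all of
    -- the connected graph, so no `e` off `v` exists. At degree two, if both edges met `e`, then `e`
    -- would join the neighbours. At degree three or more, at most two edges at `v` can meet `e`.
    avoiding-edge : Connected G → ∀ v → Essential G v → ∀ e → ¬ e ∋ v → ∃ λ g → g ∋ v × Disjoint e g
    avoiding-edge conn v ess e e∌v with Finₚ.any? (λ g → (g ∋? v) ×-dec disjoint? e g)
    ... | yes r = r
    ... | no none = ⊥-elim (impossible ess)
      where
      touches : ∀ {g} → g ∋ v → g ∋ p e ⊎ g ∋ q e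
      touches {g} g∋v = meeting {e} {g} λ d → none (g , g∋v , d)
      v≢ : ∀ {u} → e ∋ u → v ≢ u
      v≢ e∋u refl = e∌v e∋u
      impossible : Essential G v → ⊥
      impossible (inj₁ (deg , nbr)) with edge-at v (≤-reflexive (sym deg))
      ... | g , g∋v with other g∋v
      ... | u , g∋u , v≢u , only = stuck (reach-closed {X = λ w → w ≡ v ⊎ w ≡ u} closed (proj₂ conn v (p e) refl refl) (inj₁ refl))
        where
        only-u : ∀ {f} → f ∋ u → f ≡ g
        only-u f∋u with full (g ∷ []) ([] ∷ []) (g∋u ∷ []) (≤-reflexive (nbr u (adj-edge g∋v g∋u v≢u))) f∋u
        ... | here eq = eq
        only-v : ∀ {f} → f ∋ v → f ≡ g
        only-v f∋v with full (g ∷ []) ([] ∷ []) (g∋v ∷ []) (≤-reflexive deg) f∋v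
        ... | here eq = eq
        closed : ∀ {w z} → w ≡ v ⊎ w ≡ u → true ≡ true → SAdj G (const true) w z → z ≡ v ⊎ z ≡ u
        closed (inj₁ refl) _ (f , _ , s) with only-v (proj₁ (same⇒∋ s))
        ... | refl = only (proj₂ (same⇒∋ s))
        closed (inj₂ refl) _ (f , _ , s) with only-u (proj₁ (same⇒∋ s))
        ... | refl = only (proj₂ (same⇒∋ s))
        stuck : p e ≡ v ⊎ p e ≡ u → ⊥
        stuck (inj₁ eq) = e∌v (inj₁ eq)
        stuck (inj₂ eq) with only-u {e} (inj₁ eq)
        ... | refl = e∌v g∋v
      impossible (inj₂ (inj₁ (deg , open-nbhd))) with two-edges-at v (≤-reflexive (sym deg))
      ... | f , g , f∋v , g∋v , f≢g with touches f∋v | touches g∋v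
      ... | inj₁ a | inj₁ b = f≢g (unique-edge (v≢ (inj₁ refl)) f∋v a g∋v b)
      ... | inj₂ a | inj₂ b = f≢g (unique-edge (v≢ (inj₂ refl)) f∋v a g∋v b)
      ... | inj₁ a | inj₂ b = open-nbhd (p e) (q e) (adj-edge f∋v a (v≢ (inj₁ refl))) (adj-edge g∋v b (v≢ (inj₂ refl))) (loopless e) (e , inj₁ (refl , refl))
      ... | inj₂ a | inj₁ b = open-nbhd (q e) (p e) (adj-edge f∋v a (v≢ (inj₂ refl))) (adj-edge g∋v b (v≢ (inj₁ refl))) (loopless e ∘ sym) (e , inj₂ (refl , refl))
      impossible (inj₂ (inj₂ three)) = <⇒≱ three (≤-trans (≤-reflexive (degree≡count G v))
          (count≤length (λ g → incident? G g v) (to (p e) ∷ to (q e) ∷ []) cover))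
        where
        to : V → E
        -- The edge from `v` to `u`, with `e` as a placeholder if they are not adjacent.
        to u = [ proj₁ , (λ _ → e) ]′ (toSum (adj? v u))
        to-edge : ∀ {g u} → v ≢ u → g ∋ v → g ∋ u → g ≡ to u
        to-edge {g} {u} v≢u g∋v g∋u with adj? v u
        ... | yes (f , s) = unique-edge v≢u g∋v g∋u (proj₁ (same⇒∋ s)) (proj₂ (same⇒∋ s))
        ... | no ¬adj     = ⊥-elim (¬adj (adj-edge g∋v g∋u v≢u))
        cover : ∀ g → incident? G g v ≡ true → g ∈ to (p e) ∷ to (q e) ∷ []
        cover g t with touches (incident⇒∋ t)
        ... | inj₁ a = here (to-edge (v≢ (inj₁ refl)) (incident⇒∋ t) a)
        ... | inj₂ b = there (here (to-edge (v≢ (inj₂ refl)) (incident⇒∋ t) b))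

    single-star : ∀ {v} e → e ∋ v → wt (λ e → b2n (incident? G e v)) (set ∅ e) ≡ 1
    single-star {v} e e∋v = trans (wt-set star ∅ e refl) (cong₂ _+_ (cong b2n (∋⇒incident e∋v)) (wt-∅ star))
      where
      star : E → ℕ
      star e = b2n (incident? G e v)

    -- Single edges at `v` are tight, which equalises the values on the star. An edge off `v`
    -- together with a disjoint edge at `v` is tight as well, so its own value vanishes.
    star-rigid : Connected G → ∀ v → Essential G v → ∀ e₀ → e₀ ∋ v → ∀ z →
                 (∀ M → IsMatching G M → wt (λ e → b2n (incident? G e v)) M ≡ 1 → wtℤ z M ≡ wtℤ z (set ∅ e₀)) →
                 ∀ e → (incident? G e v ≡ true → z e ≡ z e₀) × (incident? G e v ≡ false → z e ≡ ℤ.0ℤ)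
    star-rigid conn v ess e₀ e₀∋v z const-z e = at-v ∘ incident⇒∋ , λ off → elsewhere (avoiding-edge conn v ess e (not-at off))
      where
      star : E → ℕ
      star e = b2n (incident? G e v)
      not-at : incident? G e v ≡ false → ¬ e ∋ v
      not-at off e∋v = case trans (sym off) (∋⇒incident e∋v) of λ ()
      at-v : ∀ {g} → g ∋ v → z g ≡ z e₀
      at-v {g} g∋v = trans (sym (wtℤ-single z g)) (trans (const-z (set ∅ g) (singleton-matching g) (single-star g g∋v)) (wtℤ-single z e₀))
      elsewhere : (∃ λ g → g ∋ v × Disjoint e g) → z e ≡ ℤ.0ℤ
      elsewhere (g , g∋v , disj) = add-zero (trans (sym pair-z) (trans (const-z pair pair-matching pair-tight) (wtℤ-single z e₀)))
        where
        misses-g : ∀ {u} → e ∋ u → Misses (set ∅ g) u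
        misses-g {u} e∋u f t = [ (λ { refl → disj u e∋u }) , (λ ()) ]′ (set-⊆ ∅ g t)
        fresh : set ∅ g e ≡ false
        fresh = not-in (misses-g (inj₁ refl)) (inj₁ refl)
        pair : E → Bool
        pair = set (set ∅ g) e
        pair-matching : IsMatching G pair
        pair-matching = matching-set (singleton-matching g) misses-g
        pair-tight : wt star pair ≡ 1
        pair-tight = trans (wt-set star (set ∅ g) e fresh)
          (cong₂ _+_ (cong b2n (¬-not λ t → disj v (incident⇒∋ t) g∋v)) (single-star g g∋v))
        pair-z : wtℤ z pair ≡ z e ℤ.+ z e₀
        pair-z = trans (Wℤ.wt-set z (set ∅ g) e fresh) (cong (ℤ._+_ (z e)) (trans (wtℤ-single z g) (at-v g∋v)))

  -- Rigidity of odd cycles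

  module OddSets where
    open Matchings
    open Swapping using (not-in)
    open Degrees

    record MatchingOn (ys : List V) (s : ℕ) (M : E → Bool) : Set where
      constructor matchingOn
      field
        matching : IsMatching G M
        within   : ∀ e → M e ≡ true → ∀ {u} → e ∋ u → u ∈ ys
        size     : count M ≡ s
    open MatchingOn

    on-misses : ∀ {ys s M u} → MatchingOn ys s M → u ∉ ys → Misses M u
    on-misses on u∉ e Me e∋u = u∉ (within on e Me e∋u)

    extend-on : ∀ {ys s M e x y} → MatchingOn ys s M → SameEnds (ends e) (x , y) → x ∉ ys → y ∉ ys →
                MatchingOn (x ∷ y ∷ ys) (suc s) (set M e) × (∀ v → wtℤ v (set M e) ≡ v e ℤ.+ wtℤ v M)
    extend-on {ys} {s} {M} {e} {x} {y} on@(matchingOn mat within-ys size-s) ends-e x∉ y∉ =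
      matchingOn (matching-set mat missing) within′ (trans (wt-set (const 1) M e fresh) (cong suc size-s)) , λ v → Wℤ.wt-set v M e fresh
      where
      missing : ∀ {u} → e ∋ u → Misses M u
      missing e∋u with same⇒only ends-e e∋u
      ... | inj₁ refl = on-misses on x∉
      ... | inj₂ refl = on-misses on y∉
      fresh : M e ≡ false
      fresh = not-in (missing (inj₁ refl)) (inj₁ refl)
      within′ : ∀ d → set M e d ≡ true → ∀ {u} → d ∋ u → u ∈ x ∷ y ∷ ys
      within′ d t d∋u with set-⊆ M e t
      ... | inj₂ Md   = there (there (within-ys d Md d∋u))
      ... | inj₁ refl with same⇒only ends-e d∋u
      ... | inj₁ refl = here refl
      ... | inj₂ refl = there (here refl)

    empty : MatchingOn [] 0 ∅
    empty = matchingOn ∅-matching (λ _ ()) (wt-∅ {m} (const 1))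

    -- The inner vertices of the walk are matched in consecutive pairs. Starting from a given
    -- matching allows several arcs to be combined.
    pair-up : ∀ s xs {ys r M u w} → Chain (Adj G) u xs w → length xs ≡ 2 * s → Unique (xs ++ ys) → MatchingOn ys r M →
              ∃ (MatchingOn (xs ++ ys) (s + r))
    pair-up zero    []           c len uniq on = _ , on
    pair-up (suc s) (x ∷ [])     c len uniq on = ⊥-elim (0≢1+n (suc-injective (trans len (*-suc 2 s))))
    pair-up (suc s) (x ∷ y ∷ xs) (_ , (e , ends-e) , c) len (x∉ ∷ y∉ ∷ uniq) on
      with pair-up s xs c (suc-injective (suc-injective (trans len (*-suc 2 s)))) uniq on
    ... | M , on′ = set M e , proj₁ (extend-on on′ ends-e (λ x∈ → All.lookup x∉ (there x∈) refl) (λ y∈ → All.lookup y∉ y∈ refl))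

    near-perfect : ∀ {t x B} → OddCycle (Adj G) t (x ∷ B) → ∃ (MatchingOn B t)
    near-perfect {t} {x} {B} (oddCycle (_ ∷ u) c len) with pair-up t B c len (subst Unique (sym (Listₚ.++-identityʳ B)) u)
      empty
    ... | M , on = M , matchingOn (matching on) (λ e Me e∋u → subst (_ ∈_) (Listₚ.++-identityʳ B) (within on e Me e∋u))
      (trans (size on) (+-identityʳ t))

    module OddSet {t : ℕ} (c : List V) (cyc : OddCycle (Adj G) t c) where

      X : E → Bool
      X = Inside set⟦ c ⟧

      on-inside : ∀ {ys s M} → MatchingOn ys s M → (∀ {u} → u ∈ ys → u ∈ c) → ∀ e → M e ≡ true → X e ≡ true
      on-inside on ys⊆c e Me = ⇒inside set⟦ c ⟧ λ e∋u → ∈⇒set c (ys⊆c (within on e Me e∋u))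

      on-weight : ∀ {ys s M} → MatchingOn ys s M → (∀ {u} → u ∈ ys → u ∈ c) → wt (b2n ∘ X) M ≡ s
      on-weight {M = M} on ys⊆c = trans (wt-inside X M (on-inside on ys⊆c)) (size on)

      -- Rotating the cycle carries this statement from its first edge to all the others. The
      -- equation for `r` leaves the list free to be rearranged.
      FirstEdge : (E → ℤ) → List V → ℤ → Set
      FirstEdge v r w = ∀ {x y R} → r ≡ x ∷ y ∷ R → ∀ {e} → SameEnds (ends e) (x , y) → v e ≡ w

      module Rigid (v : E → ℤ) (w₀ : ℤ) (tight : ∀ M → IsMatching G M → wt (b2n ∘ X) M ≡ t → wtℤ v M ≡ w₀) where

        on-tight : ∀ {ys s} M → MatchingOn ys s M → s ≡ t → (∀ {u} → u ∈ ys → u ∈ c) → wtℤ v M ≡ w₀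
        on-tight M on refl ys⊆c = tight M (matching on) (on-weight on ys⊆c)

        -- The even arc `R` is matched within itself. Adding either of the two edges makes the
        -- matching near-perfect, and the two results differ in nothing else.
        consecutive : ∀ {x y z R e e′} → OddCycle (Adj G) t (x ∷ y ∷ z ∷ R) → (∀ {u} → u ∈ x ∷ y ∷ z ∷ R → u ∈ c) →
                      SameEnds (ends e) (x , y) → SameEnds (ends e′) (y , z) → v e ≡ v e′
        consecutive {x} {y} {z} {R} {e} {e′} (oddCycle (x∉ ∷ y∉ ∷ z∉ ∷ uR) (_ , _ , chain) len) r⊆c s s′ with halve (length R)
        ... | h , inj₂ eq = ⊥-elim (parity-clash {t} {h} (trans (sym len) (cong (2 +_) eq)))
          where
          parity-clash : ∀ {a b} → 2 * a ≡ 2 + suc (2 * b) → ⊥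
          parity-clash {a} {b} eq = even≢odd a (suc b) (trans eq (cong suc (sym (*-suc 2 b))))
        ... | h , inj₁ eq with pair-up h R chain eq (subst Unique (sym (Listₚ.++-identityʳ R)) uR) empty
        ... | M , on = ℤ-cancelʳ (trans (sym (proj₂ on₁ v)) (trans (on-tight M₁ (proj₁ on₁) size-t sub₁)
                         (trans (sym (on-tight M₂ (proj₁ on₂) size-t sub₂)) (proj₂ on₂ v))))
          where
          drop : ∀ {u} → u ∈ R ++ [] → u ∈ R
          drop = subst (_ ∈_) (Listₚ.++-identityʳ R)
          notin : ∀ {a} {L : List V} → (∀ {u} → u ∈ R → u ∈ L) → All (a ≢_) L → a ∉ R ++ []
          notin R⊆ a∉ a∈ = All.lookup a∉ (R⊆ (drop a∈)) refl
          M₁ M₂ : E → Bool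
          M₁ = set M e
          M₂ = set M e′
          on₁ = extend-on on s (notin (there ∘ there) x∉) (notin there y∉)
          on₂ = extend-on on s′ (notin there y∉) (notin id z∉)
          size-t : suc (h + 0) ≡ t
          size-t = *-cancelˡ-≡ (suc (h + 0)) t 2 (trans (cong (λ j → 2 * suc j) (+-identityʳ h))
            (trans (*-suc 2 h) (trans (cong (2 +_) (sym eq)) len)))
          sub₁ : ∀ {u} → u ∈ x ∷ y ∷ R ++ [] → u ∈ c
          sub₁ (here refl)         = r⊆c (here refl)
          sub₁ (there (here refl)) = r⊆c (there (here refl))
          sub₁ (there (there u∈))  = r⊆c (there (there (there (drop u∈))))
          sub₂ : ∀ {u} → u ∈ y ∷ z ∷ R ++ [] → u ∈ c
          sub₂ (here refl)         = r⊆c (there (here refl))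
          sub₂ (there (here refl)) = r⊆c (there (there (here refl)))
          sub₂ (there (there u∈))  = r⊆c (there (there (there (drop u∈))))

        first-rotate₁ : ∀ {w} x D → OddCycle (Adj G) t (x ∷ D) → (∀ {u} → u ∈ x ∷ D → u ∈ c) → FirstEdge v (x ∷ D) w → FirstEdge v (D ++ x ∷ []) w
        first-rotate₁ x []          cyc _ first = first
        first-rotate₁ x (y ∷ [])    (oddCycle _ _ len) _ first = ⊥-elim (even≢odd t 0 (sym len))
        first-rotate₁ x (y ∷ z ∷ R) cyc@(oddCycle _ ((e , s) , _) _) r⊆c first refl s′ =
          trans (sym (consecutive cyc r⊆c s s′)) (first refl s)

        first-rotate : ∀ {w} xs {ys} → OddCycle (Adj G) t (xs ++ ys) → (∀ {u} → u ∈ xs ++ ys → u ∈ c) → FirstEdge v (xs ++ ys) w → FirstEdge v (ys ++ xs) w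
        first-rotate {w} []       {ys} cyc r⊆c first = subst (λ l → FirstEdge v l w) (sym (Listₚ.++-identityʳ ys)) first
        first-rotate {w} (x ∷ xs) {ys} cyc r⊆c first = subst (λ l → FirstEdge v l w) (Listₚ.++-assoc ys (x ∷ []) xs)
          (first-rotate xs (subst (OddCycle (Adj G) t) assoc (rotate (x ∷ []) cyc))
            (λ {u} u∈ → r⊆c (∈-swap (xs ++ ys) (x ∷ []) (subst (u ∈_) (sym assoc) u∈)))
            (subst (λ l → FirstEdge v l w) assoc (first-rotate₁ x (xs ++ ys) cyc r⊆c first)))
          where
          assoc : (xs ++ ys) ++ x ∷ [] ≡ xs ++ ys ++ x ∷ []
          assoc = Listₚ.++-assoc xs ys (x ∷ [])

        -- A chord (a , b) replaces the first edge of the odd arc in a near-perfect matching.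
        chord : ∀ {w a A b B e} s → OddCycle (Adj G) t (a ∷ A ++ b ∷ B) → (∀ {u} → u ∈ a ∷ A ++ b ∷ B → u ∈ c) →
                FirstEdge v (a ∷ A ++ b ∷ B) w → length B ≡ 2 * s → SameEnds (ends e) (a , b) → v e ≡ w
        chord {A = []} s cyc r⊆c first lenB ends-e = first refl ends-e
        chord {a = a} {A = a′ ∷ A} {b} {B} {e} s (oddCycle (a∉ ∷ a′∉ ∷ uniq) (aa′ , chain) len) r⊆c first lenB ends-e with halve (length A)
        ... | h , inj₂ odd = ⊥-elim (even≢odd t (suc (h + s)) (sym (trans (sym (cong suc arith)) (trans (cong suc (sym lens)) len))))
          where
          lens : length (A ++ b ∷ B) ≡ suc (2 * h) + suc (2 * s)
          lens = trans (Listₚ.length-++ A) (cong₂ _+_ odd (cong suc lenB))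
          arith : suc (2 * h) + suc (2 * s) ≡ 2 * suc (h + s)
          arith = lemma h s
            where
            lemma : ∀ h s → suc (2 * h) + suc (2 * s) ≡ 2 * suc (h + s)
            lemma = ℕRing.solve-∀
        ... | h , inj₁ even = trans (ℤ-cancelʳ (trans (sym (proj₂ on₁ v)) (trans (on-tight M₁ (proj₁ on₁) size-t sub₁)
                         (trans (sym (on-tight M₂ (proj₁ on₂) size-t sub₂)) (proj₂ on₂ v))))) (first refl (proj₂ aa′))
          where
          chains = chain-split A chain
          uniqs = unique-++⁻ A uniq
          uniqB : Unique (B ++ [])
          uniqB with proj₁ (proj₂ uniqs)
          ... | _ ∷ u = subst Unique (sym (Listₚ.++-identityʳ B)) u
          base = pair-up s B (proj₂ chains) lenB uniqB empty
          dropB : ∀ {u} → u ∈ B ++ [] → u ∈ B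
          dropB = subst (_ ∈_) (Listₚ.++-identityʳ B)
          both = pair-up h A (proj₁ chains) even (unique-++⁺ (proj₁ uniqs) uniqB (λ u∈A u∈B → proj₂ (proj₂ uniqs) u∈A (there (dropB u∈B)))) (proj₂ base)
          rest : ∀ {u} → u ∈ A ++ B ++ [] → u ∈ A ++ b ∷ B
          rest u∈ with ∈-++⁻ A u∈
          ... | inj₁ u∈A = ∈-++⁺ˡ u∈A
          ... | inj₂ u∈B = ∈-++⁺ʳ A (there (dropB u∈B))
          b∉ : b ∉ A ++ B ++ []
          b∉ b∈ with ∈-++⁻ A b∈
          ... | inj₁ b∈A = proj₂ (proj₂ uniqs) b∈A (here refl)
          ... | inj₂ b∈B = unique-head (proj₁ (proj₂ uniqs)) (dropB b∈B)
          a∉R : a ∉ A ++ B ++ []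
          a∉R a∈ = All.lookup a∉ (there (rest a∈)) refl
          a′∉R : a′ ∉ A ++ B ++ []
          a′∉R a∈ = All.lookup a′∉ (rest a∈) refl
          M₁ M₂ : E → Bool
          M₁ = set (proj₁ both) e
          M₂ = set (proj₁ both) (proj₁ aa′)
          on₁ = extend-on (proj₂ both) ends-e a∉R b∉
          on₂ = extend-on (proj₂ both) (proj₂ aa′) a∉R a′∉R
          size-t : suc (h + (s + 0)) ≡ t
          size-t = *-cancelˡ-≡ (suc (h + (s + 0))) t 2 (trans (lemma h s) (trans (cong suc (sym (trans (Listₚ.length-++ A) (cong₂ _+_ even (cong suc lenB))))) len))
            where
            lemma : ∀ h s → 2 * suc (h + (s + 0)) ≡ suc (2 * h + suc (2 * s))
            lemma = ℕRing.solve-∀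
          sub₁ : ∀ {u} → u ∈ a ∷ b ∷ A ++ B ++ [] → u ∈ c
          sub₁ (here refl)         = r⊆c (here refl)
          sub₁ (there (here refl)) = r⊆c (there (there (∈-++⁺ʳ A (here refl))))
          sub₁ (there (there u∈))  = r⊆c (there (there (rest u∈)))
          sub₂ : ∀ {u} → u ∈ a ∷ a′ ∷ A ++ B ++ [] → u ∈ c
          sub₂ (here refl)         = r⊆c (here refl)
          sub₂ (there (here refl)) = r⊆c (there (here refl))
          sub₂ (there (there u∈))  = r⊆c (there (there (rest u∈)))

        -- The ends of `e` cut the cycle into two arcs, just one of which has evenly many inner
        -- vertices. A rotation to `a` or to `b` puts that arc last, as `chord` requires.
        inside-value : ∀ {w e a b} → FirstEdge v c w → a ∈ c → b ∈ c → SameEnds (ends e) (a , b) → v e ≡ w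
        inside-value {w} {e} {a} {b} first a∈ b∈ ends-e with ∈-split a∈
        ... | P , R , refl = from-a (rotate P cyc) (λ u∈ → ∈-swap (a ∷ R) P u∈) (first-rotate P cyc id first) (∈-swap P (a ∷ R) b∈)
          where
          from-a : ∀ {D} → OddCycle (Adj G) t (a ∷ D) → (∀ {u} → u ∈ a ∷ D → u ∈ c) → FirstEdge v (a ∷ D) w → b ∈ a ∷ D → v e ≡ w
          from-a cyc′ r⊆c first′ (here refl) = ⊥-elim (same⇒≢ ends-e refl)
          from-a cyc′ r⊆c first′ (there b∈D) with ∈-split b∈D
          ... | A , B , refl with halve (length B)
          ... | s , inj₁ even = chord s cyc′ r⊆c first′ even ends-e
          ... | s , inj₂ odd with halve (length A)
          ... | h , inj₁ evenA = chord h (rotate (a ∷ A) cyc′) (λ u∈ → r⊆c (∈-swap (b ∷ B) (a ∷ A) u∈))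
                (first-rotate (a ∷ A) cyc′ r⊆c first′) evenA (same-sym ends-e)
          ... | h , inj₂ oddA = ⊥-elim (even≢odd t (suc (h + s)) (trans (sym (cyc-len cyc′))
                (trans (Listₚ.length-++ A) (trans (cong₂ _+_ oddA (cong suc odd)) (lemma h s)))))
            where
            cyc-len : ∀ {D} → OddCycle (Adj G) t (a ∷ D) → length D ≡ 2 * t
            cyc-len (oddCycle _ _ len) = len
            lemma : ∀ h s → suc (2 * h) + suc (suc (2 * s)) ≡ suc (2 * suc (h + s))
            lemma = ℕRing.solve-∀

        -- Such an edge has at most one end on the cycle. A near-perfect matching that misses this
        -- end, or any vertex if there is none, stays tight when the edge is added.
        outside-value : ∀ {e} → X e ≡ false → v e ≡ ℤ.0ℤ
        outside-value {e} Xe = choose (p e ∈? c) (q e ∈? c)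
          where
          using-x : ∀ {x B} → OddCycle (Adj G) t (x ∷ B) → (∀ {u} → u ∈ x ∷ B → u ∈ c) → (∀ {u} → e ∋ u → u ∉ B) → v e ≡ ℤ.0ℤ
          using-x {x} {B} cyc′ r⊆c avoid with near-perfect cyc′
          ... | M , on = add-zero (trans (sym (Wℤ.wt-set v M e fresh)) (trans (tight (set M e) mat′ weight) (sym (on-tight M on refl (r⊆c ∘ there)))))
            where
            missing : ∀ {u} → e ∋ u → Misses M u
            missing e∋u = on-misses on (avoid e∋u)
            fresh : M e ≡ false
            fresh = not-in (missing (inj₁ refl)) (inj₁ refl)
            mat′ : IsMatching G (set M e)
            mat′ = matching-set (matching on) missing
            weight : wt (b2n ∘ X) (set M e) ≡ t
            weight = trans (wt-set (b2n ∘ X) M e fresh) (trans (cong (λ b → b2n b + wt (b2n ∘ X) M) Xe) (on-weight on (r⊆c ∘ there)))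
          at : ∀ {x} → x ∈ c → (∀ {u} → e ∋ u → u ≡ x ⊎ u ∉ c) → v e ≡ ℤ.0ℤ
          at x∈ only with ∈-split x∈
          ... | P , R , refl = using-x {B = R ++ P} (rotate P cyc) (∈-swap (_ ∷ R) P) avoid
            where
            avoid : ∀ {u} → e ∋ u → u ∉ R ++ P
            avoid e∋u u∈ with only e∋u
            ... | inj₁ refl = unique-head (cycle-unique (rotate P cyc)) u∈
            ... | inj₂ u∉c  = u∉c (∈-swap (_ ∷ R) P (there u∈))
          choose : Dec (p e ∈ c) → Dec (q e ∈ c) → v e ≡ ℤ.0ℤ
          choose (yes a) (yes b) = ⊥-elim (case trans (sym Xe) (∧-intro (∈⇒set c a) (∈⇒set c b)) of λ ())
          choose (yes a) (no b)  = at a λ { (inj₁ refl) → inj₁ refl ; (inj₂ refl) → inj₂ b }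
          choose (no a)  (yes b) = at b λ { (inj₁ refl) → inj₂ a ; (inj₂ refl) → inj₁ refl }
          choose (no a)  (no b)  = neither c cyc id λ { (inj₁ refl) → a ; (inj₂ refl) → b }
            where
            neither : ∀ r → OddCycle (Adj G) t r → (∀ {u} → u ∈ r → u ∈ c) → (∀ {u} → e ∋ u → u ∉ c) → v e ≡ ℤ.0ℤ
            neither (x ∷ B) cyc′ r⊆c out = using-x cyc′ r⊆c λ e∋u u∈ → out e∋u (r⊆c (there u∈))

      rigid : ∀ v w₀ → (∀ M → IsMatching G M → wt (b2n ∘ X) M ≡ t → wtℤ v M ≡ w₀) → ∀ {w} → FirstEdge v c w →
              ∀ e → (X e ≡ true → v e ≡ w) × (X e ≡ false → v e ≡ ℤ.0ℤ)
      rigid v w₀ tight first e =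
          (λ Xe → Rigid.inside-value v w₀ tight {a = p e} {b = q e} first (set⇒∈ c (inside⇒ set⟦ c ⟧ {e} Xe (inj₁ refl)))
            (set⇒∈ c (inside⇒ set⟦ c ⟧ {e} Xe (inj₂ refl))) (inj₁ (refl , refl)))
        , Rigid.outside-value v w₀ tight

      bound : ∀ M → IsMatching G M → wt (b2n ∘ X) M ≤ t
      bound M mat = ≤-trans (≤-reflexive as-count) (≮⇒≥ λ t< → <⇒≱ (s≤s (≤-reflexive (cycle-length cyc))) (begin
        2 + 2 * t                      ≡⟨ *-suc 2 t ⟨
        2 * suc t                      ≤⟨ *-monoʳ-≤ 2 t< ⟩
        2 * count (M ∩E set⟦ c ⟧)      ≤⟨ matching-bound set⟦ c ⟧ mat ⟩
        count set⟦ c ⟧                 ≤⟨ count-set≤ c ⟩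
        length c                       ∎))
        where
        open ≤-Reasoning
        as-count : wt (b2n ∘ X) M ≡ count (M ∩E set⟦ c ⟧)
        as-count = sum-cong-≗ λ e → ⊙-∧ (M e)

      first-edge : ∀ r → OddCycle (Adj G) t r → (∀ {u} → u ∈ r → u ∈ c) → ∃ λ e → X e ≡ true ×
                   (∀ (v : E → ℤ) {x y R} → r ≡ x ∷ y ∷ R → ∀ {e′} → SameEnds (ends e′) (x , y) → v e′ ≡ v e)
      first-edge (x ∷ [])    (oddCycle _ (e , s) _)       _   = ⊥-elim (same⇒≢ s refl)
      first-edge (x ∷ y ∷ R) (oddCycle _ ((e , s) , _) _) r⊆c = e
        , ⇒inside set⟦ c ⟧ (λ e∋u → ∈⇒set c (case same⇒only s e∋u of λ { (inj₁ refl) → r⊆c (here refl) ; (inj₂ refl) → r⊆c (there (here refl)) }))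
        , λ { v refl s′ → cong v (same-unique s′ s) }

      tight-matching : ∀ r → OddCycle (Adj G) t r → (∀ {u} → u ∈ r → u ∈ c) → ∃ λ M → IsMatching G M × wt (b2n ∘ X) M ≡ t
      tight-matching (x ∷ B) cyc′ r⊆c with near-perfect cyc′
      ... | M , on = M , matching on , on-weight on (r⊆c ∘ there)

  -- Necessity: every rigid inequality has distance one

  module Necessity (conn : Connected G) (k : ℕ) (α : Fin (Graph.m G) → ℤ) (k≥1 : 1 ≤ k)
                   (lattice : LatticePolytope (Polar (Points.Q k α))) where
    open Matchings
    open Points k α

    N : ℕ
    N = proj₁ lattice

    vertex : Fin N → E → ℤ
    vertex = proj₁ (proj₂ lattice)

    polar⇒conv : ∀ {y} → Polar Q y → ConvFam N (λ i → embedℤ (vertex i)) y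
    polar⇒conv {y} = proj₁ (proj₂ (proj₂ lattice) y)

    vertex-valid : ∀ i → Valid (vertex i)
    vertex-valid i = polar⇒valid (proj₂ (proj₂ (proj₂ lattice) (embedℤ (vertex i))) (cone-unit {V = λ i → embedℤ (vertex i)} i))

    -- Such a coefficient at `e₀` witnesses that `f` is primitive and lets the factor of a multiple
    -- of `f` be read off there.
    ±1 : ℤ → Set
    ±1 s = s ≡ ℤ.1ℤ ⊎ s ≡ ℤ.-1ℤ

    ±1-square : ∀ {s} → ±1 s → s ℤ.* s ≡ ℤ.1ℤ
    ±1-square (inj₁ refl) = refl
    ±1-square (inj₂ refl) = refl

    ±1-bound : ∀ {s} → ±1 s → ∀ z → ℤ.- ℤ.+ ℤ.∣ z ∣ ℤ.≤ s ℤ.* z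
    ±1-bound (inj₁ refl) z = ℤₚ.≤-trans (low z) (ℤₚ.≤-reflexive (sym (ℤₚ.*-identityˡ z)))
      where
      low : ∀ z → ℤ.- ℤ.+ ℤ.∣ z ∣ ℤ.≤ z
      low (ℤ.+ a)      = ℤₚ.neg-≤-pos {a} {a}
      low (ℤ.-[1+ a ]) = ℤₚ.≤-refl
    ±1-bound (inj₂ refl) z = ℤₚ.≤-trans (ℤₚ.neg-mono-≤ (high z)) (ℤₚ.≤-reflexive (sym (ℤₚ.-1*i≡-i z)))
      where
      high : ∀ z → z ℤ.≤ ℤ.+ ℤ.∣ z ∣
      high (ℤ.+ a)      = ℤₚ.≤-refl
      high (ℤ.-[1+ a ]) = ℤ.-≤+

    module _ (f : E → ℤ) (b : ℤ) (e₀ : E) (unit : ±1 (f e₀))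
             (bound : ∀ M → IsMatching G M → wtℤ f M ℤ.≤ b)
             (T : E → Bool) (matT : IsMatching G T) (tightT : wtℤ f T ≡ b)
             (rigid : ∀ v → (∀ M → IsMatching G M → wtℤ f M ≡ b → wtℤ v M ≡ wtℤ v T) → ∀ e → v e ≡ (v e₀ ℤ.* f e₀) ℤ.* f e) where

      -- The lattice distance of `α` from the hyperplane `f x = k b`.
      h : ℤ
      h = ℤ.+ k ℤ.* b ℤ.- sumℤ (λ e → α e ℤ.* f e)

      pt-f : (E → Bool) → ℤ
      pt-f M = sumℤ (λ e → pt M e ℤ.* f e)

      pt-f≤h : ∀ M → IsMatching G M → pt-f M ℤ.≤ h
      pt-f≤h M mat = ℤₚ.≤-trans (ℤₚ.≤-reflexive (dot-pt M f))
        (ℤₚ.+-monoˡ-≤ (ℤ.- sumℤ (λ e → α e ℤ.* f e)) (ℤₚ.*-monoˡ-≤-nonNeg (ℤ.+ k) (bound M mat)))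

      pt-f≡h : ∀ M → wtℤ f M ≡ b → pt-f M ≡ h
      pt-f≡h M tight = trans (dot-pt M f) (cong (λ x → ℤ.+ k ℤ.* x ℤ.- sumℤ (λ e → α e ℤ.* f e)) tight)

      sum-scaled : ∀ M (s : ℤ) → sumℤ (λ e → pt M e ℤ.* (s ℤ.* f e)) ≡ s ℤ.* pt-f M
      sum-scaled M s = trans (sumℤ-cong λ e → move (pt M e) s (f e)) (sumℤ-*ˡ s (λ e → pt M e ℤ.* f e))
        where
        move : ∀ a s b → a ℤ.* (s ℤ.* b) ≡ s ℤ.* (a ℤ.* b)
        move = ℤRing.solve-∀

      -- Otherwise the polar would contain the ray spanned by -f.
      h-positive : ℤ.0ℤ ℤ.< h
      h-positive = ℤₚ.≰⇒> λ h≤0 → ray h≤0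
        where
        B : ℕ
        B = sum (λ i → ℤ.∣ vertex i e₀ ∣)
        ray : h ℤ.≤ ℤ.0ℤ → ⊥
        ray h≤0 = ℤₚ.<⇒≱ (ℤₚ.neg-mono-< (ℤ.+<+ (n<1+n B))) (ι-≤⁻ {ℤ.- ℤ.+ B} {ℤ.- ℤ.+ suc B} (ℚₚ.≤-trans
            (average-≥ c≥0 sc (λ i → ι-≤ {ℤ.- ℤ.+ B} {f e₀ ℤ.* vertex i e₀} (low i)))
            (ℚₚ.≤-reflexive value)))
          where
          low : ∀ i → ℤ.- ℤ.+ B ℤ.≤ f e₀ ℤ.* vertex i e₀
          low i = ℤₚ.≤-trans (ℤₚ.neg-mono-≤ (ℤ.+≤+ {ℤ.∣ vertex i e₀ ∣} {B} (term≤sum (λ i → ℤ.∣ vertex i e₀ ∣) i)))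
            (±1-bound unit (vertex i e₀))
          -- At `e₀` this multiple of `-f` goes one step beyond the bound `B` that all generators
          -- obey.
          z : E → ℤ
          z e = (ℤ.- ℤ.+ suc B) ℤ.* f e
          valid : Valid z
          valid M mat = ℤₚ.≤-trans ℤ.-≤+ (ℤₚ.≤-trans (ℤₚ.≤-reflexive (sym (ℤₚ.*-zeroʳ (ℤ.- ℤ.+ suc B))))
            (ℤₚ.≤-trans (ℤₚ.*-monoˡ-≤-nonPos (ℤ.- ℤ.+ suc B) (ℤₚ.≤-trans (pt-f≤h M mat) h≤0))
              (ℤₚ.≤-reflexive (sym (sum-scaled M (ℤ.- ℤ.+ suc B))))))
          conv : ConvFam N (λ i → embedℤ (vertex i)) (embedℤ z)
          conv = polar⇒conv {embedℤ z} (valid⇒polar {z} valid)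
          c : Fin N → ℚ
          c = proj₁ conv
          c≥0 : ∀ i → 0ℚ ℚ.≤ c i
          c≥0 = proj₁ (proj₂ conv)
          sc : ∑ c ≡ 1ℚ
          sc = proj₁ (proj₂ (proj₂ conv))
          value : ∑ (λ i → c i ℚ.* ι (f e₀ ℤ.* vertex i e₀)) ≡ ι (ℤ.- ℤ.+ suc B)
          value = begin
            ∑ (λ i → c i ℚ.* ι (f e₀ ℤ.* vertex i e₀))           ≡⟨ ∑-cong (λ i → trans (cong (c i ℚ.*_) (ι-* (f e₀) (vertex i e₀))) (ℚ-swap (c i) (ι (f e₀)) (ι (vertex i e₀)))) ⟩
            ∑ (λ i → ι (f e₀) ℚ.* (c i ℚ.* ι (vertex i e₀)))     ≡⟨ ∑-*ˡ (ι (f e₀)) (λ i → c i ℚ.* ι (vertex i e₀)) ⟩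
            ι (f e₀) ℚ.* ∑ (λ i → c i ℚ.* ι (vertex i e₀))       ≡⟨ cong (ι (f e₀) ℚ.*_) (proj₂ (proj₂ (proj₂ conv)) e₀) ⟨
            ι (f e₀) ℚ.* ι (z e₀)                                ≡⟨ ι-* (f e₀) (z e₀) ⟨
            ι (f e₀ ℤ.* z e₀)                                    ≡⟨ cong ι (trans (regroup (f e₀) (ℤ.- ℤ.+ suc B)) (trans (cong (ℤ._*_ (ℤ.- ℤ.+ suc B)) (±1-square unit)) (ℤₚ.*-identityʳ (ℤ.- ℤ.+ suc B)))) ⟩
            ι (ℤ.- ℤ.+ suc B)                                    ∎
            where
            open ≡-Reasoning
            regroup : ∀ s t → s ℤ.* (t ℤ.* s) ≡ t ℤ.* (s ℤ.* s)
            regroup = ℤRing.solve-∀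

      instance
        h≢0 : ℚ.NonZero (ι h)
        h≢0 = ℚ.≢-nonZero λ eq → ℤₚ.<⇒≢ h-positive (sym (ι-injective {h} {ℤ.0ℤ} eq))

      1/h : ℚ
      1/h = ℚ.1/ ι h

      h≥0 : 0ℚ ℚ.≤ ι h
      h≥0 = ι-≤ {ℤ.0ℤ} {h} (ℤₚ.<⇒≤ h-positive)

      1/h≥0 : 0ℚ ℚ.≤ 1/h
      1/h≥0 = ℚₚ.<⇒≤ (ℚₚ.positive⁻¹ 1/h {{ℚₚ.1/pos⇒pos (ι h) {{ℚₚ.nonNeg∧nonZero⇒pos (ι h) {{ℚ.nonNegative h≥0}}}}}})

      y : Vecℚ m
      y e = (ℚ.- 1/h) ℚ.* ι (f e)

      dot-y : ∀ M → embedℤ (pt M) · y ≡ (ℚ.- 1/h) ℚ.* ι (pt-f M)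
      dot-y M = trans (∑-cong λ e → ℚ-swap (embedℤ (pt M) e) (ℚ.- 1/h) (ι (f e)))
        (trans (∑-*ˡ (ℚ.- 1/h) (λ e → embedℤ (pt M) e ℚ.* ι (f e))) (cong ((ℚ.- 1/h) ℚ.*_) (ι-dot (pt M) f)))

      normalised : (ℚ.- 1/h) ℚ.* ι h ≡ ℚ.- 1ℚ
      normalised = trans (sym (ℚₚ.neg-distribˡ-* 1/h (ι h))) (cong ℚ.-_ (ℚₚ.*-inverseˡ (ι h)))

      y-polar : Polar Q y
      y-polar = polar y λ M mat → begin
        ℚ.- 1ℚ                              ≡⟨ normalised ⟨
        (ℚ.- 1/h) ℚ.* ι h                   ≡⟨ ℚₚ.neg-distribˡ-* 1/h (ι h) ⟨
        ℚ.- (1/h ℚ.* ι h)                   ≤⟨ ℚₚ.neg-antimono-≤ (*-monoˡ 1/h≥0 (ι-≤ {pt-f M} {h} (pt-f≤h M mat))) ⟩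
        ℚ.- (1/h ℚ.* ι (pt-f M))            ≡⟨ ℚₚ.neg-distribˡ-* 1/h (ι (pt-f M)) ⟩
        (ℚ.- 1/h) ℚ.* ι (pt-f M)            ≡⟨ dot-y M ⟨
        embedℤ (pt M) · y                   ∎
        where open ℚₚ.≤-Reasoning

      -- The point `-f / h` of the polar has the value -1 at all tight matchings, and so does each
      -- generator occurring in it with positive coefficient. By rigidity that generator is `s`
      -- times `f` for an integer `s`, and `s * h = -1`.
      distance-one : h ≡ ℤ.1ℤ
      distance-one = conclude (positive-coefficient c sc)
        where
        conv : ConvFam N (λ i → embedℤ (vertex i)) y
        conv = polar⇒conv {y} y-polar
        c : Fin N → ℚ
        c = proj₁ conv
        sc : ∑ c ≡ 1ℚ
        sc = proj₁ (proj₂ (proj₂ conv))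
        conclude : (∃ λ i → 0ℚ ℚ.< c i) → h ≡ ℤ.1ℤ
        conclude (i , c>0) = trans (sym (ℤₚ.0≤i⇒+∣i∣≡i (ℤₚ.<⇒≤ h-positive))) (cong ℤ.+_ (m*n≡1⇒n≡1 ℤ.∣ s ∣ ℤ.∣ h ∣
            (trans (sym (ℤₚ.abs-* s h)) (cong ℤ.∣_∣ s*h))))
          where
          v : E → ℤ
          v = vertex i
          tight : ∀ M → IsMatching G M → wtℤ f M ≡ b → sumℤ (λ e → pt M e ℤ.* v e) ≡ ℤ.-1ℤ
          tight M mat tightM = average-tight (λ j → sumℤ (λ e → pt M e ℤ.* vertex j e)) (proj₁ (proj₂ conv)) sc
            (λ j → vertex-valid j M mat) attained i c>0
            where
            attained : ∑ (λ j → c j ℚ.* ι (sumℤ (λ e → pt M e ℤ.* vertex j e))) ≡ ℚ.- 1ℚ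
            attained = begin
              ∑ (λ j → c j ℚ.* ι (sumℤ (λ e → pt M e ℤ.* vertex j e)))  ≡⟨ ∑-cong (λ j → cong (c j ℚ.*_) (trans (·-comm (embedℤ (vertex j)) (embedℤ (pt M))) (ι-dot (pt M) (vertex j)))) ⟨
              ∑ (λ j → c j ℚ.* (embedℤ (vertex j) · embedℤ (pt M)))     ≡⟨ conv-dot {V = λ i → embedℤ (vertex i)} {y} (embedℤ (pt M)) {c} (proj₂ (proj₂ (proj₂ conv))) ⟨
              y · embedℤ (pt M)                                         ≡⟨ ·-comm y (embedℤ (pt M)) ⟩
              embedℤ (pt M) · y                                         ≡⟨ dot-y M ⟩
              (ℚ.- 1/h) ℚ.* ι (pt-f M)                                  ≡⟨ cong (λ x → (ℚ.- 1/h) ℚ.* ι x) (pt-f≡h M tightM) ⟩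
              (ℚ.- 1/h) ℚ.* ι h                                         ≡⟨ normalised ⟩
              ℚ.- 1ℚ                                                    ∎
              where open ≡-Reasoning
          constant : ∀ M → IsMatching G M → wtℤ f M ≡ b → wtℤ v M ≡ wtℤ v T
          constant M mat tightM = ℤₚ.*-cancelˡ-≡ (ℤ.+ k) _ _ {{ℤ.≢-nonZero λ eq → <⇒≢ k≥1 (sym (ℤₚ.+-injective eq))}}
            (GroupProperties.∙-cancelʳ (AbelianGroup.group ℤₚ.+-0-abelianGroup) (ℤ.- sumℤ (λ e → α e ℤ.* v e)) (ℤ.+ k ℤ.* wtℤ v M) (ℤ.+ k ℤ.* wtℤ v T) (trans (sym (dot-pt M v)) (trans (tight M mat tightM)
              (trans (sym (tight T matT tightT)) (dot-pt T v)))))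
          s : ℤ
          s = v e₀ ℤ.* f e₀
          s*h : s ℤ.* h ≡ ℤ.-1ℤ
          s*h = trans (cong (s ℤ.*_) (sym (pt-f≡h T tightT))) (trans (sym (sum-scaled T s))
            (trans (sumℤ-cong λ e → cong (pt T e ℤ.*_) (sym (rigid v constant e))) (tight T matT tightT)))

    -- Numerical consequences for stars and odd cycles

    open Degrees
    open Stars
    open OddSets

    -- For the inequality `-x_e ≤ 0` the distance is `α e`. The empty matching and all single edges
    -- other than `e` are tight, which makes it rigid.
    α≡1 : ∀ e → α e ≡ ℤ.1ℤ
    α≡1 e = trans (sym distance) (distance-one f ℤ.0ℤ e (inj₂ f-e) bound ∅ ∅-matching (Wℤ.wt-∅ f) rigid)
      where
      here-e : E → Bool
      here-e = set ∅ e
      f : E → ℤ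
      f e′ = ℤ.- b2z (here-e e′)
      f-e : f e ≡ ℤ.-1ℤ
      f-e = cong (λ b → ℤ.- b2z b) (updateAt-updates e ∅)
      f-other : ∀ {e′} → e′ ≢ e → f e′ ≡ ℤ.0ℤ
      f-other {e′} e′≢e = cong (λ b → ℤ.- b2z b) (updateAt-minimal e′ e ∅ e′≢e)
      bound : ∀ M → IsMatching G M → wtℤ f M ℤ.≤ ℤ.0ℤ
      bound M _ = ℤₚ.≤-trans (ℤₚ.≤-reflexive (trans (wtℤ-neg (b2z ∘ here-e) M) (cong ℤ.-_ (wtℤ-pos (b2n ∘ here-e) M))))
        (ℤₚ.neg-mono-≤ (ℤ.+≤+ {0} {wt (b2n ∘ here-e) M} z≤n))
      rigid : ∀ v → (∀ M → IsMatching G M → wtℤ f M ≡ ℤ.0ℤ → wtℤ v M ≡ wtℤ v ∅) → ∀ e′ → v e′ ≡ (v e ℤ.* f e) ℤ.* f e′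
      rigid v const-v e′ with e′ Fin.≟ e
      ... | yes refl = sym (trans (cong (λ x → (v e ℤ.* x) ℤ.* x) f-e) (signs (v e)))
        where
        signs : ∀ a → (a ℤ.* ℤ.-1ℤ) ℤ.* ℤ.-1ℤ ≡ a
        signs = ℤRing.solve-∀
      ... | no e′≢e = trans (sym (wtℤ-single v e′)) (trans (const-v (set ∅ e′) (singleton-matching e′) (trans (wtℤ-single f e′) (f-other e′≢e)))
        (trans (Wℤ.wt-∅ v) (sym (trans (cong ((v e ℤ.* f e) ℤ.*_) (f-other e′≢e)) (ℤₚ.*-zeroʳ (v e ℤ.* f e))))))
      distance : ℤ.+ k ℤ.* ℤ.0ℤ ℤ.- sumℤ (λ e′ → α e′ ℤ.* f e′) ≡ α e
      distance = begin
        ℤ.+ k ℤ.* ℤ.0ℤ ℤ.- sumℤ (λ e′ → α e′ ℤ.* f e′)      ≡⟨ cong₂ ℤ._-_ (ℤₚ.*-zeroʳ (ℤ.+ k)) (sumℤ-cong λ e′ → trans (sym (ℤₚ.neg-distribʳ-* (α e′) _)) (cong ℤ.-_ (trans (ℤₚ.*-comm (α e′) _) (sym (⊙ℤ-* (here-e e′) (α e′)))))) ⟩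
        ℤ.0ℤ ℤ.- sumℤ (λ e′ → ℤ.- (here-e e′ Wℤ.⊙ α e′))    ≡⟨ cong (ℤ._-_ ℤ.0ℤ) (trans (sumℤ-neg (λ e′ → here-e e′ Wℤ.⊙ α e′)) (cong ℤ.-_ (wtℤ-single α e))) ⟩
        ℤ.0ℤ ℤ.- (ℤ.- α e)                                  ≡⟨ double (α e) ⟩
        α e                                                 ∎
        where
        open ≡-Reasoning
        double : ∀ a → ℤ.0ℤ ℤ.- (ℤ.- a) ≡ a
        double = ℤRing.solve-∀

    -- With `α` constantly one, `f(α)` is the number of edges in `X`, so distance one becomes an
    -- equation between natural numbers.
    binary-facet : (X : E → Bool) (β : ℕ) (e₀ : E) → X e₀ ≡ true → (∀ M → IsMatching G M → wt (b2n ∘ X) M ≤ β) →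
                   (T : E → Bool) → IsMatching G T → wt (b2n ∘ X) T ≡ β →
                   (∀ v → (∀ M → IsMatching G M → wt (b2n ∘ X) M ≡ β → wtℤ v M ≡ wtℤ v T) →
                      ∀ e → (X e ≡ true → v e ≡ v e₀) × (X e ≡ false → v e ≡ ℤ.0ℤ)) →
                   suc (count X) ≡ k * β
    binary-facet X β e₀ Xe₀ bound T matT tightT rigid = ℤₚ.+-injective (begin
      ℤ.1ℤ ℤ.+ ℤ.+ count X                                                ≡⟨ cong (ℤ._+ ℤ.+ count X) distance ⟨
      (ℤ.+ k ℤ.* ℤ.+ β ℤ.- sumℤ (λ e → α e ℤ.* b2z (X e))) ℤ.+ ℤ.+ count X
        ≡⟨ cong (λ s → (ℤ.+ k ℤ.* ℤ.+ β ℤ.- s) ℤ.+ ℤ.+ count X)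
             (trans (sumℤ-cong λ e → trans (cong (ℤ._* b2z (X e)) (α≡1 e)) (ℤₚ.*-identityˡ (b2z (X e)))) (sumℤ-pos (λ e → b2n (X e)))) ⟩
      (ℤ.+ k ℤ.* ℤ.+ β ℤ.- ℤ.+ count X) ℤ.+ ℤ.+ count X                   ≡⟨ cancel (ℤ.+ k ℤ.* ℤ.+ β) (ℤ.+ count X) ⟩
      ℤ.+ k ℤ.* ℤ.+ β                                                     ≡⟨ ℤₚ.pos-* k β ⟨
      ℤ.+ (k * β)                                                         ∎)
      where
      open ≡-Reasoning
      cancel : ∀ a b → (a ℤ.- b) ℤ.+ b ≡ a
      cancel = ℤRing.solve-∀
      f : E → ℤ
      f e = b2z (X e)
      f₀ : f e₀ ≡ ℤ.1ℤ
      f₀ = cong b2z Xe₀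
      value : ∀ M → wtℤ f M ≡ ℤ.+ wt (b2n ∘ X) M
      value = wtℤ-pos (b2n ∘ X)
      distance : ℤ.+ k ℤ.* ℤ.+ β ℤ.- sumℤ (λ e → α e ℤ.* b2z (X e)) ≡ ℤ.1ℤ
      distance = distance-one f (ℤ.+ β) e₀ (inj₁ f₀)
        (λ M mat → ℤₚ.≤-trans (ℤₚ.≤-reflexive (value M)) (ℤ.+≤+ (bound M mat))) T matT (trans (value T) (cong ℤ.+_ tightT))
        λ v const-v e → rigid′ v e (rigid v (λ M mat tight → const-v M mat (trans (value M) (cong ℤ.+_ tight))) e)
        where
        rigid′ : ∀ v e → (X e ≡ true → v e ≡ v e₀) × (X e ≡ false → v e ≡ ℤ.0ℤ) → v e ≡ (v e₀ ℤ.* f e₀) ℤ.* f e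
        rigid′ v e (on , off) with X e
        ... | true  = trans (on refl) (sym (trans (ℤₚ.*-identityʳ _) (trans (cong (v e₀ ℤ.*_) f₀) (ℤₚ.*-identityʳ (v e₀)))))
        ... | false = trans (off refl) (sym (ℤₚ.*-zeroʳ (v e₀ ℤ.* f e₀)))

    essential-degree : ∀ v → Essential G v → suc (degree G v) ≡ k
    essential-degree v ess = from-edge (edge-at v (positive ess))
      where
      positive : Essential G v → 1 ≤ degree G v
      positive (inj₁ (deg , _))        = ≤-reflexive (sym deg)
      positive (inj₂ (inj₁ (deg , _))) = ≤-trans (s≤s z≤n) (≤-reflexive (sym deg))
      positive (inj₂ (inj₂ three))     = ≤-trans (s≤s z≤n) three
      from-edge : (∃ λ e → e ∋ v) → suc (degree G v) ≡ k
      from-edge (e₀ , e₀∋v) = trans (cong suc (degree≡count G v)) (trans (binary-facet (λ e → incident? G e v) 1 e₀ (∋⇒incident e₀∋v)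
        (λ M mat → ≤-trans (≤-reflexive (sum-cong-≗ λ e → ⊙-∧ (M e))) (degIn-matching≤1 mat v))
        (set ∅ e₀) (singleton-matching e₀) (single-star e₀ e₀∋v) (star-rigid conn v ess e₀ e₀∋v)) (*-identityʳ k))

    cycle-edges : ∀ {t} c → OddCycle (Adj G) t c → suc (count (Inside set⟦ c ⟧)) ≡ k * t
    cycle-edges {t} c cyc =
      let (e₀ , Xe₀ , first)  = OddSet.first-edge c cyc c cyc id
          (T , matT , tightT) = OddSet.tight-matching c cyc c cyc id
      in binary-facet (Inside set⟦ c ⟧) t e₀ Xe₀ (OddSet.bound c cyc) T matT tightT λ v const-v → OddSet.rigid c cyc v (wtℤ v T) const-v (first v)

    -- A degree above `d ≥ 2` is at least three, which makes the vertex essential and its degree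
    -- equal to `d` after all.
    degree-bound-by : ∀ d → 2 ≤ d → k ≡ suc d → ∀ v → degree G v ≤ d
    degree-bound-by d d≥2 eq v = ≮⇒≥ λ d< → <⇒≢ d< (sym (suc-injective
      (trans (essential-degree v (inj₂ (inj₂ (≤-trans (s≤s d≥2) d<)))) eq)))

    pentagon : k ≡ 3 → ∀ {c} → OddCycle (Adj G) 2 c → CaseB G
    pentagon eq cyc with PentagonBlocks.pentagon-from (whole G) (cycle-map (λ (e , s) → e , refl , s) cyc)
    ... | g , pent , _ = PentagonBlocks.pentagon-C5 (whole G) (degree-bound-by 2 ≤-refl eq) conn (λ _ → refl) (λ _ → refl) pent

    cubic : k ≡ 4 → CaseC G
    cubic eq = (λ v ess → suc-injective (trans (essential-degree v ess) eq))
      , λ H block → BlockAnalysis.Result.shape (BlockAnalysis.analyse (degree-bound-by 3 (s≤s (s≤s z≤n)) eq)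
        (λ {t} c cyc → trans (cycle-edges c cyc) (cong (_* t) eq)) H block)

    -- A chordless cycle on 2t + 1 vertices has 2t + 1 edges, so (k - 2) t = 2.
    from-chordless : ∀ t c → OddCycle (Adj G) t c → suc (suc (2 * t)) ≡ k * t → CaseB G ⊎ CaseC G
    from-chordless 0 c cyc eq = ⊥-elim (0≢1+n (trans (sym (*-zeroʳ k)) (sym eq)))
    from-chordless 1 c cyc eq = inj₂ (cubic (trans (sym (*-identityʳ k)) (sym eq)))
    from-chordless 2 c cyc eq = inj₁ (pentagon (sym (*-cancelʳ-≡ 3 k 2 eq)) cyc)
    from-chordless t@(suc (suc (suc t′))) c cyc eq with 3 ≤? k
    ... | yes k≥3 = ⊥-elim (<⇒≱ (s≤s (s≤s (s≤s z≤n))) (+-cancelʳ-≤ (2 * t) t 2 (≤-trans (*-monoˡ-≤ t k≥3) (≤-reflexive (sym eq)))))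
    ... | no k<3  = ⊥-elim (<⇒≱ (n<1+n _) (≤-trans (n≤1+n _) (≤-trans (≤-reflexive eq) (*-monoˡ-≤ t (≤-pred (≰⇒> k<3))))))

    classification : CaseA G ⊎ CaseB G ⊎ CaseC G
    classification with Colouring.bipartite-or-cycle (whole G) conn
    ... | inj₁ bipartite = inj₁ (bipartite , pred k , λ u ess → cong pred (essential-degree u ess))
    ... | inj₂ (t , c , cyc) with Chordless.chordless t (cycle-map (λ (e , _ , s) → e , s) cyc) ≤-refl
    ... | t′ , c′ , cyc′ , edges = inj₂ (from-chordless t′ c′ cyc′ (trans (cong suc (sym edges)) (cycle-edges c′ cyc′)))

theorem3p3 : (G : Graph) → Connected G →
    (Gorenstein (MatchingPolytope G) → CaseA G ⊎ CaseB G ⊎ CaseC G) ×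
    (CaseA G ⊎ CaseB G ⊎ CaseC G → Gorenstein (MatchingPolytope G))
theorem3p3 G conn = necessary , sufficient
  where
  necessary : Gorenstein (MatchingPolytope G) → CaseA G ⊎ CaseB G ⊎ CaseC G
  necessary (k , α , k≥1 , _ , lattice) = GraphTheory.Necessity.classification G conn k α k≥1 lattice
  sufficient : CaseA G ⊎ CaseB G ⊎ CaseC G → Gorenstein (MatchingPolytope G)
  sufficient (inj₁ a)        = GraphTheory.BipartiteAndPentagon.caseA G a
  sufficient (inj₂ (inj₁ b)) = GraphTheory.BipartiteAndPentagon.caseB G b
  sufficient (inj₂ (inj₂ c)) = GraphTheory.CubicBlocks.gorensteinC G c
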